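{- Let $p\geq5$ be a prime and $G\leq\mathrm{Sym}(\Omega)$ a transitive group with $|\Omega|=3p$ satisfying the assumptions in the context, with $\overline{G}$ $2$-transitive. Then $\rho(G)=1$, unless $p=q+1$ is a Fermat prime (for a prime power $q$) and $\mathrm{PSL}(2,q)\leq\overline{G}\leq\mathrm{P\Gamma L}(2,q)$.
   Context: Assumptions: the only non-trivial $G$-invariant partition of $\Omega$ is $\mathcal{B}=\{B_1,\dots,B_p\}$ with $|B_i|=3$; $\overline{G}\leq\mathrm{Sym}(\mathcal{B})$ is the permutation group induced by $G$ on $\mathcal{B}$ and $K=\ker(G\to\overline{G})$ is the kernel of this action; $K\neq1$, $K$ contains no derangement (every element of $K$ fixes some point of $\Omega$), and every minimal normal subgroup of $G$ contained in $K$ is an elementary abelian $3$-group. Here $\mathrm{PSL}(2,q)\leq\mathrm{P\Gamma L}(2,q)$ act on the $q+1$ points of the projective line. The intersection density is $\rho(G)=\max\{|\mathcal{F}|:\mathcal{F}\subseteq G\text{ intersecting}\}/|G_\omega|$, where $\mathcal{F}$ is intersecting if any two of its elements agree on some point of $\Omega$ and $G_\omega$ is a point stabilizer. -}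

module Defs where

open import Data.Nat using (ℕ; zero; suc; _+_; _*_; _^_; _≤_; _<_; _⊔_)
open import Data.Nat.Primality using (Prime)
open import Data.Fin using (Fin)
open import Data.Fin.Properties using (any?) renaming (_≟_ to _≟ᶠ_)
open import Data.Vec using (Vec; lookup; tabulate)
open import Data.List using (List; []; _∷_; [_]; map; _++_; length; filter; foldr)
open import Data.List.Membership.Propositional using (_∈_)
open import Data.List.Relation.Unary.All using (All)
open import Data.List.Relation.Unary.AllPairs using (AllPairs; allPairs?)
open import Data.List.Relation.Unary.Unique.Propositional using (Unique)
open import Data.Maybe using (Maybe; just; nothing)
open import Data.Product using (Σ; ∃; _×_; _,_)
open import Relation.Nullary using (¬_; yes; no)
open import Relation.Binary.PropositionalEquality using (_≡_; _≢_)
open import Algebra.Structures using (IsCommutativeRing)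
open import Function.Bundles using (_↔_; Inverse)

Perm : ℕ → Set
Perm n = Vec (Fin n) n

app : ∀ {n} → Perm n → Fin n → Fin n
app σ i = lookup σ i

IsPerm : ∀ {n} → Perm n → Set
IsPerm {n} σ = ∀ (i j : Fin n) → app σ i ≡ app σ j → i ≡ j

idP : ∀ {n} → Perm n
idP = tabulate (λ i → i)

_∘P_ : ∀ {n} → Perm n → Perm n → Perm n
σ ∘P τ = tabulate (λ i → app σ (app τ i))

-- A (finite) permutation group on Fin n: a duplicate-free list of
-- permutations containing the identity and closed under composition
-- (for a finite set of permutations this is exactly a subgroup of Sym(n)).
record PermGroup (n : ℕ) : Set where
  field
    elems  : List (Perm n)
    uniq   : Unique elems
    perms  : All IsPerm elems
    hasId  : idP ∈ elems
    closed : ∀ {σ τ} → σ ∈ elems → τ ∈ elems → (σ ∘P τ) ∈ elems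
open PermGroup public

Transitive : ∀ {n} → PermGroup n → Set
Transitive {n} G = ∀ (i j : Fin n) → ∃ λ σ → σ ∈ elems G × app σ i ≡ j

_⊆G_ : ∀ {n} → PermGroup n → PermGroup n → Set
H ⊆G G = All (λ h → h ∈ elems G) (elems H)

Nontrivial : ∀ {n} → PermGroup n → Set
Nontrivial H = ∃ λ h → h ∈ elems H × h ≢ idP

Normal : ∀ {n} → PermGroup n → PermGroup n → Set
Normal H G = H ⊆G G ×
  (∀ {g h} → g ∈ elems G → h ∈ elems H → ∃ λ h' → h' ∈ elems H × (g ∘P h) ≡ (h' ∘P g))

MinimalNormal : ∀ {n} → PermGroup n → PermGroup n → Set
MinimalNormal {n} H G = Normal H G × Nontrivial H ×
  ((N : PermGroup n) → Normal N G → Nontrivial N → N ⊆G H → H ⊆G N)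

ElemAbelian3 : ∀ {n} → PermGroup n → Set
ElemAbelian3 H =
  (∀ {h h'} → h ∈ elems H → h' ∈ elems H → (h ∘P h') ≡ (h' ∘P h)) ×
  (∀ {h} → h ∈ elems H → (h ∘P (h ∘P h)) ≡ idP)

-- Partitions of Fin n are given as kernels of labelling maps.

Invariant : ∀ {n m} → PermGroup n → (Fin n → Fin m) → Set
Invariant {n} G lab = ∀ {σ} → σ ∈ elems G → ∀ (i j : Fin n) →
  lab i ≡ lab j → lab (app σ i) ≡ lab (app σ j)

NontrivialPartition : ∀ {n m} → (Fin n → Fin m) → Set
NontrivialPartition {n} lab =
  (∃ λ (i : Fin n) → ∃ λ j → lab i ≢ lab j) ×
  (∃ λ (i : Fin n) → ∃ λ j → i ≢ j × lab i ≡ lab j)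

SamePartition : ∀ {n m k} → (Fin n → Fin m) → (Fin n → Fin k) → Set
SamePartition {n} lab lab' = ∀ (i j : Fin n) →
  (lab i ≡ lab j → lab' i ≡ lab' j) × (lab' i ≡ lab' j → lab i ≡ lab j)

blockSize : ∀ {n m} → (Fin n → Fin m) → Fin m → ℕ
blockSize {n} lab b = length (filter (λ i → lab i ≟ᶠ b) (Data.List.tabulate {n = n} (λ i → i)))
  where import Data.List

InKernel : ∀ {n m} → (Fin n → Fin m) → Perm n → Set
InKernel {n} blk σ = ∀ (i : Fin n) → blk (app σ i) ≡ blk i

TwoTransitiveOnBlocks : ∀ {n m} → PermGroup n → (Fin n → Fin m) → Set
TwoTransitiveOnBlocks {n} G blk = ∀ (i j k l : Fin n) →
  blk i ≢ blk j → blk k ≢ blk l →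
  ∃ λ σ → σ ∈ elems G × blk (app σ i) ≡ blk k × blk (app σ j) ≡ blk l

Agree : ∀ {n} → Perm n → Perm n → Set
Agree {n} σ τ = ∃ λ (i : Fin n) → app σ i ≡ app τ i

Intersecting : ∀ {n} → List (Perm n) → Set
Intersecting F = AllPairs Agree F

sublists : ∀ {A : Set} → List A → List (List A)
sublists [] = [ [] ]
sublists (x ∷ xs) = map (x ∷_) (sublists xs) ++ sublists xs

maxIntersecting : ∀ {n} → PermGroup n → ℕ
maxIntersecting {n} G =
  foldr _⊔_ 0 (map length (filter (allPairs? (λ σ τ → any? (λ i → app σ i ≟ᶠ app τ i)))
                                  (sublists (elems G))))

stabSize : ∀ {n} → PermGroup n → Fin n → ℕ
stabSize G ω = length (filter (λ σ → app σ ω ≟ᶠ ω) (elems G))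

-- ρ(G) = maxIntersecting G / |G_ω| = 1
DensityOne : ∀ {n} → PermGroup n → Fin n → Set
DensityOne G ω = maxIntersecting G ≡ stabSize G ω

record FiniteField (q : ℕ) : Set where
  field
    _+F_ _*F_ : Fin q → Fin q → Fin q
    -F_       : Fin q → Fin q
    0F 1F     : Fin q
    isCommRing : IsCommutativeRing _≡_ _+F_ _*F_ -F_ 0F 1F
    0≢1       : 0F ≢ 1F
    invF      : Fin q → Fin q
    invF-r    : ∀ x → x ≢ 0F → x *F invF x ≡ 1F
open FiniteField public

module _ {q : ℕ} (F : FiniteField q) where
  private
    _+'_ = _+F_ F
    _*'_ = _*F_ F

  det : (a b c d : Fin q) → Fin q
  det a b c d = (a *' d) +' (-F_ F (b *' c))

  -- x ↦ (a x + b)/(c x + d) on the projective line Maybe (Fin q), nothing = ∞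
  mobius : (a b c d : Fin q) → Maybe (Fin q) → Maybe (Fin q)
  mobius a b c d (just x) with (c *' x) +' d ≟ᶠ 0F F
  ... | yes _ = nothing
  ... | no _  = just (((a *' x) +' b) *' invF F ((c *' x) +' d))
  mobius a b c d nothing with c ≟ᶠ 0F F
  ... | yes _ = nothing
  ... | no _  = just (a *' invF F c)

  IsFieldAut : (Fin q → Fin q) → Set
  IsFieldAut φ = (∀ x y → φ (x +' y) ≡ φ x +' φ y) × (∀ x y → φ (x *' y) ≡ φ x *' φ y) ×
                 φ (1F F) ≡ 1F F × (∀ x y → φ x ≡ φ y → x ≡ y) × (∀ y → ∃ λ x → φ x ≡ y)

  liftM : (Fin q → Fin q) → Maybe (Fin q) → Maybe (Fin q)
  liftM φ (just x) = just (φ x)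
  liftM φ nothing  = nothing


-- PSL(2,q) ≤ Ḡ ≤ PΓL(2,q) (as permutation groups, up to relabelling the
-- blocks by the points of the projective line over a field of order q)
PSLBetween : ∀ {n p} → PermGroup n → (Fin n → Fin p) → ℕ → Set
PSLBetween {n} {p} G blk q = Σ (FiniteField q) λ F → Σ (Fin p ↔ Maybe (Fin q)) λ β →
  let b : Fin n → Maybe (Fin q)
      b i = Inverse.to β (blk i) in
  -- PSL(2,q) ≤ Ḡ : Möbius maps with ad - bc a nonzero square
  (∀ (a bb c d e : Fin q) → e ≢ 0F F → det F a bb c d ≡ _*F_ F e e →
     ∃ λ σ → σ ∈ elems G × (∀ (i : Fin n) → b (app σ i) ≡ mobius F a bb c d (b i))) ×
  (∀ {σ} → σ ∈ elems G → ∃ λ (a : Fin q) → ∃ λ bb → ∃ λ c → ∃ λ d → ∃ λ φ →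
     det F a bb c d ≢ 0F F × IsFieldAut F φ ×
     (∀ (i : Fin n) → b (app σ i) ≡ mobius F a bb c d (liftM F φ (b i))))

IsPrimePower : ℕ → Set
IsPrimePower q = ∃ λ r → ∃ λ k → Prime r × q ≡ r ^ suc k

IsFermatPrime : ℕ → Set
IsFermatPrime p = Prime p × ∃ λ k → p ≡ 2 ^ (2 ^ k) + 1

Exception : ∀ {n p} → PermGroup n → (Fin n → Fin p) → Set
Exception {p = p} G blk = ∃ λ q → IsPrimePower q × p ≡ q + 1 × IsFermatPrime p × PSLBetween G blk q

-- Let N be a minimal normal subgroup of G inside K, and x ∈ G of order p. The points are then
-- P i a = xⁱ n₀ᵃ o (i mod p, a ∈ F₃), every ν ∈ N adds to a a value val ν i depending on i only, and
-- the words val ν form a cyclic ternary code C on which G acts by monomial maps, doubly transitively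
-- on coordinates. As K has no derangement, no word of C is full.
--
-- If no element of G induced i ↦ k i on the blocks with k ≢ 1, the conjugates of the powers of x̄
-- would leave only |Ḡ|/p elements of Ḡ, too few to contain different point stabilisers (Burnside). Such
-- elements lift to G, because p ∤ |K|. The multiplier −1 is impossible: it makes C reversible, hence
-- C ∩ C^⊥ = 0, so every coordinate functional is represented by a word of C, and double transitivity
-- of the matrix of these words produces a full word. So some t ∈ G has multiplier k with k² ≢ ±1, and
-- s = t² acts by s (P i a) = P (k² i) (a + τ).
--
-- Let X be the family of the elements n xⁱ sʲ with n ∈ N, i < p, j < 3. If elements of X with different
-- powers j agree somewhere, they do so in a single block, which confines n to a third of N. Hence
-- every intersecting family F meets every translate of X in at most |N| elements, so that
-- |F| · 3p|N| ≤ |G| · |N|, which is |F| ≤ |G_ω|.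
{-# OPTIONS --safe #-}
module Submission where

open import Defs
open import Data.Nat using (ℕ; zero; suc; _+_; _*_; _∸_; _≤_; _<_; _⊔_; pred; z≤n; s≤s; s≤s⁻¹; z<s; NonZero; >-nonZero; nonTrivial⇒n>1)
open import Data.Nat.Properties
open import Data.Nat.Divisibility using (_∣_; divides; ∣-refl; ∣-trans; ∣m∣n⇒∣m+n; ∣m+n∣m⇒∣n; n∣m*n; m∣m*n; ∣1⇒≡1)
open import Data.Nat.Primality using (Prime; prime⇒nonZero; prime⇒nonTrivial; prime⇒irreducible)
open import Data.Nat.Coprimality using (coprime-Bézout; prime⇒coprime; Coprime)
open import Data.Nat.GCD using (module Bézout)
open import Data.Nat.GeneralisedArithmetic using (fold; fold-+)
open import Data.Fin using (Fin; zero; suc; toℕ; fromℕ<)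
open import Data.Fin.Properties using (any?; all?; toℕ<n; toℕ-injective; toℕ-fromℕ<) renaming (_≟_ to _≟ᶠ_)
open import Data.Vec using (Vec; lookup; tabulate)
open import Data.Vec.Properties using (lookup∘tabulate; tabulate∘lookup; tabulate-cong)
import Data.Vec.Properties as Vec
import Data.List
open import Data.List using (List; []; _∷_; [_]; map; _++_; length; filter; foldr; upTo; applyUpTo; allFin; cartesianProduct; replicate)
open import Data.List.Properties using (length-map; length-++; ++-assoc; length-upTo; length-applyUpTo; filter-notAll; ∷-injective; ++-identityʳ; ≡-dec; length-replicate; length-tabulate)
open import Data.List.Membership.Propositional using (_∈_; _∉_; find; lose)
open import Data.List.Membership.Propositional.Properties
import Data.List.Membership.DecPropositional as DecMembership
open import Data.List.Relation.Unary.Any using (here; there)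
open import Data.List.Relation.Unary.All using (All; []; _∷_)
open import Data.List.Relation.Unary.Any.Properties using (lookup-index)
import Data.List.Relation.Unary.Any as Any
import Data.List.Relation.Unary.All as All
import Data.List.Relation.Unary.All.Properties as Allₚ
open import Data.List.Relation.Unary.AllPairs using (AllPairs; []; _∷_; allPairs?)
open import Data.List.Relation.Unary.Unique.Propositional using (Unique)
import Data.List.Relation.Unary.Unique.Propositional.Properties as Uniqueₚ
open import Data.Product using (Σ; ∃; ∃₂; _×_; _,_; proj₁; proj₂)
open import Data.Sum using (_⊎_; inj₁; inj₂)
open import Data.Empty using (⊥; ⊥-elim)
open import Function using (_∘_; id; case_of_)
open import Relation.Nullary using (¬_; Dec; yes; no; contradiction; ¬?)
open import Relation.Nullary.Decidable using (toWitness; _→-dec_; decidable-stable)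
open import Relation.Unary using (Decidable)
open import Relation.Binary using (DecidableEquality; tri<; tri≈; tri>)
open import Relation.Binary.PropositionalEquality hiding ([_])
open import Algebra.Bundles using (Group; CommutativeRing)
open import Algebra.Structures using (IsGroup; IsAbelianGroup)
import Algebra.Properties.Group as GroupProperties
import Algebra.Properties.Semiring.Sum as SemiringSum
import Algebra.Properties.CommutativeMonoid.Sum as MonoidSum
import Data.Fin.Permutation as Permutation
open import Data.Nat.DivMod using (_%_; _mod_; %-distribˡ-+; %-distribˡ-*; m<n⇒m%n≡m; m%n%n≡m%n; m%n<n; m*n%n≡0; m≡m%n+[m/n]*n; _/_; m/n*n≤m; /-monoˡ-≤; m*n/n≡m)
open import Data.Nat.Tactic.RingSolver using (solve-∀)

-- A sharply transitive subset of `G`, with 3p elements, would give the bound at once, since an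
-- intersecting family meets each of its translates at most once. The natural candidate, the
-- products of powers of `x` with powers of one element of N, needs an element of N that moves every
-- point, and the absence of derangements in K rules this out. `X` is the substitute: 3p|N|
-- elements, among which intersecting families have at most |N| members, give the same ratio.
-- Elements with the same j and different i never agree, because they send each block to different
-- blocks, so one power alone contributes at most |N| elements; as soon as two powers occur, each of
-- the three is limited to |N|/3. This balance asks for exactly three multipliers 1, k², k⁴. The
-- square s = t² is taken because t may act on the labels in F₃ with sign -1; its square acts on
-- them by a translation, the same on all blocks. Density one is an equality of natural numbers,
-- hence decidable, so it suffices to have the minimal normal subgroup and the multiplier up to
-- double negation.

variable
  A B : Set

-- Counting with duplicate-free lists

length-≤ : (f : A → B) {xs : List A} {ys : List B} → Unique xs →
  (∀ {x} → x ∈ xs → f x ∈ ys) →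
  (∀ {x y} → x ∈ xs → y ∈ xs → f x ≡ f y → x ≡ y) → length xs ≤ length ys
length-≤ f {[]} _ _ _ = z≤n
length-≤ f {x ∷ xs} (x∉xs ∷ u) to inj with ∈-∃++ (to (here refl))
... | as , bs , refl = begin
  suc (length xs)               ≤⟨ s≤s (length-≤ f u to′ (λ i j → inj (there i) (there j))) ⟩
  suc (length (as ++ bs))       ≡⟨ cong suc (length-++ as) ⟩
  suc (length as + length bs)   ≡⟨ sym (+-suc _ _) ⟩
  length as + suc (length bs)   ≡⟨ sym (length-++ as) ⟩
  length (as ++ f x ∷ bs)       ∎
  where
  open ≤-Reasoning
  to′ : ∀ {y} → y ∈ xs → f y ∈ as ++ bs
  to′ {y} y∈ with ∈-++⁻ as (to (there y∈))
  ... | inj₁ i = ∈-++⁺ˡ i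
  ... | inj₂ (there i) = ∈-++⁺ʳ as i
  ... | inj₂ (here fy≡fx) =
    contradiction (sym (inj (there y∈) (here refl) fy≡fx)) (All.lookup x∉xs y∈)

⊆-length : {xs ys : List A} → Unique xs → (∀ {x} → x ∈ xs → x ∈ ys) → length xs ≤ length ys
⊆-length u s = length-≤ id u s (λ _ _ e → e)

map⁺-injectiveOn : {f : A → B} {xs : List A} → Unique xs →
  (∀ {x y} → x ∈ xs → y ∈ xs → f x ≡ f y → x ≡ y) → Unique (map f xs)
map⁺-injectiveOn [] _ = []
map⁺-injectiveOn (x∉ ∷ u) inj =
  Allₚ.map⁺ (All.tabulate λ j e → All.lookup x∉ j (inj (here refl) (there j) e)) ∷
  map⁺-injectiveOn u λ i j → inj (there i) (there j)

-- If `y` were missed, all images would lie in `ys` with `y` filtered out, a strictly shorter list,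
-- against `length-≤`.
injective⇒onto : DecidableEquality B → (f : A → B) {xs : List A} {ys : List B} → Unique xs →
  (∀ {x} → x ∈ xs → f x ∈ ys) →
  (∀ {x y} → x ∈ xs → y ∈ xs → f x ≡ f y → x ≡ y) → length ys ≤ length xs →
  ∀ {y} → y ∈ ys → ∃ λ x → x ∈ xs × f x ≡ y
injective⇒onto _≟_ f {xs} {ys} u to inj l {y} y∈ with Any.any? (λ x → f x ≟ y) xs
... | yes a = find a
... | no ¬a = contradiction
  (<-≤-trans (filter-notAll ≢y? ys (Any.map (λ { refl n → n refl }) y∈)) l)
  (≤⇒≯ (length-≤ f u (λ {x} i → ∈-filter⁺ ≢y? (to i) λ e → ¬a (lose i e)) inj))
  where ≢y? = λ z → ¬? (z ≟ y)

filter-split : {P : A → Set} (P? : Decidable P) (xs : List A) →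
  length xs ≡ length (filter P? xs) + length (filter (¬? ∘ P?) xs)
filter-split P? [] = refl
filter-split P? (x ∷ xs) with P? x
... | yes _ = cong suc (filter-split P? xs)
... | no _ = trans (cong suc (filter-split P? xs)) (sym (+-suc _ _))

length-×-product : (xs : List A) (ys : List B) →
  length (cartesianProduct xs ys) ≡ length xs * length ys
length-×-product [] ys = refl
length-×-product (x ∷ xs) ys = trans (length-++ (map (x ,_) ys))
  (cong₂ _+_ (length-map (x ,_) ys) (length-×-product xs ys))

fibre-bound : (_≟_ : DecidableEquality B) (f : A → B) {b : ℕ} (ys : List B) {xs : List A} →
  Unique xs → (∀ {x} → x ∈ xs → f x ∈ ys) →
  (∀ y → length (filter (λ x → f x ≟ y) xs) ≤ b) → length xs ≤ length ys * b
fibre-bound _≟_ f [] {[]} _ _ _ = z≤n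
fibre-bound _≟_ f [] {x ∷ xs} _ to _ with () ← to (here refl)
fibre-bound _≟_ f {b} (y ∷ ys) {xs} u to bound = begin
  length xs                          ≡⟨ filter-split (λ x → f x ≟ y) xs ⟩
  length (filter (λ x → f x ≟ y) xs) + length rest
    ≤⟨ +-mono-≤ (bound y) (fibre-bound _≟_ f ys u′ to′ bound′) ⟩
  b + length ys * b                  ∎
  where
  open ≤-Reasoning
  rest? = λ x → ¬? (f x ≟ y)
  rest = filter rest? xs
  u′ = Uniqueₚ.filter⁺ rest? u
  to′ : ∀ {x} → x ∈ rest → f x ∈ ys
  to′ x∈ with ∈-filter⁻ rest? x∈
  ... | i , ne with to i
  ... | here e = contradiction e ne
  ... | there j = j
  bound′ : ∀ z → length (filter (λ x → f x ≟ z) rest) ≤ b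
  bound′ z = ≤-trans (⊆-length (Uniqueₚ.filter⁺ (λ x → f x ≟ z) u′) λ i →
    let (j , e) = ∈-filter⁻ (λ x → f x ≟ z) {xs = rest} i in
    ∈-filter⁺ (λ x → f x ≟ z) (proj₁ (∈-filter⁻ rest? {xs = xs} j)) e) (bound z)

-- Iterates of a map of prime order

module _ {A : Set} (f : A → A) where

  fold-fix : ∀ {t} m d → fold t f d ≡ t → fold t f (m * d) ≡ t
  fold-fix zero d e = refl
  fold-fix {t} (suc m) d e =
    trans (fold-+ t f d) (trans (cong (λ z → fold z f d) (fold-fix m d e)) e)

  -- By Bézout a multiple of one period exceeds a multiple of the other by one, so a single
  -- application of `f` completes a full round.
  fold-coprime : ∀ {t d p} → Coprime p d → fold t f d ≡ t → fold t f p ≡ t → f t ≡ t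
  fold-coprime {t} {d} {p} c ed ep with coprime-Bézout c
  ... | Bézout.+- a b eq = trans (cong f (sym (fold-fix b d ed)))
    (trans (cong (fold t f) eq) (fold-fix a p ep))
  ... | Bézout.-+ a b eq = trans (cong f (sym (fold-fix a p ep)))
    (trans (cong (fold t f) eq) (fold-fix b d ed))

  fold-comm : ∀ t n → f (fold t f n) ≡ fold (f t) f n
  fold-comm t zero = refl
  fold-comm t (suc n) = cong f (fold-comm t n)

  -- A repetition at i < j gives the point at i the coprime periods `j ∸ i` and `p`, so `f` fixes
  -- it. Completing the round of length `p` leads from this fixed point back to `t`, which moves.
  orbit-unique : ∀ {t p} → Prime p → fold t f p ≡ t → f t ≢ t → Unique (applyUpTo (fold t f) p)
  orbit-unique {t} {p} pr ord mv = Uniqueₚ.applyUpTo⁺₁ (fold t f) p λ {i} {j} i<j j<p e →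
    mv (trans (sym (back i (<-trans i<j j<p) (fold-coprime
      (prime⇒coprime pr {{>-nonZero (m<n⇒0<n∸m i<j)}} (≤-<-trans (m∸n≤m j i) j<p))
      (trans (sym (fold-+ t f (j ∸ i))) (trans (cong (fold t f) (m∸n+n≡m (<⇒≤ i<j))) (sym e)))
      (trans (sym (fold-+ t f p)) (trans (cong (fold t f) (+-comm p i))
        (trans (fold-+ t f i) (cong (λ z → fold z f i) ord))))))) refl)
    where
    back : ∀ i → i < p → f (fold t f i) ≡ fold t f i → t ≡ f t
    back i i<p e = trans (sym (around i i<p)) (trans (cong (λ z → fold z f (p ∸ i)) (sym e))
      (trans (sym (fold-comm (fold t f i) (p ∸ i))) (cong f (around i i<p))))
      where
      around : ∀ i → i < p → fold (fold t f i) f (p ∸ i) ≡ t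
      around i i<p = trans (sym (fold-+ t f (p ∸ i))) (trans (cong (fold t f) (m∸n+n≡m (<⇒≤ i<p))) ord)

  module _ {p : ℕ} (pr : Prime p) (_≟_ : DecidableEquality A) where

    private
      module M = DecMembership _≟_
      p≡1+ : p ≡ suc (pred p)
      p≡1+ = sym (suc-pred p {{prime⇒nonZero pr}})

      record Closed (T : List A) : Set where
        field
          unique : Unique T
          to     : ∀ {x} → x ∈ T → f x ∈ T
          order  : ∀ {x} → x ∈ T → fold x f p ≡ x
          moves  : ∀ {x} → x ∈ T → f x ≢ x

      module Orbit {T : List A} (C : Closed T) {t : A} (t∈ : t ∈ T) where
        open Closed C

        fold∈ : ∀ i → fold t f i ∈ T
        fold∈ zero = t∈
        fold∈ (suc i) = to (fold∈ i)

        orbit : List A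
        orbit = applyUpTo (fold t f) p

        ∉? : Decidable (λ x → x ∉ orbit)
        ∉? x = ¬? (x M.∈? orbit)

        rest : List A
        rest = filter ∉? T

        length-rest : length T ≡ p + length rest
        length-rest = trans (filter-split (M._∈? orbit) T) (cong (_+ length rest) (≤-antisym
          (≤-trans (⊆-length (Uniqueₚ.filter⁺ (M._∈? orbit) unique)
            (proj₂ ∘ ∈-filter⁻ (M._∈? orbit) {xs = T}))
                   (≤-reflexive (length-applyUpTo (fold t f) p)))
          (≤-trans (≤-reflexive (sym (length-applyUpTo (fold t f) p)))
            (⊆-length (orbit-unique pr (order t∈) (moves t∈)) λ {x} i → ∈-filter⁺ (M._∈? orbit) (orbit⊆ i) i))))
          where
          orbit⊆ : ∀ {x} → x ∈ orbit → x ∈ T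
          orbit⊆ i with ∈-applyUpTo⁻ (fold t f) i
          ... | k , _ , refl = fold∈ k

        -- This keeps the complement of an orbit stable under `f`. On `T` the map is injective
        -- because `pred p` further steps undo it; what precedes `t` is the last point of the orbit.
        closed-back : ∀ {x} → x ∈ T → f x ∈ orbit → x ∈ orbit
        closed-back {x} x∈ i with ∈-applyUpTo⁻ (fold t f) i
        ... | suc k , k<p , e = subst (_∈ orbit) (f-inj (fold∈ k) x∈ (sym e))
              (∈-applyUpTo⁺ (fold t f) (<-trans (n<1+n k) k<p))
          where
          f-inj : ∀ {x y} → x ∈ T → y ∈ T → f x ≡ f y → x ≡ y
          f-inj {x} {y} i j e = trans (sym (order i)) (trans (cong (fold x f) p≡1+)
            (trans (fold-comm x (pred p)) (trans (cong (λ z → fold z f (pred p)) e)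
            (trans (sym (fold-comm y (pred p))) (trans (sym (cong (fold y f) p≡1+)) (order j))))))
        ... | zero , 0<p , e = subst (_∈ orbit) x≡
              (∈-applyUpTo⁺ (fold t f) (subst (pred p <_) (sym p≡1+) (n<1+n _)))
          where
          x≡ : fold t f (pred p) ≡ x
          x≡ = trans (cong (λ z → fold z f (pred p)) (sym e)) (trans (sym (fold-comm x (pred p)))
            (trans (sym (cong (fold x f) p≡1+)) (order x∈)))

        rest-closed : Closed rest
        rest-closed = record
          { unique = Uniqueₚ.filter⁺ ∉? unique
          ; to = λ i → let (j , n) = ∈-filter⁻ ∉? i in ∈-filter⁺ ∉? (to j) (n ∘ closed-back j)
          ; order = order ∘ proj₁ ∘ ∈-filter⁻ ∉?
          ; moves = moves ∘ proj₁ ∘ ∈-filter⁻ ∉?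
          }

      go : ∀ fuel T → length T ≤ fuel → Closed T → p ∣ length T
      go _ [] _ _ = divides 0 refl
      go (suc fuel) T@(t ∷ ts) (s≤s l) C = subst (p ∣_) (sym length-rest)
        (∣m∣n⇒∣m+n ∣-refl (go fuel rest rest≤ rest-closed))
        where
        open Orbit C (here refl)
        rest≤ : length rest ≤ fuel
        rest≤ = ≤-trans (s≤s⁻¹ (subst (suc (length rest) ≤_) (sym length-rest)
          (subst (λ z → suc (length rest) ≤ z + length rest) (sym p≡1+) (s≤s (m≤n+m _ (pred p)))))) l

    -- Each orbit has exactly `p` points, and removing one leaves a list of the same kind; the
    -- length is the fuel of the recursion.
    fixed-point-free⇒∣length : ∀ {T} → Unique T → (∀ {x} → x ∈ T → f x ∈ T) →
      (∀ {x} → x ∈ T → fold x f p ≡ x) → (∀ {x} → x ∈ T → f x ≢ x) → p ∣ length T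
    fixed-point-free⇒∣length {T} u to ord mv = go (length T) T ≤-refl
      (record { unique = u ; to = to ; order = ord ; moves = mv })

    fixed-point : ∀ {T} → Unique T → (∀ {x} → x ∈ T → f x ∈ T) →
      (∀ {x} → x ∈ T → fold x f p ≡ x) → ¬ p ∣ length T → ∃ λ x → x ∈ T × f x ≡ x
    fixed-point {T} u to ord p∤ with Any.any? (λ x → f x ≟ x) T
    ... | yes a = find a
    ... | no ¬a = contradiction (fixed-point-free⇒∣length u to ord λ i e →
        ¬a (lose i e)) p∤

-- Finite groups and Cauchy's theorem

module FiniteGroup {A : Set} {_∙_ : A → A → A} {ε : A} {_⁻¹ : A → A}
  (isGroup : IsGroup _≡_ _∙_ ε _⁻¹) (_≟_ : DecidableEquality A) where

  open IsGroup isGroup public using (assoc; identityˡ; identityʳ; inverseˡ; inverseʳ)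

  group : Group _ _
  group = record { isGroup = isGroup }

  open GroupProperties group public
    using (∙-cancelˡ; ∙-cancelʳ; ⁻¹-anti-homo-∙; ⁻¹-involutive; inverseʳ-unique)

  _^_ : A → ℕ → A
  a ^ n = fold ε (a ∙_) n

  ^-+ : ∀ a m n → a ^ (m + n) ≡ (a ^ m) ∙ (a ^ n)
  ^-+ a zero n = sym (identityˡ _)
  ^-+ a (suc m) n = trans (cong (a ∙_) (^-+ a m n)) (sym (assoc _ _ _))

  ^-* : ∀ a m n → a ^ (m * n) ≡ (a ^ n) ^ m
  ^-* a zero n = refl
  ^-* a (suc m) n = trans (^-+ a n (m * n)) (cong ((a ^ n) ∙_) (^-* a m n))

  ε^ : ∀ n → ε ^ n ≡ ε
  ε^ zero = refl
  ε^ (suc n) = trans (identityˡ _) (ε^ n)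

  ^-suc : ∀ a n → a ^ suc n ≡ (a ^ n) ∙ a
  ^-suc a n = trans (cong (a ^_) (+-comm 1 n)) (trans (^-+ a n 1) (cong ((a ^ n) ∙_) (identityʳ a)))

  ⁻¹-^ : ∀ a n → (a ^ n) ∙ ((a ⁻¹) ^ n) ≡ ε
  ⁻¹-^ a zero = identityˡ ε
  ⁻¹-^ a (suc n) = trans (cong (_∙ ((a ⁻¹) ^ suc n)) (^-suc a n)) (trans (assoc (a ^ n) a _)
    (trans (cong ((a ^ n) ∙_) (trans (sym (assoc a (a ⁻¹) _)) (trans (cong (_∙ ((a ⁻¹) ^ n)) (inverseʳ a)) (identityˡ _))))
    (⁻¹-^ a n)))

  conjugate-^ : ∀ a b n → (((a ∙ b) ∙ (a ⁻¹)) ^ n) ∙ a ≡ a ∙ (b ^ n)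
  conjugate-^ a b zero = trans (identityˡ a) (sym (identityʳ a))
  conjugate-^ a b (suc n) = trans (assoc _ _ a) (trans (cong (((a ∙ b) ∙ (a ⁻¹)) ∙_) (conjugate-^ a b n))
    (trans (assoc (a ∙ b) (a ⁻¹) _) (trans (cong ((a ∙ b) ∙_) (trans (sym (assoc (a ⁻¹) a _))
      (trans (cong (_∙ (b ^ n)) (inverseˡ a)) (identityˡ _)))) (assoc a b _))))

  ^-twist : ∀ {s x k} → s ∙ x ≡ (x ^ k) ∙ s → ∀ n → s ∙ (x ^ n) ≡ (x ^ (n * k)) ∙ s
  ^-twist {s} e zero = trans (identityʳ s) (sym (identityˡ s))
  ^-twist {s} {x} {k} e (suc n) = trans (sym (assoc s x _)) (trans (cong (_∙ (x ^ n)) e)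
    (trans (assoc (x ^ k) s _) (trans (cong ((x ^ k) ∙_) (^-twist e n))
    (trans (sym (assoc (x ^ k) _ s)) (cong (_∙ s) (sym (^-+ x k (n * k))))))))

  private
    prod : List A → A
    prod = foldr _∙_ ε

    prod-snoc : ∀ l a → prod (l ++ [ a ]) ≡ prod l ∙ a
    prod-snoc [] a = trans (identityʳ a) (sym (identityˡ a))
    prod-snoc (b ∷ l) a = trans (cong (b ∙_) (prod-snoc l a)) (sym (assoc _ _ _))

    prod-replicate : ∀ n a → prod (replicate n a) ≡ a ^ n
    prod-replicate zero a = refl
    prod-replicate (suc n) a = cong (a ∙_) (prod-replicate n a)

    rot : List A → List A
    rot [] = []
    rot (a ∷ l) = l ++ [ a ]

    -- The tail `w` is carried along for the induction; with `w` empty, a tuple returns to itself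
    -- after as many rotations as it has entries.
    rot-fold : ∀ u w → fold (u ++ w) rot (length u) ≡ w ++ u
    rot-fold [] w = sym (++-identityʳ w)
    rot-fold (a ∷ u) w = trans (fold-comm rot (a ∷ u ++ w) (length u))
      (trans (cong (λ z → fold z rot (length u)) (++-assoc u w [ a ]))
      (trans (rot-fold u (w ++ [ a ])) (++-assoc w [ a ] u)))

    rot-order : ∀ l → fold l rot (length l) ≡ l
    rot-order l = trans (cong (λ z → fold z rot (length l)) (sym (++-identityʳ l))) (rot-fold l [])

    rot-fixed : ∀ (a : A) l → l ++ [ a ] ≡ a ∷ l → l ≡ replicate (length l) a
    rot-fixed a [] e = refl
    rot-fixed a (b ∷ l) e with ∷-injective e
    ... | refl , e′ = cong (b ∷_) (rot-fixed b l e′)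

  -- McKay's argument: rotate the p-tuples of product ε.
  module Cauchy {L : List A} (uL : Unique L) (ε∈ : ε ∈ L)
    (∙∈ : ∀ {a b} → a ∈ L → b ∈ L → (a ∙ b) ∈ L) (⁻¹∈ : ∀ {a} → a ∈ L → (a ⁻¹) ∈ L)
    {p : ℕ} (pr : Prime p) (p∣ : p ∣ length L) where

    private
      cons : A × List A → List A
      cons (a , l) = a ∷ l

      tuples : ℕ → List (List A)
      tuples zero = [ [] ]
      tuples (suc n) = map cons (cartesianProduct L (tuples n))

      tuples-unique : ∀ n → Unique (tuples n)
      tuples-unique zero = [] ∷ []
      tuples-unique (suc n) = Uniqueₚ.map⁺ (λ { refl → refl })
        (Uniqueₚ.cartesianProduct⁺ uL (tuples-unique n))

      tuples⁺ : ∀ {l} → All (_∈ L) l → l ∈ tuples (length l)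
      tuples⁺ [] = here refl
      tuples⁺ (i ∷ is) = ∈-map⁺ _ (∈-cartesianProduct⁺ i (tuples⁺ is))

      tuples⁻ : ∀ n {l} → l ∈ tuples n → length l ≡ n × All (_∈ L) l
      tuples⁻ zero (here refl) = refl , []
      tuples⁻ (suc n) i with ∈-map⁻ _ i
      ... | (a , l) , j , refl with ∈-cartesianProduct⁻ L (tuples n) j
      ... | k , m with tuples⁻ n m
      ... | e , al = cong suc e , k ∷ al

      p≡1+ : suc (pred p) ≡ p
      p≡1+ = suc-pred p {{prime⇒nonZero pr}}

      1<p : 1 < p
      1<p = nonTrivial⇒n>1 p {{prime⇒nonTrivial pr}}

      p∣tuples : ∀ {n} → 0 < n → p ∣ length (tuples n)
      p∣tuples {suc n} _ = subst (p ∣_) (sym (trans (length-map _ (cartesianProduct L (tuples n)))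
        (length-×-product L (tuples n)))) (∣-trans p∣ (m∣m*n _))

      -- The first entry is forced by the others, so the tuples with product `ε` correspond to all
      -- tuples of length `pred p`, and their number is a multiple of `p`.
      close : List A → List A
      close l = (prod l ⁻¹) ∷ l

      T : List (List A)
      T = map close (tuples (pred p))

      T-unique : Unique T
      T-unique = Uniqueₚ.map⁺ (λ e → proj₂ (∷-injective e)) (tuples-unique (pred p))

      T⁻ : ∀ {l} → l ∈ T → length l ≡ p × All (_∈ L) l × prod l ≡ ε
      T⁻ i with ∈-map⁻ close i
      ... | l , j , refl with tuples⁻ (pred p) j
      ... | e , al = trans (cong suc e) p≡1+ , ⁻¹∈ (prod∈ al) ∷ al , inverseˡ _
        where
        prod∈ : ∀ {l} → All (_∈ L) l → prod l ∈ L
        prod∈ [] = ε∈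
        prod∈ (i ∷ is) = ∙∈ i (prod∈ is)

      T⁺ : ∀ {l} → length l ≡ p → All (_∈ L) l → prod l ≡ ε → l ∈ T
      T⁺ {[]} e _ _ = contradiction (trans p≡1+ (sym e)) λ ()
      T⁺ {a ∷ l} e (_ ∷ al) pe = subst (_∈ T)
        (cong (_∷ l) (sym (trans (sym (⁻¹-involutive a)) (cong _⁻¹ (sym (inverseʳ-unique a _ pe))))))
        (∈-map⁺ close (subst (λ n → l ∈ tuples n) (suc-injective (trans e (sym p≡1+))) (tuples⁺ al)))

      _≟ₗ_ : DecidableEquality (List A)
      _≟ₗ_ = ≡-dec _≟_

      ones : List A
      ones = replicate p ε

      ones∈ : ones ∈ T
      ones∈ = T⁺ (length-replicate p) (Allₚ.replicate⁺ p ε∈) (trans (prod-replicate p ε) (ε^ p))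

      ≢ones? : Decidable (_≢ ones)
      ≢ones? l = ¬? (l ≟ₗ ones)

      T′ : List (List A)
      T′ = filter ≢ones? T

      T≡ : length T ≡ 1 + length T′
      T≡ = trans (filter-split (_≟ₗ ones) T) (cong (_+ length T′) (≤-antisym
        (⊆-length {ys = [ ones ]} (Uniqueₚ.filter⁺ (_≟ₗ ones) T-unique)
          (λ i → here (proj₂ (∈-filter⁻ (_≟ₗ ones) {xs = T} i))))
        (⊆-length ([] ∷ []) λ { (here refl) → ∈-filter⁺ (_≟ₗ ones) ones∈ refl })))

      -- Only the constant tuple `ones` is dropped from `T`, whose length is a multiple of `p`; if
      -- `p` divided the rest it would divide 1.
      p∤T′ : ¬ p ∣ length T′
      p∤T′ d = <⇒≢ 1<p (sym (∣1⇒≡1 (∣m+n∣m⇒∣n (subst (p ∣_)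
        (trans (sym (length-map close (tuples (pred p)))) (trans T≡ (+-comm 1 _)))
        (p∣tuples (s≤s⁻¹ (subst (1 <_) (sym p≡1+) 1<p)))) d)))

      rot∈T : ∀ {l} → l ∈ T → rot l ∈ T
      rot∈T {[]} i = i
      rot∈T {a ∷ l} i with T⁻ i
      ... | e , a∈ ∷ al , pe = T⁺
        (trans (length-++ l) (trans (+-comm (length l) 1) e))
        (Allₚ.++⁺ al (a∈ ∷ []))
        (trans (prod-snoc l a) (trans (cong (_∙ a) (inverseʳ-unique a _ pe)) (inverseˡ a)))

      rot-ones : ∀ {l} → length l ≡ p → rot l ≡ ones → l ≡ ones
      rot-ones {l} e r = trans (sym (trans (cong (fold l rot) (sym e)) (rot-order l)))
        (trans (cong (fold l rot) (sym p≡1+)) (trans (fold-comm rot l (pred p))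
        (trans (cong (λ z → fold z rot (pred p)) r) (fix (pred p)))))
        where
        replicate-snoc : ∀ n → replicate n ε ++ [ ε ] ≡ ε ∷ replicate n ε
        replicate-snoc zero = refl
        replicate-snoc (suc n) = cong (ε ∷_) (replicate-snoc n)
        fix₁ : rot ones ≡ ones
        fix₁ = subst (λ n → rot (replicate n ε) ≡ replicate n ε) p≡1+ (replicate-snoc (pred p))
        fix : ∀ n → fold ones rot n ≡ ones
        fix zero = refl
        fix (suc n) = trans (cong rot (fix n)) fix₁

    cauchy : ∃ λ a → a ∈ L × a ≢ ε × a ^ p ≡ ε
    cauchy with fixed-point rot pr _≟ₗ_ (Uniqueₚ.filter⁺ ≢ones? T-unique)
      (λ i → let (j , n) = ∈-filter⁻ ≢ones? {xs = T} i in
         ∈-filter⁺ ≢ones? (rot∈T j) (n ∘ rot-ones (proj₁ (T⁻ j))))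
      (λ {l} i → let e = proj₁ (T⁻ (proj₁ (∈-filter⁻ ≢ones? {xs = T} i))) in
         trans (cong (fold l rot) (sym e)) (rot-order l))
      p∤T′
    ... | l , i , r with ∈-filter⁻ ≢ones? {xs = T} i
    ... | j , l≢ with T⁻ j
    cauchy | [] , _ , _ | _ , _ | e , _ = contradiction (trans p≡1+ (sym e)) λ ()
    cauchy | a ∷ l , _ , r | _ , l≢ | e , a∈ ∷ _ , pe = a , a∈ ,
      (λ { refl → l≢ l≡ }) , trans (sym (prod-replicate p a)) (trans (cong prod (sym l≡)) pe)
      where
      l≡ : a ∷ l ≡ replicate p a
      l≡ = trans (cong (a ∷_) (rot-fixed a l r)) (cong (λ n → replicate n a) e)

-- Permutation groups as abstract groups

app-ext : ∀ {n} {σ τ : Perm n} → (∀ i → app σ i ≡ app τ i) → σ ≡ τ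
app-ext {σ = σ} {τ} e = trans (sym (tabulate∘lookup σ)) (trans (tabulate-cong e) (tabulate∘lookup τ))

_≟ᵖ_ : ∀ {n} → DecidableEquality (Perm n)
_≟ᵖ_ = Vec.≡-dec _≟ᶠ_

lookup-injective : {xs : List A} → Unique xs → ∀ i j →
  Data.List.lookup xs i ≡ Data.List.lookup xs j → i ≡ j
lookup-injective (_ ∷ _) zero zero _ = refl
lookup-injective (x∉ ∷ _) zero (suc j) e = contradiction e (All.lookup x∉ (∈-lookup j))
lookup-injective (x∉ ∷ _) (suc i) zero e = contradiction (sym e) (All.lookup x∉ (∈-lookup i))
lookup-injective (_ ∷ u) (suc i) (suc j) e = cong suc (lookup-injective u i j e)

module Elements {n} (G : PermGroup n) where

  -- Indices instead of permutations paired with membership proofs: their equality is decidable and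
  -- carries no proof component, so the group laws hold for `≡`.
  El : Set
  El = Fin (length (elems G))

  allEl : List El
  allEl = allFin _

  allEl-unique : Unique allEl
  allEl-unique = Uniqueₚ.allFin⁺ _

  allEl-complete : ∀ g → g ∈ allEl
  allEl-complete = ∈-allFin

  perm : El → Perm n
  perm = Data.List.lookup (elems G)

  perm∈ : ∀ g → perm g ∈ elems G
  perm∈ g = ∈-lookup g

  perm-injective : ∀ g h → perm g ≡ perm h → g ≡ h
  perm-injective = lookup-injective (uniq G)

  act : El → Fin n → Fin n
  act g = app (perm g)

  act-injective : ∀ g {i j} → act g i ≡ act g j → i ≡ j
  act-injective g = All.lookup (perms G) (perm∈ g) _ _

  faithful : ∀ {g h} → (∀ i → act g i ≡ act h i) → g ≡ h
  faithful e = perm-injective _ _ (app-ext e)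

  index : ∀ {σ} → σ ∈ elems G → El
  index = Any.index

  perm-index : ∀ {σ} (i : σ ∈ elems G) → perm (index i) ≡ σ
  perm-index i = sym (lookup-index i)

  infixl 7 _∙_

  abstract
    ε : El
    ε = index (hasId G)

    perm-ε : perm ε ≡ idP
    perm-ε = perm-index (hasId G)

    _∙_ : El → El → El
    g ∙ h = index (closed G (perm∈ g) (perm∈ h))

    perm-∙ : ∀ g h → perm (g ∙ h) ≡ (perm g ∘P perm h)
    perm-∙ g h = perm-index (closed G (perm∈ g) (perm∈ h))

  act-∙ : ∀ g h i → act (g ∙ h) i ≡ act g (act h i)
  act-∙ g h i = trans (cong (λ σ → app σ i) (perm-∙ g h)) (lookup∘tabulate _ i)

  act-ε : ∀ i → act ε i ≡ i
  act-ε i = trans (cong (λ σ → app σ i) perm-ε) (lookup∘tabulate _ i)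

  private abstract
    -- Left multiplication by `g` is injective on a finite list, so it reaches `ε`: closure under
    -- products alone supplies inverses.
    right-inverse : ∀ g → ∃ λ h → h ∈ allEl × g ∙ h ≡ ε
    right-inverse g = injective⇒onto _≟ᶠ_ (g ∙_) allEl-unique (λ _ → allEl-complete _)
      (λ {h} {k} _ _ e → faithful λ i → act-injective g
        (trans (sym (act-∙ g h i)) (trans (cong (λ z → act z i) e) (act-∙ g k i))))
      ≤-refl (allEl-complete ε)

  _⁻¹ : El → El
  g ⁻¹ = proj₁ (right-inverse g)

  act-inverseʳ : ∀ g i → act g (act (g ⁻¹) i) ≡ i
  act-inverseʳ g i = trans (sym (act-∙ g _ i))
    (trans (cong (λ z → act z i) (proj₂ (proj₂ (right-inverse g)))) (act-ε i))

  act-inverseˡ : ∀ g i → act (g ⁻¹) (act g i) ≡ i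
  act-inverseˡ g i = act-injective g (act-inverseʳ g (act g i))

  isGroup : IsGroup _≡_ _∙_ ε _⁻¹
  isGroup = record
    { isMonoid = record
      { isSemigroup = record
        { isMagma = record { isEquivalence = isEquivalence ; ∙-cong = cong₂ _∙_ }
        ; assoc = λ g h k → faithful λ i → trans (act-∙ (g ∙ h) k i) (trans (act-∙ g h _)
            (sym (trans (act-∙ g (h ∙ k) i) (cong (act g) (act-∙ h k i)))))
        }
      ; identity = (λ g → faithful λ i → trans (act-∙ ε g i) (act-ε _))
                 , (λ g → faithful λ i → trans (act-∙ g ε i) (cong (act g) (act-ε i)))
      }
    ; inverse = (λ g → faithful λ i → trans (act-∙ (g ⁻¹) g i) (trans (act-inverseˡ g i) (sym (act-ε i))))
              , (λ g → faithful λ i → trans (act-∙ g (g ⁻¹) i) (trans (act-inverseʳ g i) (sym (act-ε i))))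
    ; ⁻¹-cong = cong _⁻¹
    }

  open FiniteGroup isGroup _≟ᶠ_ public

  act-^ : ∀ g k i → act (g ^ k) i ≡ fold i (act g) k
  act-^ g zero i = act-ε i
  act-^ g (suc k) i = trans (act-∙ g (g ^ k) i) (cong (act g) (act-^ g k i))

  -- Total for convenience; the value `ε` outside the group is arbitrary.
  element : Perm n → El
  element σ with DecMembership._∈?_ _≟ᵖ_ σ (elems G)
  ... | yes i = index i
  ... | no _ = ε

  perm-element : ∀ {σ} → σ ∈ elems G → perm (element σ) ≡ σ
  perm-element {σ} i with DecMembership._∈?_ _≟ᵖ_ σ (elems G)
  ... | yes j = perm-index j
  ... | no ¬j = contradiction i ¬j

  act-element : ∀ {σ} → σ ∈ elems G → ∀ i → act (element σ) i ≡ app σ i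
  act-element i j = cong (λ τ → app τ j) (perm-element i)

  fixes? : ∀ ω → Decidable (λ g → act g ω ≡ ω)
  fixes? ω g = act g ω ≟ᶠ ω

  stabSize≡ : ∀ ω → length (filter (fixes? ω) allEl) ≡ stabSize G ω
  stabSize≡ ω = ≤-antisym
    (length-≤ perm (Uniqueₚ.filter⁺ (fixes? ω) allEl-unique)
      (λ i → ∈-filter⁺ fixesᵖ? (perm∈ _) (proj₂ (∈-filter⁻ (fixes? ω) {xs = allEl} i)))
      (λ _ _ → perm-injective _ _))
    (length-≤ element (Uniqueₚ.filter⁺ fixesᵖ? (uniq G))
      (λ i → let (j , e) = ∈-filter⁻ fixesᵖ? {xs = elems G} i in
        ∈-filter⁺ (fixes? ω) (allEl-complete _) (trans (act-element j ω) e))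
      (λ i j e → trans (sym (perm-element (proj₁ (∈-filter⁻ fixesᵖ? {xs = elems G} i))))
        (trans (cong perm e) (perm-element (proj₁ (∈-filter⁻ fixesᵖ? {xs = elems G} j))))))
    where
    fixesᵖ? : Decidable (λ (σ : Perm n) → app σ ω ≡ ω)
    fixesᵖ? σ = app σ ω ≟ᶠ ω

  -- Both inequalities come from the bijection (i, h) ↦ tᵢ h, where tᵢ moves the base point to i.
  module OrbitStabiliser {k} (b : El → Fin k → Fin k) (b-∙ : ∀ g h i → b (g ∙ h) i ≡ b g (b h i))
    (b-ε : ∀ i → b ε i ≡ i) (ω : Fin k) (transitive : ∀ i → ∃ λ g → b g ω ≡ i) where

    stab? : Decidable (λ g → b g ω ≡ ω)
    stab? g = b g ω ≟ᶠ ω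

    stab : List El
    stab = filter stab? allEl

    private
      t : Fin k → El
      t i = proj₁ (transitive i)
      t≡ : ∀ i → b (t i) ω ≡ i
      t≡ i = proj₂ (transitive i)
      b-⁻¹ : ∀ g i → b (g ⁻¹) (b g i) ≡ i
      b-⁻¹ g i = trans (sym (b-∙ (g ⁻¹) g i)) (trans (cong (λ z → b z i) (inverseˡ g)) (b-ε i))

      pairs : List (Fin k × El)
      pairs = cartesianProduct (allFin k) stab

      pairs-length : length pairs ≡ k * length stab
      pairs-length = trans (length-×-product (allFin k) stab) (cong (_* length stab) (length-tabulate {n = k} id))

    orbit-stabiliser : length allEl ≡ k * length stab
    orbit-stabiliser = ≤-antisym
      (≤-trans (length-≤ (λ g → b g ω , t (b g ω) ⁻¹ ∙ g) {ys = pairs} allEl-unique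
        (λ {g} _ → ∈-cartesianProduct⁺ (∈-allFin (b g ω)) (∈-filter⁺ stab? (allEl-complete _)
          (trans (b-∙ (t (b g ω) ⁻¹) g ω) (trans (cong (b (t (b g ω) ⁻¹)) (sym (t≡ (b g ω)))) (b-⁻¹ (t (b g ω)) ω)))))
        (λ {g} {h} _ _ e → ∙-cancelˡ (t (b h ω) ⁻¹) g h
          (subst (λ z → t z ⁻¹ ∙ g ≡ t (b h ω) ⁻¹ ∙ h) (cong proj₁ e) (cong proj₂ e))))
        (≤-reflexive pairs-length))
      (≤-trans (≤-reflexive (sym pairs-length)) (length-≤ (λ (i , g) → t i ∙ g)
        (Uniqueₚ.cartesianProduct⁺ (Uniqueₚ.allFin⁺ k) (Uniqueₚ.filter⁺ stab? allEl-unique))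
        (λ _ → allEl-complete _)
        λ { {i , g} {j , h} ig jh e →
          let at : ∀ {i g} → (i , g) ∈ pairs → b (t i ∙ g) ω ≡ i
              at {i} {g} m = trans (b-∙ (t i) g ω) (trans
                (cong (b (t i)) (proj₂ (∈-filter⁻ stab? {xs = allEl} (proj₂ (∈-cartesianProduct⁻ (allFin k) stab m))))) (t≡ i))
              i≡j = trans (sym (at ig)) (trans (cong (λ z → b z ω) e) (at jh))
          in cong₂ _,_ i≡j (∙-cancelˡ (t i) g h (trans e (cong (λ z → t z ∙ h) (sym i≡j)))) }))

-- Intersecting families and the lower bound

module _ {n} (G : PermGroup n) where
  private
    agree? : (σ τ : Perm n) → Dec (Agree σ τ)
    agree? σ τ = any? (λ i → app σ i ≟ᶠ app τ i)

    ⊔-bound : ∀ {b} ks → (∀ {k} → k ∈ ks → k ≤ b) → foldr _⊔_ 0 ks ≤ b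
    ⊔-bound [] _ = z≤n
    ⊔-bound (k ∷ ks) h = ⊔-lub (h (here refl)) (⊔-bound ks (h ∘ there))

    ≤-⊔ : ∀ {k} ks → k ∈ ks → k ≤ foldr _⊔_ 0 ks
    ≤-⊔ (k ∷ ks) (here refl) = m≤m⊔n k _
    ≤-⊔ (k ∷ ks) (there i) = ≤-trans (≤-⊔ ks i) (m≤n⊔m k _)

    filter∈sublists : {A : Set} {P : A → Set} (P? : Decidable P) (xs : List A) → filter P? xs ∈ sublists xs
    filter∈sublists P? [] = here refl
    filter∈sublists P? (x ∷ xs) with P? x
    ... | yes _ = ∈-++⁺ˡ (∈-map⁺ (x ∷_) (filter∈sublists P? xs))
    ... | no _ = ∈-++⁺ʳ (map (x ∷_) (sublists xs)) (filter∈sublists P? xs)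

    sublists-⊆ : {A : Set} (xs : List A) {ys : List A} → ys ∈ sublists xs → ∀ {y} → y ∈ ys → y ∈ xs
    sublists-⊆ [] (here refl) ()
    sublists-⊆ (x ∷ xs) i j with ∈-++⁻ (map (x ∷_) (sublists xs)) i
    ... | inj₂ i′ = there (sublists-⊆ xs i′ j)
    ... | inj₁ i′ with ∈-map⁻ (x ∷_) i′
    sublists-⊆ (x ∷ xs) i (here refl) | inj₁ _ | _ , _ , refl = here refl
    sublists-⊆ (x ∷ xs) i (there j) | inj₁ _ | _ , k , refl = there (sublists-⊆ xs k j)

    sublists-unique : {A : Set} {xs : List A} {ys : List A} → Unique xs → ys ∈ sublists xs → Unique ys
    sublists-unique {xs = []} _ (here refl) = []
    sublists-unique {xs = x ∷ xs} (x∉ ∷ u) i with ∈-++⁻ (map (x ∷_) (sublists xs)) i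
    ... | inj₂ i′ = sublists-unique u i′
    ... | inj₁ i′ with ∈-map⁻ (x ∷_) i′
    ... | ys , k , refl = All.tabulate (λ j → All.lookup x∉ (sublists-⊆ xs k j)) ∷ sublists-unique u k

    allPairs-tabulate : {A : Set} {R : A → A → Set} (xs : List A) →
      (∀ {x y} → x ∈ xs → y ∈ xs → R x y) → AllPairs R xs
    allPairs-tabulate [] _ = []
    allPairs-tabulate (x ∷ xs) r = All.tabulate (r (here refl) ∘ there) ∷
      allPairs-tabulate xs (λ i j → r (there i) (there j))

  stabSize≤maxIntersecting : ∀ ω → stabSize G ω ≤ maxIntersecting G
  stabSize≤maxIntersecting ω = ≤-⊔ _ (∈-map⁺ length (∈-filter⁺ (allPairs? agree?)
    (filter∈sublists fixes? (elems G))
    (allPairs-tabulate _ λ i j → ω , trans (proj₂ (∈-filter⁻ fixes? {xs = elems G} i))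
      (sym (proj₂ (∈-filter⁻ fixes? {xs = elems G} j))))))
    where
    fixes? = λ (σ : Perm n) → app σ ω ≟ᶠ ω

  -- Restricted to distinct elements because `AllPairs` compares entries at different positions
  -- only.
  AgreeAll : List (Perm n) → Set
  AgreeAll F = ∀ {σ τ} → σ ∈ F → τ ∈ F → σ ≢ τ → Agree σ τ

  maxIntersecting≤ : ∀ {b} → (∀ F → Unique F → (∀ {σ} → σ ∈ F → σ ∈ elems G) → AgreeAll F →
    length F ≤ b) → maxIntersecting G ≤ b
  maxIntersecting≤ {b} h = ⊔-bound _ bound
    where
    pairwise : ∀ {F} → AllPairs Agree F → AgreeAll F
    pairwise (_ ∷ _) (here refl) (here refl) ne = contradiction refl ne
    pairwise (a ∷ _) (here refl) (there j) _ = All.lookup a j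
    pairwise (a ∷ _) (there i) (here refl) _ = let (k , e) = All.lookup a i in k , sym e
    pairwise (_ ∷ as) (there i) (there j) ne = pairwise as i j ne
    bound : ∀ {k} → k ∈ map length (filter (allPairs? agree?) (sublists (elems G))) → k ≤ b
    bound i with ∈-map⁻ length i
    ... | F , j , refl with ∈-filter⁻ (allPairs? agree?) {xs = sublists (elems G)} j
    ... | k , ap = h F (sublists-unique (uniq G) k) (sublists-⊆ (elems G) k) (pairwise ap)

-- The field with three elements and sums over it

F₃ : Set
F₃ = Fin 3

pattern 0₃ = zero
pattern 1₃ = suc zero
pattern 2₃ = suc (suc zero)

infixl 6 _+₃_
infixl 7 _*₃_
infix 8 -₃_

private
  inc : F₃ → F₃
  inc 0₃ = 1₃
  inc 1₃ = 2₃
  inc 2₃ = 0₃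

-₃_ : F₃ → F₃
-₃ 0₃ = 0₃
-₃ 1₃ = 2₃
-₃ 2₃ = 1₃

_+₃_ : F₃ → F₃ → F₃
0₃ +₃ y = y
1₃ +₃ y = inc y
2₃ +₃ y = inc (inc y)

_*₃_ : F₃ → F₃ → F₃
0₃ *₃ y = 0₃
1₃ *₃ y = y
2₃ *₃ y = -₃ y

-- The carrier is finite with decidable equality, so the laws are verified by running through all
-- values; later identities in finitely many scalars are settled in the same way.
F₃-ring : CommutativeRing _ _
F₃-ring = record
  { Carrier = F₃ ; _≈_ = _≡_ ; _+_ = _+₃_ ; _*_ = _*₃_ ; -_ = -₃_ ; 0# = 0₃ ; 1# = 1₃
  ; isCommutativeRing = record
    { isRing = record
      { +-isAbelianGroup = record
        { isGroup = record
          { isMonoid = record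
            { isSemigroup = record
              { isMagma = record { isEquivalence = isEquivalence ; ∙-cong = cong₂ _+₃_ }
              ; assoc = toWitness {a? = all? λ x → all? λ y → all? λ z → (x +₃ y) +₃ z ≟ᶠ x +₃ (y +₃ z)} _ }
            ; identity = (λ _ → refl) , toWitness {a? = all? λ x → x +₃ 0₃ ≟ᶠ x} _ }
          ; inverse = toWitness {a? = all? λ x → -₃ x +₃ x ≟ᶠ 0₃} _
                    , toWitness {a? = all? λ x → x +₃ -₃ x ≟ᶠ 0₃} _
          ; ⁻¹-cong = cong -₃_ }
        ; comm = toWitness {a? = all? λ x → all? λ y → x +₃ y ≟ᶠ y +₃ x} _ }
      ; *-cong = cong₂ _*₃_
      ; *-assoc = toWitness {a? = all? λ x → all? λ y → all? λ z → (x *₃ y) *₃ z ≟ᶠ x *₃ (y *₃ z)} _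
      ; *-identity = (λ _ → refl) , toWitness {a? = all? λ x → x *₃ 1₃ ≟ᶠ x} _
      ; distrib = toWitness {a? = all? λ x → all? λ y → all? λ z → x *₃ (y +₃ z) ≟ᶠ x *₃ y +₃ x *₃ z} _
                , toWitness {a? = all? λ x → all? λ y → all? λ z → (y +₃ z) *₃ x ≟ᶠ y *₃ x +₃ z *₃ x} _ }
    ; *-comm = toWitness {a? = all? λ x → all? λ y → x *₃ y ≟ᶠ y *₃ x} _ } }

module F₃ = CommutativeRing F₃-ring
module Σ₃ = SemiringSum F₃.semiring
module Π₃ = MonoidSum F₃.*-commutativeMonoid

unit : ∀ {x} → x ≢ 0₃ → x *₃ x ≡ 1₃
unit {0₃} n = contradiction refl n
unit {1₃} _ = refl
unit {2₃} _ = refl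

Word : ℕ → Set
Word n = Fin n → F₃

-- Opaque, so that unification can read the summand off a sum.
opaque
  ∑ : ∀ {n} → Word n → F₃
  ∑ = Σ₃.sum

  ∑-suc : ∀ {n} (f : Word (suc n)) → ∑ f ≡ f zero +₃ ∑ (f ∘ suc)
  ∑-suc f = refl

  ∑-empty : (f : Word 0) → ∑ f ≡ 0₃
  ∑-empty f = refl

  ∑-cong : ∀ {n} {f g : Word n} → (∀ i → f i ≡ g i) → ∑ f ≡ ∑ g
  ∑-cong = Σ₃.sum-cong-≗

  ∑-+ : ∀ {n} (f g : Word n) → ∑ (λ i → f i +₃ g i) ≡ ∑ f +₃ ∑ g
  ∑-+ = Σ₃.∑-distrib-+

  ∑-*ˡ : ∀ {n} x (f : Word n) → x *₃ ∑ f ≡ ∑ (λ i → x *₃ f i)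
  ∑-*ˡ = Σ₃.*-distribˡ-sum

  ∑-comm : ∀ {m n} (f : Fin m → Word n) → ∑ (λ i → ∑ (f i)) ≡ ∑ (λ j → ∑ λ i → f i j)
  ∑-comm = Σ₃.∑-comm

  ∑-permute : ∀ {n} (f : Word n) (π : Permutation.Permutation n n) →
    ∑ f ≡ ∑ (λ i → f (π Permutation.⟨$⟩ʳ i))
  ∑-permute = Σ₃.∑-permute

  ∑-zero : ∀ {n} {f : Word n} → (∀ i → f i ≡ 0₃) → ∑ f ≡ 0₃
  ∑-zero {n} e = trans (∑-cong e) (Σ₃.sum-replicate-zero n)

∑-single : ∀ {n} (f : Word n) a → (∀ i → i ≢ a → f i ≡ 0₃) → ∑ f ≡ f a
∑-single f zero z = trans (∑-suc f)
  (trans (cong (f zero +₃_) (∑-zero λ i → z (suc i) λ ())) (F₃.+-identityʳ _))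
∑-single f (suc a) z = trans (∑-suc f) (trans (cong (_+₃ ∑ (f ∘ suc)) (z zero λ ()))
  (∑-single (f ∘ suc) a λ i ne → z (suc i) λ { refl → ne refl }))

-- In characteristic 3 the cyclic orbits of length three contribute nothing.
∑-cyclic : ∀ n (T : Fin n → Fin n → Fin n → F₃) → (∀ i j k → T i j k ≡ T j k i) →
  ∑ (λ i → ∑ λ j → ∑ λ k → T i j k) ≡ ∑ (λ i → T i i i)
∑-cyclic zero T cyc = trans (∑-empty _) (sym (∑-empty _))
∑-cyclic (suc n) T cyc = trans (∑-suc _) (trans (cong₂ _+₃_ eq₀ eqₛ)
  (trans (collect a b d e) (sym (∑-suc _))))
  where
  a = T zero zero zero
  b = ∑ λ k → T zero zero (suc k)
  d = ∑ λ j → ∑ λ k → T zero (suc j) (suc k)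
  e = ∑ λ i → T (suc i) (suc i) (suc i)
  -- `b` sums the triples with exactly two indices zero and `d` those with exactly one. Each appears
  -- three times, once for every rotation, and so vanishes.
  collect : ∀ a b d e → ((a +₃ b) +₃ (b +₃ d)) +₃ ((b +₃ d) +₃ (d +₃ e)) ≡ a +₃ e
  collect = toWitness {a? = all? λ a → all? λ b → all? λ d → all? λ e →
    ((a +₃ b) +₃ (b +₃ d)) +₃ ((b +₃ d) +₃ (d +₃ e)) ≟ᶠ a +₃ e} _
  split : ∀ (S : Fin (suc n) → Fin (suc n) → F₃) → ∑ (λ j → ∑ λ k → S j k) ≡
    (S zero zero +₃ ∑ λ k → S zero (suc k)) +₃ (∑ (λ j → S (suc j) zero) +₃ ∑ λ j → ∑ λ k → S (suc j) (suc k))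
  split S = trans (∑-suc _) (cong₂ _+₃_ (∑-suc (S zero)) (trans (∑-cong λ j → ∑-suc (S (suc j))) (∑-+ _ _)))
  eq₀ : ∑ (λ j → ∑ λ k → T zero j k) ≡ (a +₃ b) +₃ (b +₃ d)
  eq₀ = trans (split (T zero)) (cong (λ z → (a +₃ b) +₃ (z +₃ d)) (∑-cong λ j → sym (cyc zero zero (suc j))))
  eqₛ : ∑ (λ i → ∑ λ j → ∑ λ k → T (suc i) j k) ≡ (b +₃ d) +₃ (d +₃ e)
  eqₛ = trans (∑-cong λ i → split (T (suc i))) (trans (∑-+ _ _) (cong₂ _+₃_
    (trans (∑-+ _ _) (cong₂ _+₃_
      (∑-cong λ i → cyc (suc i) zero zero)
      (trans (∑-comm λ i k → T (suc i) zero (suc k)) (∑-cong λ k → ∑-cong λ i → cyc (suc i) zero (suc k)))))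
    (trans (∑-+ _ _) (cong₂ _+₃_
      (∑-cong λ i → ∑-cong λ j → trans (cyc (suc i) (suc j) zero) (cyc (suc j) zero (suc i)))
      (∑-cyclic n (λ i j k → T (suc i) (suc j) (suc k)) λ i j k → cyc (suc i) (suc j) (suc k))))))

⟨_,_⟩ : ∀ {n} → Word n → Word n → F₃
⟨ c , d ⟩ = ∑ λ i → c i *₃ d i

⟨⟩-comm : ∀ {n} (c d : Word n) → ⟨ c , d ⟩ ≡ ⟨ d , c ⟩
⟨⟩-comm c d = ∑-cong λ i → F₃.*-comm (c i) (d i)

⟨⟩-+ : ∀ {n} (c c′ d : Word n) → ⟨ (λ i → c i +₃ c′ i) , d ⟩ ≡ ⟨ c , d ⟩ +₃ ⟨ c′ , d ⟩
⟨⟩-+ c c′ d = trans (∑-cong λ i → F₃.distribʳ (d i) (c i) (c′ i)) (∑-+ _ _)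

⟨⟩-* : ∀ {n} x (c d : Word n) → ⟨ (λ i → x *₃ c i) , d ⟩ ≡ x *₃ ⟨ c , d ⟩
⟨⟩-* x c d = trans (∑-cong λ i → F₃.*-assoc x (c i) (d i)) (sym (∑-*ˡ x _))

-- Ternary codes and the representation of functionals

-- Words are functions, so membership respects pointwise equality; `words` lists the code up to that
-- equality and provides the finiteness behind `riesz`.
record Code (n : ℕ) : Set₁ where
  field
    Has      : Word n → Set
    has-cong : ∀ {c d} → (∀ i → c i ≡ d i) → Has c → Has d
    has-+    : ∀ {c d} → Has c → Has d → Has (λ i → c i +₃ d i)
    has-*    : ∀ {c} x → Has c → Has (λ i → x *₃ c i)
    words    : List (Word n)
    words-⊆  : All Has words
    complete : ∀ {c} → Has c → ∃ λ w → w ∈ words × (∀ i → c i ≡ w i)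

-- Signs being their own inverses, the formula in `push` is the inverse of the one in `pull`.
record MonomialSymmetry {n} (C : Code n) : Set where
  open Code C
  field
    π π⁻¹    : Fin n → Fin n
    π-π⁻¹    : ∀ i → π (π⁻¹ i) ≡ i
    π⁻¹-π    : ∀ i → π⁻¹ (π i) ≡ i
    sign     : Word n
    sign²    : ∀ i → sign i *₃ sign i ≡ 1₃
    pull     : ∀ {c} → Has c → Has (λ i → sign i *₃ c (π i))
    push     : ∀ {c} → Has c → Has (λ i → sign (π⁻¹ i) *₃ c (π⁻¹ i))

module CodeTheory {n} (C : Code n) where
  open Code C

  infix 4 _⊥C
  _⊥C : Word n → Set
  c ⊥C = ∀ {d} → Has d → ⟨ c , d ⟩ ≡ 0₃

  -- A word of C ∩ C^⊥ has zero square in the group ring F₃[A], hence zero cube; its cube is c(z³).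
  module _ {_⊕_ : Fin n → Fin n → Fin n} {o : Fin n} {⊖_ : Fin n → Fin n}
    (A : IsAbelianGroup _≡_ _⊕_ o ⊖_)
    (cubes : ∀ {i j} → (i ⊕ (i ⊕ i)) ≡ (j ⊕ (j ⊕ j)) → i ≡ j)
    (reflect : ∀ {c} s → Has c → Has (λ i → c (s ⊕ (⊖ i)))) where

    private module A = IsAbelianGroup A

    isotropic⇒zero : ∀ {c} → Has c → c ⊥C → ∀ t → c t ≡ 0₃
    isotropic⇒zero {c} h iso t = trans (sym diag) (trans (sym (∑-cyclic n T cyc))
      (∑-zero λ i → trans (∑-cong (inner i)) (square i)))
      where
      -- The coefficient of the cube is taken at 3t: on the diagonal only i = t has the sum `u`,
      -- since tripling is injective, and there x³ = x returns `c t`.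
      u = t ⊕ (t ⊕ t)
      δ : ∀ {P : Set} → Dec P → F₃ → F₃
      δ (yes _) x = x
      δ (no _) _ = 0₃
      T : Fin n → Fin n → Fin n → F₃
      T i j k = δ ((i ⊕ (j ⊕ k)) ≟ᶠ u) (c i *₃ (c j *₃ c k))
      rotate : ∀ i j k → (i ⊕ (j ⊕ k)) ≡ (j ⊕ (k ⊕ i))
      rotate i j k = trans (A.comm i (j ⊕ k)) (A.assoc j k i)
      rotate* : ∀ x y z → x *₃ (y *₃ z) ≡ y *₃ (z *₃ x)
      rotate* x y z = trans (F₃.*-comm x _) (F₃.*-assoc y z x)
      cyc : ∀ i j k → T i j k ≡ T j k i
      cyc i j k rewrite rotate i j k = cong (δ _) (rotate* (c i) (c j) (c k))
      diag : ∑ (λ i → T i i i) ≡ c t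
      diag = trans (∑-single (λ i → T i i i) t off) on
        where
        off : ∀ i → i ≢ t → T i i i ≡ 0₃
        off i ne with (i ⊕ (i ⊕ i)) ≟ᶠ u
        ... | yes e = contradiction (cubes e) ne
        ... | no _ = refl
        on : T t t t ≡ c t
        on with u ≟ᶠ u
        ... | yes _ = cube (c t)
          where
          cube : ∀ x → x *₃ (x *₃ x) ≡ x
          cube = toWitness {a? = all? λ x → x *₃ (x *₃ x) ≟ᶠ x} _
        ... | no ne = contradiction refl ne
      third : Fin n → Fin n → Fin n
      third i j = (u ⊕ (⊖ i)) ⊕ (⊖ j)
      third≡ : ∀ i j k → (i ⊕ (j ⊕ k)) ≡ u → k ≡ third i j
      third≡ i j k e = sym (trans (cong (λ z → (z ⊕ (⊖ i)) ⊕ (⊖ j)) (sym e))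
        (trans (cong (_⊕ (⊖ j)) (trans (cong (_⊕ (⊖ i)) (A.comm i _))
        (trans (A.assoc _ i _) (trans (cong ((j ⊕ k) ⊕_) (A.inverseʳ i)) (A.identityʳ _)))))
        (trans (cong (_⊕ (⊖ j)) (A.comm j k)) (trans (A.assoc k j _)
        (trans (cong (k ⊕_) (A.inverseʳ j)) (A.identityʳ k))))))
      third-sum : ∀ i j → (i ⊕ (j ⊕ third i j)) ≡ u
      third-sum i j = trans (cong (i ⊕_) (trans (A.comm j _) (trans (A.assoc _ _ j)
        (trans (cong ((u ⊕ (⊖ i)) ⊕_) (A.inverseˡ j)) (A.identityʳ _)))))
        (trans (A.comm i _) (trans (A.assoc u _ i) (trans (cong (u ⊕_) (A.inverseˡ i)) (A.identityʳ u))))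
      inner : ∀ i j → ∑ (λ k → T i j k) ≡ c i *₃ (c j *₃ c (third i j))
      inner i j = trans (∑-single (T i j) (third i j) off) on
        where
        off : ∀ k → k ≢ third i j → T i j k ≡ 0₃
        off k ne with (i ⊕ (j ⊕ k)) ≟ᶠ u
        ... | yes e = contradiction (third≡ i j k e) ne
        ... | no _ = refl
        on : T i j (third i j) ≡ c i *₃ (c j *₃ c (third i j))
        on with (i ⊕ (j ⊕ third i j)) ≟ᶠ u
        ... | yes _ = refl
        ... | no ne = contradiction (third-sum i j) ne
      -- For fixed i the sum over j pairs `c` with one of its reflections, which is a word of the
      -- code.
      square : ∀ i → ∑ (λ j → c i *₃ (c j *₃ c (third i j))) ≡ 0₃
      square i = trans (sym (∑-*ˡ (c i) _))
        (trans (cong (c i *₃_) (iso (reflect (u ⊕ (⊖ i)) h))) (F₃.zeroʳ (c i)))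

  module _ (nondegenerate : ∀ {c} → Has c → c ⊥C → ∀ t → c t ≡ 0₃) where

    record Functional : Set where
      field
        φ      : Word n → F₃
        φ-cong : ∀ {c d} → (∀ i → c i ≡ d i) → φ c ≡ φ d
        φ-+    : ∀ c d → φ (λ i → c i +₃ d i) ≡ φ c +₃ φ d
        φ-*    : ∀ x c → φ (λ i → x *₃ c i) ≡ x *₃ φ c

    private
      Riesz : Functional → List (Word n) → Set
      Riesz Φ L = (∃ λ e → Has e × (∀ {c} → Has c → ⟨ e , c ⟩ ≡ φ c))
        ⊎ (∃ λ c → Has c × φ c ≢ 0₃ × All (λ v → ⟨ c , v ⟩ ≡ 0₃) L)
        where open Functional Φ

      shift : Functional → F₃ → Word n → Functional
      shift Φ x a = record
        { φ = λ c → φ c +₃ -₃ (x *₃ ⟨ a , c ⟩)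
        ; φ-cong = λ e → cong₂ (λ y z → y +₃ -₃ (x *₃ z)) (φ-cong e) (∑-cong λ i → cong (a i *₃_) (e i))
        ; φ-+ = λ c d → trans (cong₂ (λ y z → y +₃ -₃ (x *₃ z)) (φ-+ c d) (⟨a⟩-+ c d))
            (alg₁ (φ c) (φ d) x ⟨ a , c ⟩ ⟨ a , d ⟩)
        ; φ-* = λ y c → trans (cong₂ (λ u v → u +₃ -₃ (x *₃ v)) (φ-* y c) (⟨a⟩-* y c))
            (alg₂ y (φ c) x ⟨ a , c ⟩)
        }
        where
        open Functional Φ
        ⟨a⟩-+ : ∀ c d → ⟨ a , (λ i → c i +₃ d i) ⟩ ≡ ⟨ a , c ⟩ +₃ ⟨ a , d ⟩
        ⟨a⟩-+ c d = trans (⟨⟩-comm a _) (trans (⟨⟩-+ c d a) (cong₂ _+₃_ (⟨⟩-comm c a) (⟨⟩-comm d a)))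
        ⟨a⟩-* : ∀ y c → ⟨ a , (λ i → y *₃ c i) ⟩ ≡ y *₃ ⟨ a , c ⟩
        ⟨a⟩-* y c = trans (⟨⟩-comm a _) (trans (⟨⟩-* y c a) (cong (y *₃_) (⟨⟩-comm c a)))
        alg₁ : ∀ p q x a b → (p +₃ q) +₃ -₃ (x *₃ (a +₃ b)) ≡ (p +₃ -₃ (x *₃ a)) +₃ (q +₃ -₃ (x *₃ b))
        alg₁ = toWitness {a? = all? λ p → all? λ q → all? λ x → all? λ a → all? λ b →
          (p +₃ q) +₃ -₃ (x *₃ (a +₃ b)) ≟ᶠ (p +₃ -₃ (x *₃ a)) +₃ (q +₃ -₃ (x *₃ b))} _
        alg₂ : ∀ y p x a → (y *₃ p) +₃ -₃ (x *₃ (y *₃ a)) ≡ y *₃ (p +₃ -₃ (x *₃ a))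
        alg₂ = toWitness {a? = all? λ y → all? λ p → all? λ x → all? λ a →
          (y *₃ p) +₃ -₃ (x *₃ (y *₃ a)) ≟ᶠ y *₃ (p +₃ -₃ (x *₃ a))} _

      -- Gaussian elimination without bases. If the word `y` found for the tail is not orthogonal to
      -- `a`, subtracting from φ the multiple of ⟨ a , _ ⟩ that cancels it on `y` gives a functional
      -- to which induction applies again. A representative of it becomes one of φ after adding `x`
      -- times `a`; a word on which it does not vanish is corrected by a multiple of `y`.
      fredholm : ∃ Has → ∀ {L} → All Has L → ∀ Φ → Riesz Φ L
      fredholm (c₀ , h₀) [] Φ with Any.any? (λ w → ¬? (φ w ≟ᶠ 0₃)) words
        where open Functional Φ
      ... | yes a = let (w , i , ne) = find a in inj₂ (w , All.lookup words-⊆ i , ne , [])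
      ... | no ¬a = inj₁ ((λ i → 0₃ *₃ c₀ i) , has-* 0₃ h₀ , λ {c} h →
          let (w , i , e) = complete h in
          trans (∑-zero {f = λ i → (0₃ *₃ c₀ i) *₃ c i} λ _ → refl) (sym (trans (φ-cong e)
            (decidable-stable (φ w ≟ᶠ 0₃) λ ne → ¬a (lose i ne)))))
        where open Functional Φ
      fredholm h₀ {a ∷ L} (ha ∷ hL) Φ with fredholm h₀ hL Φ
      ... | inj₁ s = inj₁ s
      ... | inj₂ (y , hy , φy , y⊥) with ⟨ y , a ⟩ ≟ᶠ 0₃
      ... | yes ya = inj₂ (y , hy , φy , ya ∷ y⊥)
      ... | no ya with fredholm h₀ hL (shift Φ (Functional.φ Φ y *₃ ⟨ y , a ⟩) a)
      ... | inj₁ (e , he , es) = inj₁ ((λ i → e i +₃ x *₃ a i) , has-+ he (has-* x ha) , λ {c} h →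
          trans (⟨⟩-+ e _ c) (trans (cong₂ _+₃_ (es h) (⟨⟩-* x a c)) (alg (φ c) (x *₃ ⟨ a , c ⟩))))
        where
        open Functional Φ
        x = φ y *₃ ⟨ y , a ⟩
        alg : ∀ p q → (p +₃ -₃ q) +₃ q ≡ p
        alg = toWitness {a? = all? λ p → all? λ q → (p +₃ -₃ q) +₃ q ≟ᶠ p} _
      ... | inj₂ (z , hz , φz , z⊥) = inj₂ ((λ i → z i +₃ m *₃ y i) , has-+ hz (has-* m hy) ,
          (λ e → φz (trans (sym eq) e)) , za ∷ All.tabulate λ i → trans (expand _)
            (trans (cong₂ (λ u v → u +₃ m *₃ v) (All.lookup z⊥ i) (All.lookup y⊥ i)) (F₃.zeroʳ m)))
        where
        open Functional Φ
        -- A nonzero scalar is its own inverse, so z + m y is orthogonal to `a`. The shifted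
        -- functional vanishes on `y`, and therefore φ of the sum is its value on `z`, which is
        -- nonzero.
        m = -₃ (⟨ z , a ⟩ *₃ ⟨ y , a ⟩)
        expand : ∀ v → ⟨ (λ i → z i +₃ m *₃ y i) , v ⟩ ≡ ⟨ z , v ⟩ +₃ m *₃ ⟨ y , v ⟩
        expand v = trans (⟨⟩-+ z _ v) (cong (⟨ z , v ⟩ +₃_) (⟨⟩-* m y v))
        za : ⟨ (λ i → z i +₃ m *₃ y i) , a ⟩ ≡ 0₃
        za = trans (expand a) (alg ⟨ z , a ⟩ ⟨ y , a ⟩ (unit ya))
          where
          alg : ∀ p q → q *₃ q ≡ 1₃ → p +₃ (-₃ (p *₃ q)) *₃ q ≡ 0₃
          alg p 1₃ _ = toWitness {a? = all? λ p → p +₃ (-₃ (p *₃ 1₃)) *₃ 1₃ ≟ᶠ 0₃} _ p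
          alg p 2₃ _ = toWitness {a? = all? λ p → p +₃ (-₃ (p *₃ 2₃)) *₃ 2₃ ≟ᶠ 0₃} _ p
        eq : φ (λ i → z i +₃ m *₃ y i) ≡ φ z +₃ -₃ ((φ y *₃ ⟨ y , a ⟩) *₃ ⟨ a , z ⟩)
        eq = trans (φ-+ z _) (trans (cong (φ z +₃_) (φ-* m y))
          (trans (alg (φ z) ⟨ z , a ⟩ ⟨ y , a ⟩ (φ y))
            (cong (λ u → φ z +₃ -₃ ((φ y *₃ ⟨ y , a ⟩) *₃ u)) (⟨⟩-comm z a))))
          where
          alg : ∀ w p q f → w +₃ (-₃ (p *₃ q)) *₃ f ≡ w +₃ -₃ ((f *₃ q) *₃ p)
          alg = toWitness {a? = all? λ w → all? λ p → all? λ q → all? λ f →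
            w +₃ (-₃ (p *₃ q)) *₃ f ≟ᶠ w +₃ -₃ ((f *₃ q) *₃ p)} _

    -- With the complete list of words as `L`, the second alternative would be a word orthogonal to
    -- the code with a nonzero entry at `b`.
    riesz : ∃ Has → ∀ b → ∃ λ e → Has e × (∀ {c} → Has c → ⟨ e , c ⟩ ≡ c b)
    riesz h₀ b with fredholm h₀ words-⊆ (record
      { φ = λ c → c b ; φ-cong = λ e → e b ; φ-+ = λ _ _ → refl ; φ-* = λ _ _ → refl })
    ... | inj₁ s = s
    ... | inj₂ (c , h , cb , c⊥) = contradiction (nondegenerate h (λ {d} hd →
        let (w , i , e) = complete hd in
        trans (∑-cong λ j → cong (c j *₃_) (e j)) (All.lookup c⊥ i)) b) cb

-- Products of signs and the full word

opaque
  ∏ : ∀ {n} → Word n → F₃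
  ∏ = Π₃.sum

  ∏-cong : ∀ {n} {f g : Word n} → (∀ i → f i ≡ g i) → ∏ f ≡ ∏ g
  ∏-cong = Π₃.sum-cong-≗

  ∏-* : ∀ {n} (f g : Word n) → ∏ (λ i → f i *₃ g i) ≡ ∏ f *₃ ∏ g
  ∏-* = Π₃.∑-distrib-+

  ∏-permute : ∀ {n} (f : Word n) (π : Permutation.Permutation n n) →
    ∏ f ≡ ∏ (λ i → f (π Permutation.⟨$⟩ʳ i))
  ∏-permute = Π₃.∑-permute

  ∏-unit : ∀ {n} (f : Word n) → (∀ i → f i *₃ f i ≡ 1₃) → ∏ f *₃ ∏ f ≡ 1₃
  ∏-unit {zero} f u = refl
  ∏-unit {suc n} f u = mul (f zero) _ (u zero) (∏-unit (f ∘ suc) (u ∘ suc))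
    where
    mul : ∀ x y → x *₃ x ≡ 1₃ → y *₃ y ≡ 1₃ → (x *₃ y) *₃ (x *₃ y) ≡ 1₃
    mul 1₃ y _ e = e
    mul 2₃ 1₃ _ _ = refl
    mul 2₃ 2₃ _ _ = refl

  ∏-const-odd : ∀ h {x} → x *₃ x ≡ 1₃ → ∏ {suc (h * 2)} (λ _ → x) ≡ x
  ∏-const-odd zero {x} _ = F₃.*-identityʳ x
  ∏-const-odd (suc h) {x} u = trans (sym (F₃.*-assoc x x _))
    (trans (cong (_*₃ ∏ {suc (h * 2)} (λ _ → x)) u) (∏-const-odd h u))

Odd : ℕ → Set
Odd n = ∃ λ h → n ≡ suc (h * 2)

record DoublyTransitive {n} (C : Code n) : Set where
  field
    symmetry : ∀ {i j k l} → i ≢ j → k ≢ l → Σ (MonomialSymmetry C) λ S →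
      MonomialSymmetry.π S i ≡ k × MonomialSymmetry.π S j ≡ l

-- The matrix (e i j) of the words representing c ↦ c i is, up to signs, invariant under a doubly
-- transitive group. If it is diagonal, Σ e b is full; if it has no zero entry, e 0 is full; and if only
-- the diagonal vanishes, then e i j = ± r i r j off the diagonal and e 0 + r 0 r 1 e 1 is full.
module FullWord {m} (C : Code (suc (suc m))) (odd : Odd (suc (suc m)))
  (nondegenerate : ∀ {c} → Code.Has C c → CodeTheory._⊥C C c → ∀ t → c t ≡ 0₃)
  (DT : DoublyTransitive C) where

  open Code C
  open CodeTheory C
  open DoublyTransitive DT

  private
    n : ℕ
    n = suc (suc m)

    another : ∀ (i : Fin n) → ∃ λ j → i ≢ j
    another zero = suc zero , λ ()
    another (suc i) = zero , λ ()

  module _ {c₀} (h₀ : Has c₀) {b₀} (c₀b₀ : c₀ b₀ ≢ 0₃) where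

    e : Fin n → Word n
    e b = proj₁ (riesz nondegenerate (c₀ , h₀) b)

    e∈ : ∀ b → Has (e b)
    e∈ b = proj₁ (proj₂ (riesz nondegenerate (c₀ , h₀) b))

    ⟨e,⟩ : ∀ b {c} → Has c → ⟨ e b , c ⟩ ≡ c b
    ⟨e,⟩ b = proj₂ (proj₂ (riesz nondegenerate (c₀ , h₀) b))

    -- The difference of two representatives lies in the code and is orthogonal to it; the scalar
    -- `2₃` serves as -1.
    e-unique : ∀ b {d} → Has d → (∀ {c} → Has c → ⟨ d , c ⟩ ≡ c b) → ∀ i → d i ≡ e b i
    e-unique b {d} hd rep i = cancel (d i) (e b i) (nondegenerate (has-+ hd (has-* 2₃ (e∈ b)))
      (λ {c} h → trans (⟨⟩-+ d _ c) (trans (cong₂ _+₃_ (rep h) (trans (⟨⟩-* 2₃ (e b) c) (cong -₃_ (⟨e,⟩ b h))))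
        (F₃.-‿inverseʳ (c b)))) i)
      where
      cancel : ∀ x y → x +₃ -₃ y ≡ 0₃ → x ≡ y
      cancel = toWitness {a? = all? λ x → all? λ y → (x +₃ -₃ y ≟ᶠ 0₃) →-dec (x ≟ᶠ y)} _

    module _ (S : MonomialSymmetry C) where
      open MonomialSymmetry S

      private
        perm : Permutation.Permutation n n
        perm = Permutation.permutation π π⁻¹ π-π⁻¹ π⁻¹-π

      -- Pulled back along the symmetry, `e (π b)` represents evaluation at `b` up to `sign b`, so
      -- uniqueness compares it with `e b`.
      e-equivariant : ∀ b i → e (π b) (π i) ≡ (sign b *₃ sign i) *₃ e b i
      e-equivariant b i = solve (sign b) (sign i) _ _ (sign² b) (sign² i)
        (e-unique b (has-* (sign b) (pull (e∈ (π b)))) rep i)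
        where
        solve : ∀ s t x y → s *₃ s ≡ 1₃ → t *₃ t ≡ 1₃ → s *₃ (t *₃ x) ≡ y → x ≡ (s *₃ t) *₃ y
        solve = toWitness {a? = all? λ s → all? λ t → all? λ x → all? λ y →
          (s *₃ s ≟ᶠ 1₃) →-dec (t *₃ t ≟ᶠ 1₃) →-dec (s *₃ (t *₃ x) ≟ᶠ y) →-dec (x ≟ᶠ (s *₃ t) *₃ y)} _
        rep : ∀ {c} → Has c → ⟨ (λ j → sign b *₃ (sign j *₃ e (π b) (π j))) , c ⟩ ≡ c b
        rep {c} h = begin
          ⟨ (λ j → sign b *₃ (sign j *₃ e (π b) (π j))) , c ⟩
            ≡⟨ ⟨⟩-* (sign b) _ c ⟩
          sign b *₃ ⟨ (λ j → sign j *₃ e (π b) (π j)) , c ⟩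
            ≡⟨ cong (sign b *₃_) (∑-cong λ j → trans (shuffle (sign j) (e (π b) (π j)) (c j))
                 (cong (e (π b) (π j) *₃_) (cong (λ k → sign k *₃ c k) (sym (π⁻¹-π j))))) ⟩
          sign b *₃ ∑ (λ j → e (π b) (π j) *₃ d (π j))
            ≡⟨ cong (sign b *₃_) (∑-permute (λ j → e (π b) j *₃ d j) perm) ⟨
          sign b *₃ ⟨ e (π b) , d ⟩
            ≡⟨ cong (sign b *₃_) (⟨e,⟩ (π b) (push h)) ⟩
          sign b *₃ (sign (π⁻¹ (π b)) *₃ c (π⁻¹ (π b)))
            ≡⟨ cong (λ k → sign b *₃ (sign k *₃ c k)) (π⁻¹-π b) ⟩
          sign b *₃ (sign b *₃ c b)
            ≡⟨ F₃.*-assoc (sign b) (sign b) (c b) ⟨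
          (sign b *₃ sign b) *₃ c b
            ≡⟨ cong (_*₃ c b) (sign² b) ⟩
          c b ∎
          where
          open ≡-Reasoning
          d : Word n
          d j = sign (π⁻¹ j) *₃ c (π⁻¹ j)
          shuffle : ∀ x y z → (x *₃ y) *₃ z ≡ y *₃ (x *₃ z)
          shuffle x y z = trans (cong (_*₃ z) (F₃.*-comm x y)) (F₃.*-assoc y x z)

    -- Each row of e₁ has an odd number n of sign changes, so its product r i changes sign with sign i.
    e₁ : Fin n → Word n
    e₁ i l with i ≟ᶠ l
    ... | yes _ = 1₃
    ... | no _ = e i l

    r : Word n
    r i = ∏ (e₁ i)

    r-equivariant : (S : MonomialSymmetry C) → ∀ i →
      r (MonomialSymmetry.π S i) ≡ (MonomialSymmetry.sign S i *₃ ∏ (MonomialSymmetry.sign S)) *₃ r i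
    r-equivariant S i = begin
      ∏ (e₁ (π i))                                 ≡⟨ ∏-permute (e₁ (π i)) perm ⟩
      ∏ (λ l → e₁ (π i) (π l))                     ≡⟨ ∏-cong e₁-equivariant ⟩
      ∏ (λ l → (sign i *₃ sign l) *₃ e₁ i l)       ≡⟨ ∏-* _ (e₁ i) ⟩
      ∏ (λ l → sign i *₃ sign l) *₃ r i            ≡⟨ cong (_*₃ r i) (∏-* (λ _ → sign i) sign) ⟩
      (∏ {n} (λ _ → sign i) *₃ ∏ sign) *₃ r i      ≡⟨ cong (λ z → (z *₃ ∏ sign) *₃ r i) const ⟩
      (sign i *₃ ∏ sign) *₃ r i                    ∎
      where
      open ≡-Reasoning
      open MonomialSymmetry S
      perm : Permutation.Permutation n n
      perm = Permutation.permutation π π⁻¹ π-π⁻¹ π⁻¹-π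
      const : ∏ {n} (λ _ → sign i) ≡ sign i
      const = subst (λ k → ∏ {k} (λ _ → sign i) ≡ sign i) (sym (proj₂ odd)) (∏-const-odd (proj₁ odd) (sign² i))
      e₁-equivariant : ∀ l → e₁ (π i) (π l) ≡ (sign i *₃ sign l) *₃ e₁ i l
      e₁-equivariant l with π i ≟ᶠ π l | i ≟ᶠ l
      ... | yes _ | yes refl = sym (trans (F₃.*-identityʳ _) (sign² i))
      ... | yes q | no ne = contradiction (trans (sym (π⁻¹-π i)) (trans (cong π⁻¹ q) (π⁻¹-π l))) ne
      ... | no ne | yes refl = contradiction refl ne
      ... | no _ | no _ = e-equivariant S i l

    diagonal≢0 : ∀ {b} → e b b ≢ 0₃ → ∀ i → e i i ≢ 0₃
    diagonal≢0 {b} ne i eii =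
      let (j , b≢j) = another b
          (k , i≢k) = another i
          (S , pb , pj) = symmetry b≢j i≢k
          open MonomialSymmetry S
      in ne (trans (sym (cong (_*₃ e b b) (sign² b))) (trans (sym (e-equivariant S b b))
        (trans (cong (λ z → e z z) pb) eii)))

    off-diagonal≢0 : ∀ {i j k l} → i ≢ j → k ≢ l → e i j ≢ 0₃ → e k l ≢ 0₃
    off-diagonal≢0 {i} {j} i≢j k≢l ne ekl =
      let (S , pi , pj) = symmetry i≢j k≢l
          open MonomialSymmetry S
      in ne (zero-product (sign i) (sign j) (sign² i) (sign² j)
        (trans (sym (e-equivariant S i j)) (trans (cong₂ e pi pj) ekl)))
      where
      zero-product : ∀ s t {x} → s *₃ s ≡ 1₃ → t *₃ t ≡ 1₃ → (s *₃ t) *₃ x ≡ 0₃ → x ≡ 0₃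
      zero-product s t {x} = toWitness {a? = all? λ s → all? λ t → all? λ x →
        (s *₃ s ≟ᶠ 1₃) →-dec (t *₃ t ≟ᶠ 1₃) →-dec ((s *₃ t) *₃ x ≟ᶠ 0₃) →-dec (x ≟ᶠ 0₃)} _ s t x

    -- Under a symmetry `sign i`, `sign j` and `∏ sign` each enter the product twice and cancel;
    -- double transitivity then makes it constant off the diagonal.
    off-diagonal : ∀ {i j k l} → i ≢ j → k ≢ l →
      e k l *₃ (r k *₃ r l) ≡ e i j *₃ (r i *₃ r j)
    off-diagonal {i} {j} i≢j k≢l with symmetry i≢j k≢l
    ... | S , refl , refl = trans (cong₂ _*₃_ (e-equivariant S i j)
        (cong₂ _*₃_ (r-equivariant S i) (r-equivariant S j)))
      (cancel (sign i) (sign j) (∏ sign) (e i j) (r i) (r j) (sign² i) (sign² j) (∏-unit sign sign²))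
      where
      open MonomialSymmetry S
      cancel : ∀ s t p x y z → s *₃ s ≡ 1₃ → t *₃ t ≡ 1₃ → p *₃ p ≡ 1₃ →
        ((s *₃ t) *₃ x) *₃ (((s *₃ p) *₃ y) *₃ ((t *₃ p) *₃ z)) ≡ x *₃ (y *₃ z)
      cancel = toWitness {a? = all? λ s → all? λ t → all? λ p → all? λ x → all? λ y → all? λ z →
        (s *₃ s ≟ᶠ 1₃) →-dec (t *₃ t ≟ᶠ 1₃) →-dec (p *₃ p ≟ᶠ 1₃) →-dec
        (((s *₃ t) *₃ x) *₃ (((s *₃ p) *₃ y) *₃ ((t *₃ p) *₃ z)) ≟ᶠ x *₃ (y *₃ z))} _

    has-∑ : ∀ {k} (f : Fin k → Word n) → (∀ b → Has (f b)) → Has (λ i → ∑ λ b → f b i)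
    has-∑ {zero} f h = has-cong (λ i → sym (∑-empty _)) (has-* 0₃ h₀)
    has-∑ {suc k} f h = has-cong (λ i → sym (∑-suc _)) (has-+ (h zero) (has-∑ (f ∘ suc) (h ∘ suc)))

    full-word : ∃ λ c → Has c × (∀ i → c i ≢ 0₃)
    full-word with e zero (suc zero) ≟ᶠ 0₃
    ... | yes e₀₁ = (λ i → ∑ λ b → e b i) , has-∑ e e∈ , λ i q →
        e≢0 i (trans (sym (∑-single (λ b → e b i) i λ b ne → off b i ne)) q)
      where
      off : ∀ k l → k ≢ l → e k l ≡ 0₃
      off k l ne = decidable-stable (e k l ≟ᶠ 0₃) λ q → off-diagonal≢0 ne (λ ()) q e₀₁
      -- A zero at `b₀` on the diagonal would make the whole row `e b₀` vanish, but this row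
      -- represents evaluation at `b₀`, which is nonzero on `c₀`.
      e≢0 : ∀ i → e i i ≢ 0₃
      e≢0 = diagonal≢0 {b₀} λ q → c₀b₀ (trans (sym (⟨e,⟩ b₀ h₀)) (∑-zero λ i → cong (_*₃ c₀ i) (row i q)))
        where
        row : ∀ i → e b₀ b₀ ≡ 0₃ → e b₀ i ≡ 0₃
        row i q with b₀ ≟ᶠ i
        ... | yes refl = q
        ... | no ne = off b₀ i ne
    ... | no e₀₁ with e zero zero ≟ᶠ 0₃
    ... | no e₀₀ = e zero , e∈ zero , full
      where
      full : ∀ i → e zero i ≢ 0₃
      full zero = e₀₀
      full (suc i) = off-diagonal≢0 {zero} {suc zero} (λ ()) (λ ()) e₀₁
    ... | yes e₀₀ = (λ i → e zero i +₃ (r zero *₃ r (suc zero)) *₃ e (suc zero) i) ,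
        has-+ (e∈ zero) (has-* (r zero *₃ r (suc zero)) (e∈ (suc zero))) , full
      where
      off : ∀ {k l} → k ≢ l → e k l ≢ 0₃
      off ne = off-diagonal≢0 {zero} {suc zero} (λ ()) ne e₀₁
      e≡0 : ∀ i → e i i ≡ 0₃
      e≡0 i = decidable-stable (e i i ≟ᶠ 0₃) λ q → diagonal≢0 q zero e₀₀
      e₁≢0 : ∀ i l → e₁ i l ≢ 0₃
      e₁≢0 i l with i ≟ᶠ l
      ... | yes _ = λ ()
      ... | no ne = off ne
      r² : ∀ i → r i *₃ r i ≡ 1₃
      r² i = ∏-unit (e₁ i) λ l → unit (e₁≢0 i l)
      full : ∀ i → e zero i +₃ (r zero *₃ r (suc zero)) *₃ e (suc zero) i ≢ 0₃
      full zero q = first (r zero) (r (suc zero)) (r² zero) (r² (suc zero)) (off {suc zero} {zero} λ ())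
        (trans (cong (_+₃ (r zero *₃ r (suc zero)) *₃ e (suc zero) zero) (sym e₀₀)) q)
        where
        first : ∀ s t {x} → s *₃ s ≡ 1₃ → t *₃ t ≡ 1₃ → x ≢ 0₃ → (s *₃ t) *₃ x ≢ 0₃
        first s t {x} = toWitness {a? = all? λ s → all? λ t → all? λ x →
          (s *₃ s ≟ᶠ 1₃) →-dec (t *₃ t ≟ᶠ 1₃) →-dec ¬? (x ≟ᶠ 0₃) →-dec ¬? ((s *₃ t) *₃ x ≟ᶠ 0₃)} _ s t x
      full (suc zero) q = e₀₁ (trans (sym (F₃.+-identityʳ _)) (trans (cong (e zero (suc zero) +₃_)
        (sym (trans (cong ((r zero *₃ r (suc zero)) *₃_) (e≡0 (suc zero))) (F₃.zeroʳ (r zero *₃ r (suc zero)))))) q))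
      -- Columns 0 and 1 each lose one summand to the vanishing diagonal. In any other column
      -- `off-diagonal` makes the two summands equal, and 2 is nonzero in F₃.
      full i@(suc (suc _)) q = double (r zero) (r (suc zero)) (r i) (r² zero) (r² (suc zero)) (r² i)
        (off {zero} {i} λ ()) (off-diagonal {suc zero} {i} {zero} {i} (λ ()) (λ ())) q
        where
        double : ∀ s t u {x y} → s *₃ s ≡ 1₃ → t *₃ t ≡ 1₃ → u *₃ u ≡ 1₃ → x ≢ 0₃ →
          x *₃ (s *₃ u) ≡ y *₃ (t *₃ u) → x +₃ (s *₃ t) *₃ y ≢ 0₃
        double s t u {x} {y} a b c = toWitness {a? = all? λ s → all? λ t → all? λ u → all? λ x → all? λ y →
          (s *₃ s ≟ᶠ 1₃) →-dec (t *₃ t ≟ᶠ 1₃) →-dec (u *₃ u ≟ᶠ 1₃) →-dec ¬? (x ≟ᶠ 0₃) →-dec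
          (x *₃ (s *₃ u) ≟ᶠ y *₃ (t *₃ u)) →-dec ¬? (x +₃ (s *₃ t) *₃ y ≟ᶠ 0₃)} _ s t u x y a b c

abstract
  -- A single coordinate has no pair of distinct indices to move and is treated apart: there a
  -- nonzero word is already full.
  full-word′ : ∀ {n} (C : Code n) → Odd n →
    (∀ {c} → Code.Has C c → CodeTheory._⊥C C c → ∀ t → c t ≡ 0₃) → DoublyTransitive C →
    ∀ {c₀} → Code.Has C c₀ → ∀ {b₀} → c₀ b₀ ≢ 0₃ → ∃ λ c → Code.Has C c × (∀ i → c i ≢ 0₃)
  full-word′ {suc zero} C _ _ _ {c₀} h₀ {zero} ne = c₀ , h₀ , λ { zero → ne }
  full-word′ {suc (suc _)} C odd nd DT h₀ ne = FullWord.full-word C odd nd DT h₀ ne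

-- Residues modulo a prime

module Mod (p : ℕ) (pr : Prime p) where

  private instance
    p≢0 : NonZero p
    p≢0 = prime⇒nonZero pr

  infix 4 _≋_
  _≋_ : ℕ → ℕ → Set
  m ≋ n = m % p ≡ n % p

  ≋-+ : ∀ {m m′ n n′} → m ≋ m′ → n ≋ n′ → m + n ≋ m′ + n′
  ≋-+ {m} {m′} {n} {n′} e f = trans (%-distribˡ-+ m n p)
    (trans (cong₂ (λ a b → (a + b) % p) e f) (sym (%-distribˡ-+ m′ n′ p)))

  ≋-* : ∀ {m m′ n n′} → m ≋ m′ → n ≋ n′ → m * n ≋ m′ * n′
  ≋-* {m} {m′} {n} {n′} e f = trans (%-distribˡ-* m n p)
    (trans (cong₂ (λ a b → (a * b) % p) e f) (sym (%-distribˡ-* m′ n′ p)))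

  *p≋0 : ∀ m → m * p ≋ 0
  *p≋0 m = trans (m*n%n≡0 m p) (sym (m*n%n≡0 0 p))

  ≋⇒≡ : ∀ {m n} → m < p → n < p → m ≋ n → m ≡ n
  ≋⇒≡ l k e = trans (sym (m<n⇒m%n≡m l)) (trans e (m<n⇒m%n≡m k))

  -- pred p acts as −1
  neg-+ : ∀ c → pred p * c + c ≋ 0
  neg-+ c = trans (cong (_% p) (trans (+-comm _ c) (trans (cong (_* c) (suc-pred p)) (*-comm p c)))) (*p≋0 c)

  ≋-+-cancelˡ : ∀ c {m n} → c + m ≋ c + n → m ≋ n
  ≋-+-cancelˡ c {m} {n} e = trans (sym (shift m)) (trans (≋-+ {pred p * c} refl e) (shift n))
    where
    shift : ∀ k → pred p * c + (c + k) ≋ k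
    shift k = trans (cong (_% p) (sym (+-assoc (pred p * c) c k))) (≋-+ {n = k} (neg-+ c) refl)

  abstract
    inverse : ∀ {d} → 0 < d → d < p → ∃ λ l → l * d ≋ 1
    inverse {d} 0<d d<p with coprime-Bézout (prime⇒coprime pr {{>-nonZero 0<d}} d<p)
    ... | Bézout.-+ a b eq = b , trans (cong (_% p) (sym eq)) (≋-+ {1} refl (*p≋0 a))
    -- In this case b d is -1 modulo `p`, so b is multiplied by `pred p`, which stands for -1.
    ... | Bézout.+- a b eq = pred p * b , ≋-+-cancelˡ (b * d)
          (trans (trans (cong (_% p) (trans (+-comm (b * d) _) (cong (_+ b * d) (*-assoc (pred p) b d))))
            (neg-+ (b * d))) (sym (trans (cong (_% p) (trans (+-comm (b * d) 1) eq)) (*p≋0 a))))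

  ≋-*-cancelʳ : ∀ {m n} d → 0 < d → d < p → m * d ≋ n * d → m ≋ n
  ≋-*-cancelʳ {m} {n} d 0<d d<p e = let (l , ld) = inverse 0<d d<p in
    trans (sym (undo m l ld)) (trans (≋-* {n = l} e refl) (undo n l ld))
    where
    undo : ∀ m l → l * d ≋ 1 → m * d * l ≋ m
    undo m l ld = trans (cong (_% p) (trans (*-assoc m d l) (cong (m *_) (*-comm d l))))
      (trans (≋-* {m} refl ld) (cong (_% p) (*-identityʳ m)))

  1+≋0⇒≋-1 : ∀ {k} → suc k ≋ 0 → k ≋ pred p
  1+≋0⇒≋-1 {k} e = ≋-+-cancelˡ 1 {k} {pred p} (trans e (sym (trans (cong (_% p) (suc-pred p))
    (trans (cong (_% p) (sym (*-identityˡ p))) (*p≋0 1)))))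

  -- Factoring without subtraction: k (k + 1) = k + k² = 1 (k + 1), and k + 1 cancels unless it is
  -- zero.
  square-one : ∀ {k} → k * k ≋ 1 → k ≋ 1 ⊎ k ≋ pred p
  square-one {k} e with suc k % p ≟ 0 % p
  ... | yes q = inj₂ (1+≋0⇒≋-1 {k} q)
  ... | no ne = inj₁ (≋-*-cancelʳ {k} {1} d 0<d (m%n<n (suc k) p) (begin
      (k * d) % p        ≡⟨ ≋-* {k} {k} {d} {suc k} refl d≋ ⟩
      (k * suc k) % p    ≡⟨ cong (_% p) (*-suc k k) ⟩
      (k + k * k) % p    ≡⟨ ≋-+ {k} {k} {k * k} {1} refl e ⟩
      (k + 1) % p        ≡⟨ cong (_% p) (trans (+-comm k 1) (sym (*-identityˡ (suc k)))) ⟩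
      (1 * suc k) % p    ≡⟨ ≋-* {1} {1} {d} {suc k} refl d≋ ⟨
      (1 * d) % p        ∎))
    where
    open ≡-Reasoning
    d = suc k % p
    d≋ : d ≋ suc k
    d≋ = m%n%n≡m%n (suc k) p
    0<d : 0 < d
    0<d = n≢0⇒n>0 λ q → ne (trans q (sym (m<n⇒m%n≡m (≤-<-trans z≤n (m%n<n (suc k) p)))))

  private
    slope : ∀ {m n a b e f} → e < f → f < p → a + m * e ≋ b + n * e → a + m * f ≋ b + n * f → m ≋ n
    slope {m} {n} {a} {b} {e} {f} e<f f<p E F = ≋-*-cancelʳ (f ∸ e) (m<n⇒0<n∸m e<f) (≤-<-trans (m∸n≤m f e) f<p)
      (≋-+-cancelˡ (b + n * e) (trans (≋-+ {n = m * (f ∸ e)} (sym E) refl)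
        (trans (sym (expand a m)) (trans F (expand b n)))))
      where
      expand : ∀ a m → a + m * f ≋ a + m * e + m * (f ∸ e)
      expand a m = cong (_% p) (trans (cong (λ z → a + m * z) (sym (m+[n∸m]≡n (<⇒≤ e<f))))
        (trans (cong (a +_) (*-distribˡ-+ m e (f ∸ e))) (sym (+-assoc a _ _))))

  -- Different slopes allow only one common value; this is what confines the agreement of elements
  -- with different powers of s to one block.
  affine-agree : ∀ {m n a b e f} → e < p → f < p → ¬ m ≋ n →
    a + m * e ≋ b + n * e → a + m * f ≋ b + n * f → e ≡ f
  affine-agree {m} {n} {a} {b} {e} {f} e<p f<p m≢n E F with <-cmp e f
  ... | tri≈ _ e≡f _ = e≡f
  ... | tri< e<f _ _ = contradiction (slope e<f f<p E F) m≢n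
  ... | tri> _ _ f<e = contradiction (slope f<e e<p F E) m≢n

  abstract
    [_]ₚ : ℕ → Fin p
    [ m ]ₚ = m mod p

    toℕ-[] : ∀ m → toℕ [ m ]ₚ ≡ m % p
    toℕ-[] m = toℕ-fromℕ< (m%n<n m p)

  toℕ-[]-≋ : ∀ m → toℕ [ m ]ₚ ≋ m
  toℕ-[]-≋ m = trans (cong (_% p) (toℕ-[] m)) (m%n%n≡m%n m p)

  []-cong : ∀ {m n} → m ≋ n → [ m ]ₚ ≡ [ n ]ₚ
  []-cong {m} {n} e = toℕ-injective (trans (toℕ-[] m) (trans e (sym (toℕ-[] n))))

  []-toℕ : ∀ i → [ toℕ i ]ₚ ≡ i
  []-toℕ i = toℕ-injective (trans (toℕ-[] _) (m<n⇒m%n≡m (toℕ<n i)))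

  []-injective : ∀ {m n} → [ m ]ₚ ≡ [ n ]ₚ → m ≋ n
  []-injective {m} {n} e = trans (sym (toℕ-[] m)) (trans (cong toℕ e) (toℕ-[] n))

  _⊕_ : Fin p → Fin p → Fin p
  i ⊕ j = [ toℕ i + toℕ j ]ₚ

  ⊖_ : Fin p → Fin p
  ⊖ i = [ pred p * toℕ i ]ₚ

  private
    ⊕-comm : ∀ i j → i ⊕ j ≡ j ⊕ i
    ⊕-comm i j = cong [_]ₚ (+-comm (toℕ i) (toℕ j))

    ⊕-assoc : ∀ i j k → (i ⊕ j) ⊕ k ≡ i ⊕ (j ⊕ k)
    ⊕-assoc i j k = []-cong (trans (≋-+ {n = toℕ k} (toℕ-[]-≋ _) refl)
      (trans (cong (_% p) (+-assoc (toℕ i) (toℕ j) (toℕ k))) (≋-+ {toℕ i} refl (sym (toℕ-[]-≋ (toℕ j + toℕ k))))))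

    ⊕-identityˡ : ∀ i → [ 0 ]ₚ ⊕ i ≡ i
    ⊕-identityˡ i = trans ([]-cong (≋-+ {n = toℕ i} (toℕ-[]-≋ 0) refl)) ([]-toℕ i)

    ⊕-inverseˡ : ∀ i → (⊖ i) ⊕ i ≡ [ 0 ]ₚ
    ⊕-inverseˡ i = []-cong (trans (≋-+ {n = toℕ i} (toℕ-[]-≋ _) refl) (neg-+ (toℕ i)))

  ⊕-isAbelianGroup : IsAbelianGroup _≡_ _⊕_ [ 0 ]ₚ ⊖_
  ⊕-isAbelianGroup = record
    { isGroup = record
      { isMonoid = record
        { isSemigroup = record
          { isMagma = record { isEquivalence = isEquivalence ; ∙-cong = cong₂ _⊕_ }
          ; assoc = ⊕-assoc }
        ; identity = ⊕-identityˡ , λ i → trans (⊕-comm i _) (⊕-identityˡ i) }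
      ; inverse = ⊕-inverseˡ , λ i → trans (⊕-comm i _) (⊕-inverseˡ i)
      ; ⁻¹-cong = cong ⊖_ }
    ; comm = ⊕-comm }

  ⊕-cubes : 3 < p → ∀ {i j} → i ⊕ (i ⊕ i) ≡ j ⊕ (j ⊕ j) → i ≡ j
  ⊕-cubes 3<p {i} {j} e = toℕ-injective (≋⇒≡ (toℕ<n i) (toℕ<n j)
    (≋-*-cancelʳ 3 (s≤s z≤n) 3<p (trans (sym (triple i)) (trans ([]-injective e) (triple j)))))
    where
    triple : ∀ i → toℕ i + toℕ (i ⊕ i) ≋ toℕ i * 3
    triple i = trans (≋-+ {toℕ i} refl (toℕ-[]-≋ (toℕ i + toℕ i)))
      (cong (_% p) (trans (cong (λ z → toℕ i + (toℕ i + z)) (sym (+-identityʳ _))) (*-comm 3 (toℕ i))))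

  private
    halve : ∀ n → (∃ λ h → n ≡ h * 2) ⊎ Odd n
    halve zero = inj₁ (0 , refl)
    halve (suc n) with halve n
    ... | inj₁ (h , e) = inj₂ (h , cong suc e)
    ... | inj₂ (h , e) = inj₁ (suc h , cong suc e)

  abstract
    odd : 2 < p → Odd p
    odd 2<p with halve p
    ... | inj₂ r = r
    ... | inj₁ (h , e) with prime⇒irreducible pr (divides h e)
    ... | inj₁ ()
    ... | inj₂ refl = contradiction 2<p (<-irrefl refl)

-- Descent to a minimal normal subgroup

-- Descent on the number of elements: a normal subgroup inside the candidate is either smaller, so
-- that the argument repeats, or equal to it by counting. Minimality quantifies over all subgroups
-- and is not decided, hence the double negation.
¬¬-minimalNormal : ∀ {n} {G : PermGroup n} {P : Perm n → Set} (H : PermGroup n) →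
  Normal H G → Nontrivial H → (∀ {σ} → σ ∈ elems H → P σ) →
  ¬ ¬ (Σ (PermGroup n) λ N → MinimalNormal N G × (∀ {σ} → σ ∈ elems N → P σ))
¬¬-minimalNormal {n} {G} {P} H nH tH pH none = go _ H ≤-refl nH tH pH
  where
  go : ∀ fuel (H : PermGroup n) → length (elems H) ≤ fuel → Normal H G → Nontrivial H →
    (∀ {σ} → σ ∈ elems H → P σ) → ⊥
  go zero H l _ _ _ with elems H | hasId H
  go zero H () _ _ _ | _ ∷ _ | _
  go (suc fuel) H l nH tH pH = none (H , (nH , tH , minimal) , pH)
    where
    minimal : (N : PermGroup n) → Normal N G → Nontrivial N → N ⊆G H → H ⊆G N
    minimal N nN tN N⊆H with length (elems N) <? length (elems H)
    ... | yes lt = ⊥-elim (go fuel N (s≤s⁻¹ (≤-trans lt l)) nN tN (pH ∘ All.lookup N⊆H))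
    ... | no ¬lt = All.tabulate λ h∈ →
      let (σ , σ∈ , e) = injective⇒onto _≟ᵖ_ id (uniq N) (All.lookup N⊆H) (λ _ _ e → e) (≮⇒≥ ¬lt) h∈
      in subst (_∈ elems N) e σ∈

-- The induced action on blocks and its kernel

module Blocks {n p} (G : PermGroup n) (blk : Fin n → Fin p) (invariant : Invariant G blk)
  (nonempty : ∀ i → ∃ λ ω → blk ω ≡ i) where

  open Elements G public

  onBlocks : El → Fin p → Fin p
  onBlocks g i = blk (act g (proj₁ (nonempty i)))

  blk-act : ∀ g ω → blk (act g ω) ≡ onBlocks g (blk ω)
  blk-act g ω = invariant (perm∈ g) _ _ (sym (proj₂ (nonempty (blk ω))))

  onBlocks-ε : ∀ i → onBlocks ε i ≡ i
  onBlocks-ε i = trans (cong blk (act-ε _)) (proj₂ (nonempty i))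

  onBlocks-∙ : ∀ g h i → onBlocks (g ∙ h) i ≡ onBlocks g (onBlocks h i)
  onBlocks-∙ g h i = trans (cong blk (act-∙ g h _)) (blk-act g _)

  onBlocks-^ : ∀ g m i → onBlocks (g ^ m) i ≡ fold i (onBlocks g) m
  onBlocks-^ g zero i = onBlocks-ε i
  onBlocks-^ g (suc m) i = trans (onBlocks-∙ g (g ^ m) i) (cong (onBlocks g) (onBlocks-^ g m i))

  onBlocks-inverseˡ : ∀ g i → onBlocks (g ⁻¹) (onBlocks g i) ≡ i
  onBlocks-inverseˡ g i = trans (sym (onBlocks-∙ (g ⁻¹) g i))
    (trans (cong (λ h → onBlocks h i) (inverseˡ g)) (onBlocks-ε i))

  onBlocks-inverseʳ : ∀ g i → onBlocks g (onBlocks (g ⁻¹) i) ≡ i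
  onBlocks-inverseʳ g i = trans (sym (onBlocks-∙ g (g ⁻¹) i))
    (trans (cong (λ h → onBlocks h i) (inverseʳ g)) (onBlocks-ε i))

  infix 4 _≈_
  -- Equality in Ḡ. The quotient is never formed; elements of `G` are compared modulo the kernel.
  _≈_ : El → El → Set
  g ≈ h = ∀ i → onBlocks g i ≡ onBlocks h i

  ∙-≈ : ∀ {g g′ h h′} → g ≈ g′ → h ≈ h′ → g ∙ h ≈ g′ ∙ h′
  ∙-≈ {g} {g′} {h} {h′} e f i = trans (onBlocks-∙ g h i)
    (trans (cong (onBlocks g) (f i)) (trans (e _) (sym (onBlocks-∙ g′ h′ i))))

  ≈-refl : ∀ {g} → g ≈ g
  ≈-refl i = refl

  ≈-sym : ∀ {g h} → g ≈ h → h ≈ g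
  ≈-sym e i = sym (e i)

  ≈-trans : ∀ {g h k} → g ≈ h → h ≈ k → g ≈ k
  ≈-trans e f i = trans (e i) (f i)

  ≡⇒≈ : ∀ {g h} → g ≡ h → g ≈ h
  ≡⇒≈ refl = ≈-refl

  _≈?_ : ∀ g h → Dec (g ≈ h)
  g ≈? h = all? λ i → onBlocks g i ≟ᶠ onBlocks h i

  K? : Decidable (_≈ ε)
  K? g = g ≈? ε

  kernel : List El
  kernel = filter K? allEl

  kernel-unique : Unique kernel
  kernel-unique = Uniqueₚ.filter⁺ K? allEl-unique

  kernel⁺ : ∀ {g} → g ≈ ε → g ∈ kernel
  kernel⁺ = ∈-filter⁺ K? (allEl-complete _)

  kernel⁻ : ∀ {g} → g ∈ kernel → g ≈ ε
  kernel⁻ i = proj₂ (∈-filter⁻ K? {xs = allEl} i)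

  ⁻¹-≈ε : ∀ {g} → g ≈ ε → g ⁻¹ ≈ ε
  ⁻¹-≈ε {g} e = ≈-trans (≡⇒≈ (sym (identityʳ (g ⁻¹))))
    (≈-trans (∙-≈ {g ⁻¹} ≈-refl (≈-sym e)) (≡⇒≈ (inverseˡ g)))

  inKernel⇒≈ε : ∀ {g} → InKernel blk (perm g) → g ≈ ε
  inKernel⇒≈ε {g} k i = trans (k _) (trans (proj₂ (nonempty i)) (sym (onBlocks-ε i)))

  ≈ε⇒inKernel : ∀ {g} → g ≈ ε → InKernel blk (perm g)
  ≈ε⇒inKernel {g} e ω = trans (blk-act g ω) (trans (e (blk ω)) (onBlocks-ε _))

  inKernel? : Decidable (InKernel blk)
  inKernel? σ = all? λ ω → blk (app σ ω) ≟ᶠ blk ω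

  Kernel : PermGroup n
  Kernel = record
    { elems = filter inKernel? (elems G)
    ; uniq = Uniqueₚ.filter⁺ inKernel? (uniq G)
    ; perms = Allₚ.filter⁺ inKernel? (perms G)
    ; hasId = ∈-filter⁺ inKernel? (hasId G) λ ω → cong blk (lookup∘tabulate id ω)
    ; closed = λ i j → let (i′ , k) = un i ; (j′ , l) = un j in
        ∈-filter⁺ inKernel? (closed G i′ j′) λ ω → trans (cong blk (lookup∘tabulate _ ω)) (trans (k _) (l ω))
    }
    where
    un : ∀ {σ} → σ ∈ filter inKernel? (elems G) → σ ∈ elems G × InKernel blk σ
    un = ∈-filter⁻ inKernel? {xs = elems G}

  ∈Kernel⁻ : ∀ {σ} → σ ∈ elems Kernel → σ ∈ elems G × InKernel blk σ
  ∈Kernel⁻ = ∈-filter⁻ inKernel? {xs = elems G}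

  Kernel-normal : Normal Kernel G
  Kernel-normal = All.tabulate (proj₁ ∘ ∈Kernel⁻) , λ {σ} {τ} σ∈ τ∈ →
    let g = index σ∈ ; h = index (proj₁ (∈Kernel⁻ τ∈))
        pg = perm-index σ∈ ; ph = perm-index (proj₁ (∈Kernel⁻ τ∈))
        h≈ε = inKernel⇒≈ε {h} (subst (InKernel blk) (sym ph) (proj₂ (∈Kernel⁻ τ∈)))
        c = g ∙ h ∙ g ⁻¹
        c≈ε = ≈-trans (∙-≈ {g ∙ h} {g} {g ⁻¹} (≈-trans (∙-≈ {g} ≈-refl h≈ε) (≡⇒≈ (identityʳ g))) ≈-refl) (≡⇒≈ (inverseʳ g))
        cg : c ∙ g ≡ g ∙ h
        cg = trans (assoc (g ∙ h) (g ⁻¹) g) (trans (cong (g ∙ h ∙_) (inverseˡ g)) (identityʳ _))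
    in perm c , ∈-filter⁺ inKernel? (perm∈ c) (≈ε⇒inKernel {c} c≈ε) ,
       trans (cong₂ _∘P_ (sym pg) (sym ph)) (trans (sym (perm-∙ g h)) (trans (cong perm (sym cg))
         (trans (perm-∙ c g) (cong (perm c ∘P_) pg))))

-- Elements of order p, multipliers and Burnside's count

module PrimeBlocks {p} (pr : Prime p) (5≤p : 5 ≤ p) (G : PermGroup (3 * p)) (transitive : Transitive G)
  (blk : Fin (3 * p) → Fin p) (size3 : ∀ b → blockSize blk b ≡ 3) (invariant : Invariant G blk) where

  open Mod p pr public

  block : Fin p → List (Fin (3 * p))
  block b = filter (λ i → blk i ≟ᶠ b) (allFin (3 * p))

  private
    3<p : 3 < p
    3<p = <-≤-trans (n<1+n 3) (<⇒≤ 5≤p)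

    nonempty : ∀ b → ∃ λ ω → blk ω ≡ b
    nonempty b = first (block b) (size3 b) λ i → proj₂ (∈-filter⁻ (λ i → blk i ≟ᶠ b) {xs = allFin (3 * p)} i)
      where
      first : ∀ l → length l ≡ 3 → (∀ {ω} → ω ∈ l → blk ω ≡ b) → ∃ λ ω → blk ω ≡ b
      first (ω ∷ _) _ h = ω , h (here refl)

    instance
      p≢0 : NonZero p
      p≢0 = prime⇒nonZero pr

  open Blocks G blk invariant nonempty public

  block⁺ : ∀ {ω b} → blk ω ≡ b → ω ∈ block b
  block⁺ {ω} {b} = ∈-filter⁺ (λ i → blk i ≟ᶠ b) (∈-allFin ω)

  moved : ∀ {g} → g ≢ ε → ∃ λ ω → act g ω ≢ ω
  moved {g} ne with any? (λ ω → ¬? (act g ω ≟ᶠ ω))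
  ... | yes r = r
  ... | no ¬r = contradiction (faithful λ ω →
        trans (decidable-stable (act g ω ≟ᶠ ω) (λ q → ¬r (ω , q))) (sym (act-ε ω))) ne

  -- An orbit of length p does not fit into a block of size 3.
  kernel-order : ∀ {g} → g ≈ ε → g ^ p ≡ ε → g ≡ ε
  kernel-order {g} k gp = decidable-stable (g ≟ᶠ ε) λ ne →
    let (ω , mv) = moved ne
        ord : fold ω (act g) p ≡ ω
        ord = trans (sym (act-^ g p ω)) (trans (cong (λ h → act h ω) gp) (act-ε ω))
    in <⇒≱ 3<p (begin
      p                                             ≡⟨ length-applyUpTo (fold ω (act g)) p ⟨
      length (applyUpTo (fold ω (act g)) p)         ≤⟨ ⊆-length (orbit-unique (act g) pr ord mv) (λ i →
        let (m , _ , e) = ∈-applyUpTo⁻ (fold ω (act g)) i in block⁺ (trans (cong blk e) (in-block ω m))) ⟩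
      length (block (blk ω))                        ≡⟨ size3 (blk ω) ⟩
      3                                             ∎)
    where
    open ≤-Reasoning
    in-block : ∀ ω m → blk (fold ω (act g) m) ≡ blk ω
    in-block ω zero = refl
    in-block ω (suc m) = trans (≈ε⇒inKernel {g} k _) (in-block ω m)

  p∤kernel : ¬ p ∣ length kernel
  p∤kernel d =
    let (a , a∈ , ne , ord) = Cauchy.cauchy kernel-unique (kernel⁺ {ε} λ _ → refl)
          (λ {a} {b} i j → kernel⁺ {a ∙ b} (≈-trans (∙-≈ {a} {ε} {b} {ε} (kernel⁻ i) (kernel⁻ j)) (≡⇒≈ (identityˡ ε))))
          (λ {a} i → kernel⁺ {a ⁻¹} (⁻¹-≈ε {a} (kernel⁻ i))) pr d
    in ne (kernel-order {a} (kernel⁻ a∈) ord)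

  order-count : ∀ ω → length allEl ≡ (3 * p) * stabSize G ω
  order-count ω = trans (OrbitStabiliser.orbit-stabiliser act act-∙ act-ε ω
      (λ i → let (σ , σ∈ , e) = transitive ω i in element σ , trans (act-element σ∈ ω) e))
    (cong (3 * p *_) (stabSize≡ ω))

  -- Normalisation of the cycle x̄ in Ḡ, written without inverses.
  Multiplier : El → El → ℕ → Set
  Multiplier x h k = h ∙ x ≈ (x ^ k) ∙ h

  cycle : Fin (3 * p) → ∃ λ x → x ≢ ε × x ^ p ≡ ε
  cycle ω = let (x , _ , r) = Cauchy.cauchy allEl-unique (allEl-complete ε) (λ _ _ → allEl-complete _)
                  (λ _ → allEl-complete _) pr (subst (p ∣_) (sym (order-count ω)) (∣-trans (n∣m*n 3) (m∣m*n _)))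
            in x , r

  abstract
    move-blocks : TwoTransitiveOnBlocks G blk → ∀ {i j k l} → i ≢ j → k ≢ l → ∃ λ g → onBlocks g i ≡ k × onBlocks g j ≡ l
    move-blocks two {i} {j} {k} {l} i≢j k≢l =
      let (a , a≡) = nonempty i ; (b , b≡) = nonempty j ; (c , c≡) = nonempty k ; (d , d≡) = nonempty l
          (σ , σ∈ , e₁ , e₂) = two a b c d (λ e → i≢j (trans (sym a≡) (trans e b≡)))
            (λ e → k≢l (trans (sym c≡) (trans e d≡)))
          g = element σ
      in g , trans (cong (onBlocks g) (sym a≡)) (trans (sym (blk-act g a)) (trans (cong blk (act-element σ∈ a)) (trans e₁ c≡)))
           , trans (cong (onBlocks g) (sym b≡)) (trans (sym (blk-act g b)) (trans (cong blk (act-element σ∈ b)) (trans e₂ d≡)))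

  module Cycle (x : El) (x≢ε : x ≢ ε) (x^p : x ^ p ≡ ε) where

    x̄ : Fin p → Fin p
    x̄ = onBlocks x

    x̄-order : ∀ i → fold i x̄ p ≡ i
    x̄-order i = trans (sym (onBlocks-^ x p i)) (trans (cong (λ g → onBlocks g i) x^p) (onBlocks-ε i))

    x^-cong : ∀ {m n} → m ≋ n → x ^ m ≡ x ^ n
    x^-cong {m} {n} e = trans (reduce m) (trans (cong (x ^_) e) (sym (reduce n)))
      where
      reduce : ∀ m → x ^ m ≡ x ^ (m % p)
      reduce m = trans (cong (x ^_) (m≡m%n+[m/n]*n m p)) (trans (^-+ x (m % p) _)
        (trans (cong (x ^ (m % p) ∙_) (trans (^-* x (m / p) p) (trans (cong (_^ (m / p)) x^p) (ε^ (m / p)))))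
        (identityʳ _)))

    x̄-cong : ∀ {m n} i → m ≋ n → fold i x̄ m ≡ fold i x̄ n
    x̄-cong {m} {n} i e = trans (sym (onBlocks-^ x m i))
      (trans (cong (λ g → onBlocks g i) (x^-cong e)) (onBlocks-^ x n i))

    private
      reach-from : ∀ {β} → x̄ β ≢ β → ∀ i → ∃ λ m → m ∈ upTo p × fold β x̄ m ≡ i
      reach-from {β} mv i with injective⇒onto _≟ᶠ_ id {ys = allFin p} (orbit-unique x̄ pr (x̄-order β) mv)
        (λ _ → ∈-allFin _) (λ _ _ e → e)
        (≤-reflexive (trans (length-tabulate {n = p} id) (sym (length-applyUpTo (fold β x̄) p)))) (∈-allFin i)
      ... | j , j∈ , refl with ∈-applyUpTo⁻ (fold β x̄) j∈
      ... | m , m<p , e = m , ∈-upTo⁺ m<p , sym e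

      moves-some : ∃ λ β → x̄ β ≢ β
      moves-some with any? (λ β → ¬? (x̄ β ≟ᶠ β))
      ... | yes r = r
      ... | no ¬r = contradiction (kernel-order {x} (λ i → trans
            (decidable-stable (x̄ i ≟ᶠ i) λ q → ¬r (i , q)) (sym (onBlocks-ε i))) x^p) x≢ε

    -- The orbit of one moved block β already contains all `p` blocks. A fixed block would lie on
    -- it, and following the orbit on to β would show β fixed as well.
    x̄-moves : ∀ i → x̄ i ≢ i
    x̄-moves i e =
      let (β , mv) = moves-some
          (m , m∈ , β→i) = reach-from mv i
          m≤p = <⇒≤ (∈-upTo⁻ m∈)
          β≡ : fold i x̄ (p ∸ m) ≡ β
          β≡ = trans (cong (λ z → fold z x̄ (p ∸ m)) (sym β→i)) (trans (sym (fold-+ β x̄ (p ∸ m)))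
            (trans (cong (fold β x̄) (m∸n+n≡m m≤p)) (x̄-order β)))
      in mv (trans (cong x̄ (sym β≡)) (trans (fold-comm x̄ i (p ∸ m))
           (trans (cong (λ z → fold z x̄ (p ∸ m)) e) β≡)))

    private
      apart : ∀ {β m n} → m < n → n < p → fold β x̄ m ≢ fold β x̄ n
      apart {β} {m} {n} m<n n<p e = x̄-moves _ (fold-coprime x̄
        (prime⇒coprime pr {{>-nonZero (m<n⇒0<n∸m m<n)}} (≤-<-trans (m∸n≤m n m) n<p))
        (trans (sym (fold-+ β x̄ (n ∸ m))) (trans (cong (fold β x̄) (m∸n+n≡m (<⇒≤ m<n))) (sym e)))
        (x̄-order (fold β x̄ m)))

    abstract
      reach : ∀ β i → ∃ λ m → m ∈ upTo p × fold β x̄ m ≡ i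
      reach β = reach-from (x̄-moves β)

    x̄-injective : ∀ β {m n} → m < p → n < p → fold β x̄ m ≡ fold β x̄ n → m ≡ n
    x̄-injective β {m} {n} m<p n<p e with <-cmp m n
    ... | tri≈ _ q _ = q
    ... | tri< m<n _ _ = contradiction e (apart m<n n<p)
    ... | tri> _ _ n<m = contradiction (sym e) (apart n<m m<p)

    x̄^-moves : ∀ {k} → 0 < k → k < p → ∀ i → fold i x̄ k ≢ i
    x̄^-moves {k} 0<k k<p i e = x̄-moves i (fold-coprime x̄ (prime⇒coprime pr {{>-nonZero 0<k}} k<p) e (x̄-order i))

    -- Multipliers lift to G because p does not divide |K|: κ ↦ xᵏ κ y x⁻¹ y⁻¹ has order p on K.
    abstract
      lift : ∀ {y k} → Multiplier x y k → ∃ λ s → s ≈ y × s ∙ x ≡ (x ^ k) ∙ s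
      lift {y} {k} mult =
        let (κ , κ∈ , fix) = fixed-point φ pr _≟ᶠ_ kernel-unique φ∈ (λ {κ} _ → φ-order κ) p∤kernel
        in κ ∙ y , ≈-trans (∙-≈ {κ} {ε} {y} (kernel⁻ κ∈) ≈-refl) (≡⇒≈ (identityˡ y)) , commutes κ fix
        where
        c : El
        c = y ∙ x ⁻¹ ∙ y ⁻¹
        a : El
        a = x ^ k
        φ : El → El
        φ κ = a ∙ (κ ∙ c)
        φ∈ : ∀ {κ} → κ ∈ kernel → φ κ ∈ kernel
        φ∈ {κ} κ∈ = kernel⁺ {φ κ} (≈-trans
          (∙-≈ {a} ≈-refl (≈-trans (∙-≈ {κ} {ε} {c} (kernel⁻ κ∈) ≈-refl) (≡⇒≈ (identityˡ c))))
          (λ i → begin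
            onBlocks (a ∙ c) i                                                   ≡⟨ onBlocks-∙ a c i ⟩
            onBlocks a (onBlocks c i)                                            ≡⟨ cong (onBlocks a) (onBlocks-∙ (y ∙ x ⁻¹) (y ⁻¹) i) ⟩
            onBlocks a (onBlocks (y ∙ x ⁻¹) (onBlocks (y ⁻¹) i))                 ≡⟨ cong (onBlocks a) (onBlocks-∙ y (x ⁻¹) _) ⟩
            onBlocks a (onBlocks y (onBlocks (x ⁻¹) (onBlocks (y ⁻¹) i)))        ≡⟨ onBlocks-∙ a y _ ⟨
            onBlocks (a ∙ y) (onBlocks (x ⁻¹) (onBlocks (y ⁻¹) i))               ≡⟨ mult _ ⟨
            onBlocks (y ∙ x) (onBlocks (x ⁻¹) (onBlocks (y ⁻¹) i))               ≡⟨ onBlocks-∙ y x _ ⟩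
            onBlocks y (onBlocks x (onBlocks (x ⁻¹) (onBlocks (y ⁻¹) i)))        ≡⟨ cong (onBlocks y) (onBlocks-inverseʳ x _) ⟩
            onBlocks y (onBlocks (y ⁻¹) i)                                       ≡⟨ onBlocks-inverseʳ y i ⟩
            i                                                                    ≡⟨ onBlocks-ε i ⟨
            onBlocks ε i                                                         ∎))
          where open ≡-Reasoning
        φ-fold : ∀ κ m → fold κ φ m ≡ (a ^ m) ∙ (κ ∙ (c ^ m))
        φ-fold κ zero = sym (trans (identityˡ _) (identityʳ κ))
        φ-fold κ (suc m) = trans (cong φ (φ-fold κ m)) (trans
          (cong (a ∙_) (trans (assoc (a ^ m) _ c) (cong ((a ^ m) ∙_) (trans (assoc κ _ c) (cong (κ ∙_) (sym (^-suc c m)))))))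
          (sym (assoc a (a ^ m) _)))
        a^p : a ^ p ≡ ε
        a^p = trans (sym (^-* x p k)) (trans (cong (x ^_) (*-comm p k)) (trans (^-* x k p) (trans (cong (_^ k) x^p) (ε^ k))))
        x⁻¹^p : (x ⁻¹) ^ p ≡ ε
        x⁻¹^p = trans (sym (identityˡ _)) (trans (cong (_∙ ((x ⁻¹) ^ p)) (sym x^p)) (⁻¹-^ x p))
        c^p : c ^ p ≡ ε
        c^p = ∙-cancelʳ y (c ^ p) ε (trans (conjugate-^ y (x ⁻¹) p)
          (trans (cong (y ∙_) x⁻¹^p) (trans (identityʳ y) (sym (identityˡ y)))))
        φ-order : ∀ κ → fold κ φ p ≡ κ
        φ-order κ = trans (φ-fold κ p) (trans (cong₂ (λ u v → u ∙ (κ ∙ v)) a^p c^p) (trans (identityˡ _) (identityʳ κ)))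
        -- A fixed point satisfies xᵏ κ c = κ; multiplied by y x on the right, where c y x = y, this
        -- becomes the exact relation for κ y.
        commutes : ∀ κ → φ κ ≡ κ → (κ ∙ y) ∙ x ≡ a ∙ (κ ∙ y)
        commutes κ fix = trans (cong (λ z → (z ∙ y) ∙ x) (sym fix)) (trans (assoc (φ κ) y x)
          (trans (assoc a (κ ∙ c) _) (cong (a ∙_) (trans (assoc κ c _) (cong (κ ∙_) cyx)))))
          where
          cyx : c ∙ (y ∙ x) ≡ y
          cyx = trans (assoc (y ∙ x ⁻¹) (y ⁻¹) _) (trans (cong ((y ∙ x ⁻¹) ∙_)
            (trans (sym (assoc (y ⁻¹) y x)) (trans (cong (_∙ x) (inverseˡ y)) (identityˡ x))))
            (trans (assoc y (x ⁻¹) x) (trans (cong (y ∙_) (inverseˡ x)) (identityʳ y))))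

    module Burnside (two : TwoTransitiveOnBlocks G blk) (central : ∀ h k → Multiplier x h k → k ≋ 1) where

      -- (g, k, κ) ↦ g xᵏ g⁻¹ κ is |K| p to one onto the elements without fixed blocks.
      private
        exponents : List ℕ
        exponents = applyUpTo suc (pred p)

        exponent⁻ : ∀ {k} → k ∈ exponents → 0 < k × k < p
        exponent⁻ i with ∈-applyUpTo⁻ suc i
        ... | k , k< , refl = s≤s z≤n , subst (suc k <_) (suc-pred p) (s≤s k<)

        triples : List (El × ℕ × El)
        triples = cartesianProduct allEl (cartesianProduct exponents kernel)

        triples-unique : Unique triples
        triples-unique = Uniqueₚ.cartesianProduct⁺ allEl-unique (Uniqueₚ.cartesianProduct⁺
          (Uniqueₚ.applyUpTo⁺₁ suc (pred p) λ i<j _ e → <⇒≢ i<j (suc-injective e)) kernel-unique)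

        triples-length : length triples ≡ length allEl * (pred p * length kernel)
        triples-length = trans (length-×-product allEl _) (cong (length allEl *_)
          (trans (length-×-product exponents kernel) (cong (_* length kernel) (length-applyUpTo suc (pred p)))))

        triple⁻ : ∀ {g k κ} → (g , k , κ) ∈ triples → 0 < k × k < p × κ ≈ ε
        triple⁻ i = let (_ , j) = ∈-cartesianProduct⁻ allEl (cartesianProduct exponents kernel) i
                        (k∈ , κ∈) = ∈-cartesianProduct⁻ exponents kernel j
                        (a , b) = exponent⁻ k∈
                    in a , b , kernel⁻ κ∈

        f : El × ℕ × El → El
        f (g , k , κ) = g ∙ (x ^ k) ∙ g ⁻¹ ∙ κ

        f-onBlocks : ∀ {g k κ} → κ ≈ ε → ∀ i →
          onBlocks (f (g , k , κ)) i ≡ onBlocks g (fold (onBlocks (g ⁻¹) i) x̄ k)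
        f-onBlocks {g} {k} {κ} κ≈ε i = begin
          onBlocks (g ∙ (x ^ k) ∙ g ⁻¹ ∙ κ) i                     ≡⟨ onBlocks-∙ (g ∙ (x ^ k) ∙ g ⁻¹) κ i ⟩
          onBlocks (g ∙ (x ^ k) ∙ g ⁻¹) (onBlocks κ i)            ≡⟨ cong (onBlocks _) (trans (κ≈ε i) (onBlocks-ε i)) ⟩
          onBlocks (g ∙ (x ^ k) ∙ g ⁻¹) i                         ≡⟨ onBlocks-∙ (g ∙ (x ^ k)) (g ⁻¹) i ⟩
          onBlocks (g ∙ (x ^ k)) (onBlocks (g ⁻¹) i)              ≡⟨ onBlocks-∙ g (x ^ k) _ ⟩
          onBlocks g (onBlocks (x ^ k) (onBlocks (g ⁻¹) i))       ≡⟨ cong (onBlocks g) (onBlocks-^ x k _) ⟩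
          onBlocks g (fold (onBlocks (g ⁻¹) i) x̄ k)               ∎
          where open ≡-Reasoning

        f-moves : ∀ {g k κ} → (g , k , κ) ∈ triples → ∀ i → onBlocks (f (g , k , κ)) i ≢ i
        f-moves {g} {k} {κ} t∈ i e =
          let (0<k , k<p , κ≈ε) = triple⁻ t∈
          in x̄^-moves 0<k k<p (onBlocks (g ⁻¹) i) (trans (sym (onBlocks-inverseˡ g _))
               (cong (onBlocks (g ⁻¹)) (trans (sym (f-onBlocks {g} {k} {κ} κ≈ε i)) e)))

        0<p : 0 < p
        0<p = <-trans (s≤s z≤n) 3<p
        1<p : 1 < p
        1<p = <-trans (s≤s (s≤s z≤n)) 3<p
        2<p : 2 < p
        2<p = <-trans (s≤s (s≤s (s≤s z≤n))) 3<p

        β i₁ i₂ : Fin p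
        β = fromℕ< 0<p
        i₁ = fromℕ< 1<p
        i₂ = fromℕ< 2<p

        -- Equal values mean that `h` conjugates the `k`-th power of x̄ to the `k₀`-th. With `l`
        -- inverse to `k`, the number l k₀ is a multiplier of `h`, so `central` gives k = k₀. Then
        -- `h` commutes with the p-cycle x̄ and is one of its powers modulo the kernel.
        module Fibre {g k κ} (w∈ : (g , k , κ) ∈ triples) {g₀ k₀ κ₀} (w₀∈ : (g₀ , k₀ , κ₀) ∈ triples)
          (e : f (g , k , κ) ≡ f (g₀ , k₀ , κ₀)) where

          h : El
          h = g₀ ⁻¹ ∙ g

          H : Fin p → Fin p
          H = onBlocks h

          step : ∀ i → H (fold i x̄ k) ≡ fold (H i) x̄ k₀
          step i = begin
            onBlocks (g₀ ⁻¹ ∙ g) (fold i x̄ k)                  ≡⟨ onBlocks-∙ (g₀ ⁻¹) g _ ⟩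
            onBlocks (g₀ ⁻¹) (onBlocks g (fold i x̄ k))
              ≡⟨ cong (λ z → onBlocks (g₀ ⁻¹) (onBlocks g (fold z x̄ k))) (onBlocks-inverseˡ g i) ⟨
            onBlocks (g₀ ⁻¹) (onBlocks g (fold (onBlocks (g ⁻¹) (onBlocks g i)) x̄ k))
              ≡⟨ cong (onBlocks (g₀ ⁻¹)) (f-onBlocks {g} {k} {κ} (proj₂ (proj₂ (triple⁻ w∈))) (onBlocks g i)) ⟨
            onBlocks (g₀ ⁻¹) (onBlocks (f (g , k , κ)) (onBlocks g i))
              ≡⟨ cong (λ z → onBlocks (g₀ ⁻¹) (onBlocks z (onBlocks g i))) e ⟩
            onBlocks (g₀ ⁻¹) (onBlocks (f (g₀ , k₀ , κ₀)) (onBlocks g i))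
              ≡⟨ cong (onBlocks (g₀ ⁻¹)) (f-onBlocks {g₀} {k₀} {κ₀} (proj₂ (proj₂ (triple⁻ w₀∈))) (onBlocks g i)) ⟩
            onBlocks (g₀ ⁻¹) (onBlocks g₀ (fold (onBlocks (g₀ ⁻¹) (onBlocks g i)) x̄ k₀))
              ≡⟨ onBlocks-inverseˡ g₀ _ ⟩
            fold (onBlocks (g₀ ⁻¹) (onBlocks g i)) x̄ k₀        ≡⟨ cong (λ z → fold z x̄ k₀) (onBlocks-∙ (g₀ ⁻¹) g i) ⟨
            fold (H i) x̄ k₀                                    ∎
            where open ≡-Reasoning

          steps : ∀ l i → H (fold i x̄ (l * k)) ≡ fold (H i) x̄ (l * k₀)
          steps zero i = refl
          steps (suc l) i = trans (cong H (fold-+ i x̄ k)) (trans (step _)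
            (trans (cong (λ z → fold z x̄ k₀) (steps l i)) (sym (fold-+ (H i) x̄ k₀))))

          l : ℕ
          l = proj₁ (inverse (proj₁ (triple⁻ w∈)) (proj₁ (proj₂ (triple⁻ w∈))))

          lk : l * k ≋ 1
          lk = proj₂ (inverse (proj₁ (triple⁻ w∈)) (proj₁ (proj₂ (triple⁻ w∈))))

          H-x̄ : ∀ i → H (x̄ i) ≡ fold (H i) x̄ (l * k₀)
          H-x̄ i = trans (cong H (sym (x̄-cong i lk))) (steps l i)

          lk₀ : l * k₀ ≋ 1
          lk₀ = central h (l * k₀) λ i → trans (onBlocks-∙ h x i) (trans (H-x̄ i)
            (sym (trans (onBlocks-∙ (x ^ (l * k₀)) h i) (onBlocks-^ x (l * k₀) _))))

          k≡k₀ : k ≡ k₀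
          k≡k₀ = ≋⇒≡ (proj₁ (proj₂ (triple⁻ w∈))) (proj₁ (proj₂ (triple⁻ w₀∈))) (begin
            k % p                  ≡⟨ cong (_% p) (*-identityˡ k) ⟨
            (1 * k) % p            ≡⟨ ≋-* {n = k} lk₀ refl ⟨
            (l * k₀ * k) % p       ≡⟨ cong (_% p) (trans (*-assoc l k₀ k) (trans (cong (l *_) (*-comm k₀ k)) (sym (*-assoc l k k₀)))) ⟩
            (l * k * k₀) % p       ≡⟨ ≋-* {n = k₀} lk refl ⟩
            (1 * k₀) % p           ≡⟨ cong (_% p) (*-identityˡ k₀) ⟩
            k₀ % p                 ∎)
            where open ≡-Reasoning

          q : ℕ
          q = proj₁ (reach β (H β))

          H-power : ∀ i → H i ≡ fold i x̄ q
          H-power i with reach β i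
          ... | m , _ , refl = trans (along m) (trans (cong (λ z → fold z x̄ m) (sym (proj₂ (proj₂ (reach β (H β))))))
            (trans (sym (fold-+ β x̄ m)) (trans (cong (fold β x̄) (+-comm m q)) (fold-+ β x̄ q))))
            where
            along : ∀ m → H (fold β x̄ m) ≡ fold (H β) x̄ m
            along zero = refl
            along (suc m) = trans (H-x̄ _) (trans (x̄-cong _ lk₀) (cong x̄ (along m)))

          remainder : (x ^ q) ⁻¹ ∙ h ≈ ε
          remainder i = trans (onBlocks-∙ ((x ^ q) ⁻¹) h i) (trans
            (cong (onBlocks ((x ^ q) ⁻¹)) (trans (H-power i) (sym (onBlocks-^ x q i))))
            (trans (onBlocks-inverseˡ (x ^ q) i) (sym (onBlocks-ε i))))

        -- Compared with the head of the list, a triple is determined by its `g`: `k` is the same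
        -- throughout and `κ` can be solved for. By `Fibre`, g₀⁻¹ g is a power of `x` times a kernel
        -- element, which leaves p|K| possibilities.
        fibre-size : ∀ y (l : List (El × ℕ × El)) → Unique l → (∀ {w} → w ∈ l → w ∈ triples × f w ≡ y) →
          length l ≤ p * length kernel
        fibre-size y [] _ _ = z≤n
        fibre-size y l@((g₀ , k₀ , κ₀) ∷ _) u h = ≤-trans (length-≤ F u into injective)
          (≤-reflexive (trans (length-×-product (upTo p) kernel) (cong (_* length kernel) (length-upTo p))))
          where
          rest : El → El
          rest g = g₀ ⁻¹ ∙ g
          exp : El → ℕ
          exp g = proj₁ (reach β (onBlocks (rest g) β))
          F : El × ℕ × El → ℕ × El
          F (g , k , κ) = exp g , (x ^ exp g) ⁻¹ ∙ rest g
          same : ∀ {w} → w ∈ l → f w ≡ f (g₀ , k₀ , κ₀)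
          same i = trans (proj₂ (h i)) (sym (proj₂ (h (here refl))))
          into : ∀ {w} → w ∈ l → F w ∈ cartesianProduct (upTo p) kernel
          into {g , k , κ} i = ∈-cartesianProduct⁺ (proj₁ (proj₂ (reach β (onBlocks (rest g) β))))
            (kernel⁺ {(x ^ exp g) ⁻¹ ∙ rest g} (Fibre.remainder (proj₁ (h i)) (proj₁ (h (here refl))) (same i)))
          injective : ∀ {w w′} → w ∈ l → w′ ∈ l → F w ≡ F w′ → w ≡ w′
          injective {g , k , κ} {g′ , k′ , κ′} i j e = cong₂ _,_ g≡ (cong₂ _,_ k≡ κ≡)
            where
            g≡ : g ≡ g′
            g≡ = ∙-cancelˡ (g₀ ⁻¹) g g′ (∙-cancelˡ ((x ^ exp g) ⁻¹) _ _
              (trans (cong proj₂ e) (cong (λ m → (x ^ m) ⁻¹ ∙ rest g′) (sym (cong proj₁ e)))))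
            k≡ : k ≡ k′
            k≡ = trans (Fibre.k≡k₀ (proj₁ (h i)) (proj₁ (h (here refl))) (same i))
              (sym (Fibre.k≡k₀ (proj₁ (h j)) (proj₁ (h (here refl))) (same j)))
            κ≡ : κ ≡ κ′
            κ≡ = ∙-cancelˡ (g ∙ (x ^ k) ∙ g ⁻¹) κ κ′ (trans (trans (same i) (sym (same j)))
              (cong₂ (λ a b → a ∙ (x ^ b) ∙ a ⁻¹ ∙ κ′) (sym g≡) (sym k≡)))

        apart-blocks : ∀ {a b} (a<p : a < p) (b<p : b < p) → a ≢ b → fromℕ< a<p ≢ fromℕ< b<p
        apart-blocks a<p b<p ne e = ne (trans (sym (toℕ-fromℕ< a<p)) (trans (cong toℕ e) (toℕ-fromℕ< b<p)))

        β≢i₁ : β ≢ i₁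
        β≢i₁ = apart-blocks 0<p 1<p λ ()
        β≢i₂ : β ≢ i₂
        β≢i₂ = apart-blocks 0<p 2<p λ ()
        i₁≢i₂ : i₁ ≢ i₂
        i₁≢i₂ = apart-blocks 1<p 2<p λ ()

        -- Double transitivity supplies an element that fixes β but moves `i₁`. It is counted in
        -- `unstable`, yet it is no value of `f`, whose values fix no block.
        g* : El
        g* = proj₁ (move-blocks two β≢i₁ β≢i₂)

        transport : ∀ i → ∃ λ g → onBlocks g i₁ ≡ i
        transport i with i ≟ᶠ β
        ... | yes refl = let (g , e , _) = move-blocks two (β≢i₁ ∘ sym) β≢i₁ in g , e
        ... | no ne = let (g , e , _) = move-blocks two (β≢i₁ ∘ sym) ne in g , e

        module OS = OrbitStabiliser onBlocks onBlocks-∙ onBlocks-ε i₁ transport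

        unstable unstable* : List El
        unstable = filter (¬? ∘ OS.stab?) allEl
        unstable* = filter (λ g → ¬? (g ≟ᶠ g*)) unstable

        f∈ : ∀ {w} → w ∈ triples → f w ∈ unstable*
        f∈ {w} w∈ = ∈-filter⁺ (λ g → ¬? (g ≟ᶠ g*)) (∈-filter⁺ (¬? ∘ OS.stab?) (allEl-complete (f w)) (f-moves w∈ i₁))
          λ e → f-moves w∈ β (trans (cong (λ z → onBlocks z β) e) (proj₁ (proj₂ (move-blocks two β≢i₁ β≢i₂))))

        unstable*< : length unstable* < length unstable
        unstable*< = filter-notAll (λ g → ¬? (g ≟ᶠ g*)) unstable (lose {x = g*}
          (∈-filter⁺ (¬? ∘ OS.stab?) (allEl-complete g*)
            λ e → i₁≢i₂ (trans (sym e) (proj₂ (proj₂ (move-blocks two β≢i₁ β≢i₂)))))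
          (λ ne → ne refl))

      -- By the fibre bound `f` takes at least |G|(p - 1)/p values. That is p - 1 times the
      -- stabiliser of block `i₁`, the size of all of `unstable`, which leaves no room for `g*`.
      no-central : ⊥
      no-central = <⇒≱ unstable*< (begin
        length unstable                ≡⟨ +-cancelˡ-≡ (length OS.stab) _ _ (trans (sym (filter-split OS.stab? allEl))
                                            (trans OS.orbit-stabiliser (cong (_* length OS.stab) (sym (suc-pred p))))) ⟩
        pred p * length OS.stab        ≤⟨ *-cancelˡ-≤ p (*-cancelʳ-≤ _ _ (length kernel) counted) ⟩
        length unstable*               ∎)
        where
        open ≤-Reasoning
        instance
          kernel≢0 : NonZero (length kernel)
          kernel≢0 = >-nonZero (∈-length (kernel⁺ {ε} λ _ → refl))
        arrange : ∀ a b c d → a * (b * c) * d ≡ a * c * (b * d)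
        arrange = solve-∀
        counted : p * (pred p * length OS.stab) * length kernel ≤ p * length unstable* * length kernel
        counted = begin
          p * (pred p * length OS.stab) * length kernel
            ≡⟨ arrange p (pred p) (length OS.stab) (length kernel) ⟩
          p * length OS.stab * (pred p * length kernel)
            ≡⟨ cong (_* (pred p * length kernel)) OS.orbit-stabiliser ⟨
          length allEl * (pred p * length kernel)
            ≡⟨ triples-length ⟨
          length triples
            ≤⟨ fibre-bound _≟ᶠ_ f unstable* triples-unique f∈ (λ y → fibre-size y _
                 (Uniqueₚ.filter⁺ (λ w → f w ≟ᶠ y) triples-unique) (∈-filter⁻ (λ w → f w ≟ᶠ y))) ⟩
          length unstable* * (p * length kernel)
            ≡⟨ trans (sym (*-assoc (length unstable*) p _)) (cong (_* length kernel) (*-comm (length unstable*) p)) ⟩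
          p * length unstable* * length kernel ∎

-- Coordinates on the points and the code of N

module Coordinates {p} (pr : Prime p) (5≤p : 5 ≤ p) (G : PermGroup (3 * p)) (transitive : Transitive G)
  (blk : Fin (3 * p) → Fin p) (size3 : ∀ b → blockSize blk b ≡ 3) (invariant : Invariant G blk)
  (N : PermGroup (3 * p)) (normal : Normal N G) (N⊆K : ∀ {σ} → σ ∈ elems N → InKernel blk σ)
  (abelian : ElemAbelian3 N) where

  open PrimeBlocks pr 5≤p G transitive blk size3 invariant public

  InN : El → Set
  InN g = perm g ∈ elems N

  InN? : Decidable InN
  InN? g = DecMembership._∈?_ _≟ᵖ_ (perm g) (elems N)

  N-ε : InN ε
  N-ε = subst (_∈ elems N) (sym perm-ε) (hasId N)

  N-∙ : ∀ {μ ν} → InN μ → InN ν → InN (μ ∙ ν)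
  N-∙ {μ} {ν} i j = subst (_∈ elems N) (sym (perm-∙ μ ν)) (closed N i j)

  N-comm : ∀ {μ ν} → InN μ → InN ν → μ ∙ ν ≡ ν ∙ μ
  N-comm {μ} {ν} i j = perm-injective _ _
    (trans (perm-∙ μ ν) (trans (proj₁ abelian i j) (sym (perm-∙ ν μ))))

  N-cube : ∀ {ν} → InN ν → ν ∙ (ν ∙ ν) ≡ ε
  N-cube {ν} i = perm-injective _ _ (trans (perm-∙ ν (ν ∙ ν)) (trans (cong (perm ν ∘P_) (perm-∙ ν ν))
    (trans (proj₂ abelian i) (sym perm-ε))))

  N-conj : ∀ g {ν} → InN ν → InN (g ∙ ν ∙ g ⁻¹)
  N-conj g {ν} i =
    let (σ , σ∈ , e) = proj₂ normal (perm∈ g) i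
        σ∈G = All.lookup (proj₁ normal) σ∈
        s = element σ
        sg : s ∙ g ≡ g ∙ ν
        sg = perm-injective _ _ (trans (perm-∙ s g) (trans (cong (_∘P perm g) (perm-element σ∈G))
          (trans (sym e) (sym (perm-∙ g ν)))))
        s≡ : s ≡ g ∙ ν ∙ g ⁻¹
        s≡ = trans (sym (identityʳ s)) (trans (cong (s ∙_) (sym (inverseʳ g)))
          (trans (sym (assoc s g (g ⁻¹))) (cong (_∙ g ⁻¹) sg)))
    in subst InN s≡ (subst (_∈ elems N) (sym (perm-element σ∈G)) σ∈)

  module Frame (x : El) (x≢ε : x ≢ ε) (x^p : x ^ p ≡ ε)
    (n₀ : El) (n₀∈ : InN n₀) (o : Fin (3 * p)) (n₀o≢o : act n₀ o ≢ o) where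

    open Cycle x x≢ε x^p public

    private instance
      p≢0 : NonZero p
      p≢0 = prime⇒nonZero pr

    pow₃ : El → F₃ → El
    pow₃ g 0₃ = ε
    pow₃ g 1₃ = g
    pow₃ g 2₃ = g ∙ g

    pow₃∈ : ∀ {ν} → InN ν → ∀ v → InN (pow₃ ν v)
    pow₃∈ ν∈ 0₃ = N-ε
    pow₃∈ ν∈ 1₃ = ν∈
    pow₃∈ ν∈ 2₃ = N-∙ ν∈ ν∈

    nu : F₃ → El
    nu = pow₃ n₀

    nu∈ : ∀ a → InN (nu a)
    nu∈ = pow₃∈ n₀∈

    nu-+ : ∀ a b → nu (a +₃ b) ≡ nu a ∙ nu b
    nu-+ 0₃ b = sym (identityˡ _)
    nu-+ 1₃ 0₃ = sym (identityʳ _)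
    nu-+ 1₃ 1₃ = refl
    nu-+ 1₃ 2₃ = sym (N-cube n₀∈)
    nu-+ 2₃ 0₃ = sym (identityʳ _)
    nu-+ 2₃ 1₃ = sym (trans (assoc n₀ n₀ n₀) (N-cube n₀∈))
    nu-+ 2₃ 2₃ = sym (trans (assoc n₀ n₀ _) (trans (cong (n₀ ∙_) (N-cube n₀∈)) (identityʳ _)))

    nu-fixes : ∀ a → act (nu a) o ≡ o → a ≡ 0₃
    nu-fixes 0₃ _ = refl
    nu-fixes 1₃ e = contradiction e n₀o≢o
    nu-fixes 2₃ e = contradiction (begin
      act n₀ o                  ≡⟨ cong (act n₀) e ⟨
      act n₀ (act (n₀ ∙ n₀) o)  ≡⟨ act-∙ n₀ (n₀ ∙ n₀) o ⟨
      act (n₀ ∙ (n₀ ∙ n₀)) o    ≡⟨ cong (λ g → act g o) (N-cube n₀∈) ⟩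
      act ε o                   ≡⟨ act-ε o ⟩
      o                         ∎) n₀o≢o
      where open ≡-Reasoning

    nu-injective : ∀ {a b} → act (nu a) o ≡ act (nu b) o → a ≡ b
    nu-injective {a} {b} e = from-difference a b (nu-fixes (a +₃ -₃ b) (act-injective (nu b) (begin
      act (nu b) (act (nu (a +₃ -₃ b)) o)  ≡⟨ act-∙ (nu b) _ o ⟨
      act (nu b ∙ nu (a +₃ -₃ b)) o        ≡⟨ cong (λ g → act g o) (nu-+ b (a +₃ -₃ b)) ⟨
      act (nu (b +₃ (a +₃ -₃ b))) o        ≡⟨ cong (λ c → act (nu c) o) (add-difference a b) ⟩
      act (nu a) o                         ≡⟨ e ⟩
      act (nu b) o                         ∎)))
      where
      open ≡-Reasoning
      from-difference : ∀ a b → a +₃ -₃ b ≡ 0₃ → a ≡ b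
      from-difference = toWitness {a? = all? λ a → all? λ b → (a +₃ -₃ b ≟ᶠ 0₃) →-dec (a ≟ᶠ b)} _
      add-difference : ∀ a b → b +₃ (a +₃ -₃ b) ≡ a
      add-difference = toWitness {a? = all? λ a → all? λ b → b +₃ (a +₃ -₃ b) ≟ᶠ a} _

    base : Fin p
    base = blk o

    blk-nu : ∀ a → blk (act (nu a) o) ≡ base
    blk-nu a = N⊆K (nu∈ a) o

    abstract
      nu-onto : ∀ {ω} → blk ω ≡ base → ∃ λ a → act (nu a) o ≡ ω
      nu-onto e = let (a , _ , q) = injective⇒onto _≟ᶠ_ (λ a → act (nu a) o) (Uniqueₚ.allFin⁺ 3)
                        (λ {a} _ → block⁺ (blk-nu a)) (λ _ _ → nu-injective)
                        (≤-reflexive (size3 base)) (block⁺ e)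
                  in a , q

    opaque
      P : Fin p → F₃ → Fin (3 * p)
      P i a = act (x ^ toℕ i) (act (nu a) o)

      P-def : ∀ i a → P i a ≡ act (x ^ toℕ i) (act (nu a) o)
      P-def i a = refl

      blk-P : ∀ i a → blk (P i a) ≡ fold base x̄ (toℕ i)
      blk-P i a = trans (blk-act (x ^ toℕ i) _) (trans (cong (onBlocks (x ^ toℕ i)) (blk-nu a)) (onBlocks-^ x (toℕ i) base))

      act-x^ : ∀ k i a → act (x ^ k) (P i a) ≡ P [ k + toℕ i ]ₚ a
      act-x^ k i a = trans (sym (act-∙ (x ^ k) (x ^ toℕ i) _)) (cong (λ g → act g (act (nu a) o))
        (trans (sym (^-+ x k (toℕ i))) (x^-cong (sym (toℕ-[]-≋ (k + toℕ i))))))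

      P-index : ∀ {i j a b} → blk (P i a) ≡ blk (P j b) → i ≡ j
      P-index {i} {j} {a} {b} e = toℕ-injective (x̄-injective base (toℕ<n i) (toℕ<n j)
        (trans (sym (blk-P i a)) (trans e (blk-P j b))))

      P-injective : ∀ {i j a b} → P i a ≡ P j b → i ≡ j × a ≡ b
      P-injective {i} {j} {a} {b} e with P-index {i} {j} {a} {b} (cong blk e)
      ... | refl = refl , nu-injective (act-injective (x ^ toℕ i) e)

      P-surjective : ∀ ω → ∃₂ λ i a → P i a ≡ ω
      P-surjective ω =
        let (m , m∈ , e) = reach base (blk ω)
            g = x ^ m
            (a , q) = nu-onto (trans (blk-act (g ⁻¹) ω) (trans (cong (onBlocks (g ⁻¹))
              (trans (sym e) (sym (onBlocks-^ x m base)))) (onBlocks-inverseˡ g base)))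
            m<p = ∈-upTo⁻ m∈
        in fromℕ< m<p , a , trans (cong (λ k → act (x ^ k) (act (nu a) o)) (toℕ-fromℕ< m<p))
             (trans (cong (act g) q) (act-inverseʳ g ω))

    idx : Fin (3 * p) → Fin p
    idx ω = proj₁ (P-surjective ω)

    col : Fin (3 * p) → F₃
    col ω = proj₁ (proj₂ (P-surjective ω))

    P-coord : ∀ ω → P (idx ω) (col ω) ≡ ω
    P-coord ω = proj₂ (proj₂ (P-surjective ω))

    bl : El → Fin p → Fin p
    bl g i = idx (act g (P i 0₃))

    tr : El → Fin p → F₃ → F₃
    tr g i a = col (act g (P i a))

    -- Blocks go to blocks, so the index of the image may be read off at label 0 while the label of
    -- the image still depends on `a`.
    act-P : ∀ g i a → act g (P i a) ≡ P (bl g i) (tr g i a)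
    act-P g i a = trans (sym (P-coord _)) (cong (λ j → P j (tr g i a)) (P-index {a = tr g i a} {b = tr g i 0₃} (begin
      blk (P (idx (act g (P i a))) (tr g i a))  ≡⟨ cong blk (P-coord (act g (P i a))) ⟩
      blk (act g (P i a))                       ≡⟨ blk-act g (P i a) ⟩
      onBlocks g (blk (P i a))                  ≡⟨ cong (onBlocks g) (trans (blk-P i a) (sym (blk-P i 0₃))) ⟩
      onBlocks g (blk (P i 0₃))                 ≡⟨ blk-act g (P i 0₃) ⟨
      blk (act g (P i 0₃))                      ≡⟨ cong blk (P-coord (act g (P i 0₃))) ⟨
      blk (P (bl g i) (tr g i 0₃))              ∎)))
      where open ≡-Reasoning

    P-bl : ∀ {g i a j b} → act g (P i a) ≡ P j b → bl g i ≡ j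
    P-bl {g} {i} {a} e = proj₁ (P-injective (trans (sym (act-P g i a)) e))

    P-tr : ∀ {g i a j b} → act g (P i a) ≡ P j b → tr g i a ≡ b
    P-tr {g} {i} {a} e = proj₂ (P-injective (trans (sym (act-P g i a)) e))

    bl-∙ : ∀ g h i → bl (g ∙ h) i ≡ bl g (bl h i)
    bl-∙ g h i = P-bl {g ∙ h} {i} {0₃} (trans (act-∙ g h _) (trans (cong (act g) (act-P h i 0₃)) (act-P g (bl h i) _)))

    bl-ε : ∀ i → bl ε i ≡ i
    bl-ε i = P-bl {ε} {i} {0₃} (act-ε _)

    bl-onBlocks : ∀ g i → fold base x̄ (toℕ (bl g i)) ≡ onBlocks g (fold base x̄ (toℕ i))
    bl-onBlocks g i = trans (sym (blk-P (bl g i) (tr g i 0₃))) (trans (cong blk (sym (act-P g i 0₃)))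
      (trans (blk-act g _) (cong (onBlocks g) (blk-P i 0₃))))

    bl-unique : ∀ g {i j} → fold base x̄ (toℕ j) ≡ onBlocks g (fold base x̄ (toℕ i)) → bl g i ≡ j
    bl-unique g {i} {j} e = toℕ-injective (x̄-injective base (toℕ<n _) (toℕ<n j) (trans (bl-onBlocks g i) (sym e)))

    bl-x^ : ∀ k i → bl (x ^ k) i ≡ [ k + toℕ i ]ₚ
    bl-x^ k i = P-bl {x ^ k} {i} {0₃} (act-x^ k i 0₃)

    -- g is affine on each block: S₃ = AGL(1, 3).
    sg : El → Fin p → F₃
    sg g i = tr g i 1₃ +₃ -₃ tr g i 0₃

    private
      tr-injective : ∀ g i {a b} → tr g i a ≡ tr g i b → a ≡ b
      tr-injective g i {a} {b} e = proj₂ (P-injective {i} {i} (act-injective g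
        (trans (act-P g i a) (trans (cong (P (bl g i)) e) (sym (act-P g i b))))))

    tr-affine : ∀ g i a → tr g i a ≡ tr g i 0₃ +₃ sg g i *₃ a
    tr-affine g i 0₃ = sym (trans (cong (tr g i 0₃ +₃_) (F₃.zeroʳ (sg g i))) (F₃.+-identityʳ _))
    tr-affine g i 1₃ = alg (tr g i 0₃) (tr g i 1₃)
      where
      alg : ∀ t u → u ≡ t +₃ (u +₃ -₃ t) *₃ 1₃
      alg = toWitness {a? = all? λ t → all? λ u → u ≟ᶠ t +₃ (u +₃ -₃ t) *₃ 1₃} _
    tr-affine g i 2₃ = third (tr g i 0₃) (tr g i 1₃) (tr g i 2₃)
      (λ e → case tr-injective g i e of λ ()) (λ e → case tr-injective g i e of λ ()) (λ e → case tr-injective g i e of λ ())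
      where
      third : ∀ t u v → t ≢ u → t ≢ v → u ≢ v → v ≡ t +₃ (u +₃ -₃ t) *₃ 2₃
      third = toWitness {a? = all? λ t → all? λ u → all? λ v → ¬? (t ≟ᶠ u) →-dec ¬? (t ≟ᶠ v) →-dec ¬? (u ≟ᶠ v) →-dec
        (v ≟ᶠ t +₃ (u +₃ -₃ t) *₃ 2₃)} _

    sg² : ∀ g i → sg g i *₃ sg g i ≡ 1₃
    sg² g i = unit λ e → case tr-injective g i {1₃} {0₃} (from (tr g i 1₃) (tr g i 0₃) e) of λ ()
      where
      from : ∀ a b → a +₃ -₃ b ≡ 0₃ → a ≡ b
      from = toWitness {a? = all? λ a → all? λ b → (a +₃ -₃ b ≟ᶠ 0₃) →-dec (a ≟ᶠ b)} _

    val : El → Word p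
    val ν i = col (act ν (P i 0₃))

    -- Conjugated by the power of `x` that leads to block i, `ν` becomes an element of N preserving
    -- the base block. It commutes with `n₀`, so it translates the labels there.
    act-N : ∀ {ν} → InN ν → ∀ i a → act ν (P i a) ≡ P i (a +₃ val ν i)
    act-N {ν} ν∈ i a = trans (translate a) (cong (λ v → P i (a +₃ v)) (sym (P-tr {ν} {i} {0₃} (translate 0₃))))
      where
      g = x ^ toℕ i
      μ = g ⁻¹ ∙ ν ∙ g ⁻¹ ⁻¹
      μ∈ : InN μ
      μ∈ = N-conj (g ⁻¹) ν∈
      gμ : g ∙ μ ≡ ν ∙ g
      gμ = trans (cong (λ h → g ∙ (g ⁻¹ ∙ ν ∙ h)) (⁻¹-involutive g)) (trans (cong (g ∙_) (assoc (g ⁻¹) ν g))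
        (trans (sym (assoc g (g ⁻¹) (ν ∙ g))) (trans (cong (_∙ (ν ∙ g)) (inverseʳ g)) (identityˡ _))))
      v = proj₁ (nu-onto (N⊆K μ∈ o))
      μo : act (nu v) o ≡ act μ o
      μo = proj₂ (nu-onto (N⊆K μ∈ o))
      translate : ∀ a → act ν (P i a) ≡ P i (a +₃ v)
      translate a = begin
        act ν (P i a)                     ≡⟨ cong (act ν) (P-def i a) ⟩
        act ν (act g (act (nu a) o))      ≡⟨ act-∙ ν g _ ⟨
        act (ν ∙ g) (act (nu a) o)        ≡⟨ cong (λ h → act h (act (nu a) o)) gμ ⟨
        act (g ∙ μ) (act (nu a) o)        ≡⟨ act-∙ g μ _ ⟩
        act g (act μ (act (nu a) o))      ≡⟨ cong (act g) (act-∙ μ (nu a) o) ⟨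
        act g (act (μ ∙ nu a) o)          ≡⟨ cong (λ h → act g (act h o)) (N-comm μ∈ (nu∈ a)) ⟩
        act g (act (nu a ∙ μ) o)          ≡⟨ cong (act g) (act-∙ (nu a) μ o) ⟩
        act g (act (nu a) (act μ o))      ≡⟨ cong (λ z → act g (act (nu a) z)) μo ⟨
        act g (act (nu a) (act (nu v) o)) ≡⟨ cong (act g) (act-∙ (nu a) (nu v) o) ⟨
        act g (act (nu a ∙ nu v) o)       ≡⟨ cong (λ h → act g (act h o)) (nu-+ a v) ⟨
        act g (act (nu (a +₃ v)) o)       ≡⟨ P-def i (a +₃ v) ⟨
        P i (a +₃ v)                      ∎
        where open ≡-Reasoning

    val-∙ : ∀ {μ ν} → InN μ → InN ν → ∀ i → val (μ ∙ ν) i ≡ val ν i +₃ val μ i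
    val-∙ {μ} {ν} μ∈ ν∈ i = P-tr {μ ∙ ν} {i} {0₃} (trans (act-∙ μ ν _) (trans (cong (act μ) (act-N ν∈ i 0₃)) (act-N μ∈ i (val ν i))))

    val-ε : ∀ i → val ε i ≡ 0₃
    val-ε i = P-tr {ε} {i} {0₃} (act-ε _)

    -- Conjugating a translation by an affine map multiplies it by the linear part of that map, here
    -- `sg g i`.
    val-conj : ∀ g {ν} → InN ν → ∀ i → val (g ∙ ν ∙ g ⁻¹) (bl g i) ≡ sg g i *₃ val ν i
    val-conj g {ν} ν∈ i = F₃-cancel {tr g i 0₃} (proj₂ (P-injective (begin
      P (bl g i) (tr g i 0₃ +₃ val c (bl g i))   ≡⟨ act-N (N-conj g ν∈) (bl g i) (tr g i 0₃) ⟨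
      act c (P (bl g i) (tr g i 0₃))             ≡⟨ cong (act c) (act-P g i 0₃) ⟨
      act c (act g (P i 0₃))                     ≡⟨ act-∙ c g _ ⟨
      act (c ∙ g) (P i 0₃)                       ≡⟨ cong (λ h → act h (P i 0₃)) cg ⟩
      act (g ∙ ν) (P i 0₃)                       ≡⟨ act-∙ g ν _ ⟩
      act g (act ν (P i 0₃))                     ≡⟨ cong (act g) (act-N ν∈ i 0₃) ⟩
      act g (P i (val ν i))                      ≡⟨ act-P g i (val ν i) ⟩
      P (bl g i) (tr g i (val ν i))              ≡⟨ cong (P (bl g i)) (tr-affine g i (val ν i)) ⟩
      P (bl g i) (tr g i 0₃ +₃ sg g i *₃ val ν i) ∎)))
      where
      open ≡-Reasoning
      c = g ∙ ν ∙ g ⁻¹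
      cg : c ∙ g ≡ g ∙ ν
      cg = trans (assoc (g ∙ ν) (g ⁻¹) g) (trans (cong (g ∙ ν ∙_) (inverseˡ g)) (identityʳ _))
      F₃-cancel : ∀ {t u v} → t +₃ u ≡ t +₃ v → u ≡ v
      F₃-cancel {t} {u} {v} = toWitness {a? = all? λ t → all? λ u → all? λ v →
        (t +₃ u ≟ᶠ t +₃ v) →-dec (u ≟ᶠ v)} _ t u v

    -- An element normalising ⟨x⟩ is affine with constants independent of the block.
    act-twist : ∀ {s k} → s ∙ x ≡ (x ^ k) ∙ s → bl s [ 0 ]ₚ ≡ [ 0 ]ₚ → ∀ i a →
      act s (P i a) ≡ P [ k * toℕ i ]ₚ (tr s [ 0 ]ₚ a)
    act-twist {s} {k} sx s0 i a = begin
      act s (P i a)                                        ≡⟨ cong (act s) (P-def i a) ⟩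
      act s (act (x ^ toℕ i) (act (nu a) o))               ≡⟨ act-∙ s (x ^ toℕ i) _ ⟨
      act (s ∙ (x ^ toℕ i)) (act (nu a) o)                 ≡⟨ cong (λ g → act g (act (nu a) o)) (^-twist sx (toℕ i)) ⟩
      act ((x ^ (toℕ i * k)) ∙ s) (act (nu a) o)           ≡⟨ act-∙ (x ^ (toℕ i * k)) s _ ⟩
      act (x ^ (toℕ i * k)) (act s (act (nu a) o))         ≡⟨ cong (λ z → act (x ^ (toℕ i * k)) (act s z)) P0 ⟨
      act (x ^ (toℕ i * k)) (act s (P [ 0 ]ₚ a))           ≡⟨ cong (act (x ^ (toℕ i * k))) (act-P s [ 0 ]ₚ a) ⟩
      act (x ^ (toℕ i * k)) (P (bl s [ 0 ]ₚ) (tr s [ 0 ]ₚ a)) ≡⟨ cong (λ j → act (x ^ (toℕ i * k)) (P j (tr s [ 0 ]ₚ a))) s0 ⟩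
      act (x ^ (toℕ i * k)) (P [ 0 ]ₚ (tr s [ 0 ]ₚ a))     ≡⟨ act-x^ (toℕ i * k) [ 0 ]ₚ _ ⟩
      P [ toℕ i * k + toℕ [ 0 ]ₚ ]ₚ (tr s [ 0 ]ₚ a)        ≡⟨ cong (λ j → P j (tr s [ 0 ]ₚ a)) ([]-cong (trans
                                                                 (≋-+ {toℕ i * k} refl (toℕ-[]-≋ 0))
                                                                 (cong (_% p) (trans (+-identityʳ _) (*-comm (toℕ i) k))))) ⟩
      P [ k * toℕ i ]ₚ (tr s [ 0 ]ₚ a)                     ∎
      where
      open ≡-Reasoning
      P0 : P [ 0 ]ₚ a ≡ act (nu a) o
      P0 = trans (P-def [ 0 ]ₚ a) (trans (cong (λ g → act g (act (nu a) o)) (x^-cong (toℕ-[]-≋ 0))) (act-ε _))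

    NL : List El
    NL = filter InN? allEl

    NL-unique : Unique NL
    NL-unique = Uniqueₚ.filter⁺ InN? allEl-unique

    NL⁺ : ∀ {ν} → InN ν → ν ∈ NL
    NL⁺ = ∈-filter⁺ InN? (allEl-complete _)

    NL⁻ : ∀ {ν} → ν ∈ NL → InN ν
    NL⁻ i = proj₂ (∈-filter⁻ InN? {xs = allEl} i)

    val-pow₃ : ∀ {ν} → InN ν → ∀ v i → val (pow₃ ν v) i ≡ v *₃ val ν i
    val-pow₃ ν∈ 0₃ i = val-ε i
    val-pow₃ ν∈ 1₃ i = refl
    val-pow₃ {ν} ν∈ 2₃ i = trans (val-∙ ν∈ ν∈ i) (double (val ν i))
      where
      double : ∀ x → x +₃ x ≡ -₃ x
      double = toWitness {a? = all? λ x → x +₃ x ≟ᶠ -₃ x} _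

    code : Code p
    code = record
      { Has = λ c → ∃ λ ν → InN ν × (∀ i → val ν i ≡ c i)
      ; has-cong = λ { e (ν , ν∈ , v) → ν , ν∈ , λ i → trans (v i) (e i) }
      ; has-+ = λ { (μ , μ∈ , u) (ν , ν∈ , v) → ν ∙ μ , N-∙ ν∈ μ∈ , λ i → trans (val-∙ ν∈ μ∈ i) (cong₂ _+₃_ (u i) (v i)) }
      ; has-* = λ { x (ν , ν∈ , v) → pow₃ ν x , pow₃∈ ν∈ x , λ i → trans (val-pow₃ ν∈ x i) (cong (x *₃_) (v i)) }
      ; words = map val NL
      ; words-⊆ = Allₚ.map⁺ (All.tabulate λ {ν} i → ν , NL⁻ i , λ _ → refl)
      ; complete = λ { (ν , ν∈ , v) → val ν , ∈-map⁺ val (NL⁺ ν∈) , λ i → sym (v i) }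
      }

    open Code code using (Has; has-cong; has-*)

    twice : ∀ s x → s *₃ s ≡ 1₃ → s *₃ (s *₃ x) ≡ x
    twice s x e = trans (sym (F₃.*-assoc s s x)) (cong (_*₃ x) e)

    symmetry-of : El → MonomialSymmetry code
    symmetry-of g = record
      { π = bl g
      ; π⁻¹ = bl (g ⁻¹)
      ; π-π⁻¹ = λ i → trans (sym (bl-∙ g (g ⁻¹) i)) (trans (cong (λ h → bl h i) (inverseʳ g)) (bl-ε i))
      ; π⁻¹-π = λ i → trans (sym (bl-∙ (g ⁻¹) g i)) (trans (cong (λ h → bl h i) (inverseˡ g)) (bl-ε i))
      ; sign = sg g
      ; sign² = sg² g
      ; pull = λ { {c} (ν , ν∈ , v) → let μ = g ⁻¹ ∙ ν ∙ g ⁻¹ ⁻¹ in μ , N-conj (g ⁻¹) ν∈ , λ i → sym (begin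
          sg g i *₃ c (bl g i)                          ≡⟨ cong (sg g i *₃_) (v (bl g i)) ⟨
          sg g i *₃ val ν (bl g i)                      ≡⟨ cong (λ h → sg g i *₃ val h (bl g i)) (undo ν) ⟨
          sg g i *₃ val (g ∙ μ ∙ g ⁻¹) (bl g i)         ≡⟨ cong (sg g i *₃_) (val-conj g (N-conj (g ⁻¹) ν∈) i) ⟩
          sg g i *₃ (sg g i *₃ val μ i)                 ≡⟨ twice (sg g i) (val μ i) (sg² g i) ⟩
          val μ i                                       ∎) }
      ; push = λ { {c} (ν , ν∈ , v) → g ∙ ν ∙ g ⁻¹ , N-conj g ν∈ , λ i → let j = bl (g ⁻¹) i in begin
          val (g ∙ ν ∙ g ⁻¹) i            ≡⟨ cong (val (g ∙ ν ∙ g ⁻¹)) (trans (sym (bl-∙ g (g ⁻¹) i)) (trans (cong (λ h → bl h i) (inverseʳ g)) (bl-ε i))) ⟨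
          val (g ∙ ν ∙ g ⁻¹) (bl g j)     ≡⟨ val-conj g ν∈ j ⟩
          sg g j *₃ val ν j               ≡⟨ cong (sg g j *₃_) (v j) ⟩
          sg g j *₃ c j                   ∎ }
      }
      where
      open ≡-Reasoning
      undo : ∀ ν → g ∙ (g ⁻¹ ∙ ν ∙ g ⁻¹ ⁻¹) ∙ g ⁻¹ ≡ ν
      undo ν = begin
        g ∙ (g ⁻¹ ∙ ν ∙ g ⁻¹ ⁻¹) ∙ g ⁻¹     ≡⟨ cong (λ h → g ∙ (g ⁻¹ ∙ ν ∙ h) ∙ g ⁻¹) (⁻¹-involutive g) ⟩
        g ∙ (g ⁻¹ ∙ ν ∙ g) ∙ g ⁻¹           ≡⟨ cong (_∙ g ⁻¹) (trans (cong (g ∙_) (assoc (g ⁻¹) ν g)) (sym (assoc g (g ⁻¹) (ν ∙ g)))) ⟩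
        g ∙ g ⁻¹ ∙ (ν ∙ g) ∙ g ⁻¹           ≡⟨ cong (λ h → h ∙ (ν ∙ g) ∙ g ⁻¹) (inverseʳ g) ⟩
        ε ∙ (ν ∙ g) ∙ g ⁻¹                  ≡⟨ cong (_∙ g ⁻¹) (identityˡ (ν ∙ g)) ⟩
        ν ∙ g ∙ g ⁻¹                        ≡⟨ trans (assoc ν g (g ⁻¹)) (cong (ν ∙_) (inverseʳ g)) ⟩
        ν ∙ ε                               ≡⟨ identityʳ ν ⟩
        ν                                   ∎

    doublyTransitive : TwoTransitiveOnBlocks G blk → DoublyTransitive code
    doublyTransitive two = record { symmetry = λ i≢j k≢l →
      let (g , gi , gj) = move-blocks two (i≢j ∘ distinct) (k≢l ∘ distinct)
      in symmetry-of g , bl-unique g (sym gi) , bl-unique g (sym gj) }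
      where
      distinct : ∀ {i j : Fin p} → fold base x̄ (toℕ i) ≡ fold base x̄ (toℕ j) → i ≡ j
      distinct {i} {j} e = toℕ-injective (x̄-injective base (toℕ<n i) (toℕ<n j) e)

    val≢0 : val n₀ (idx o) ≢ 0₃
    val≢0 e = n₀o≢o (begin
      act n₀ o                                    ≡⟨ cong (act n₀) (P-coord o) ⟨
      act n₀ (P (idx o) (col o))                  ≡⟨ act-N n₀∈ (idx o) (col o) ⟩
      P (idx o) (col o +₃ val n₀ (idx o))         ≡⟨ cong (P (idx o)) (trans (cong (col o +₃_) e) (F₃.+-identityʳ _)) ⟩
      P (idx o) (col o)                           ≡⟨ P-coord o ⟩
      o                                           ∎)
      where open ≡-Reasoning

    -- The relation makes `s` act on block indices by an affine map of slope k, and fixing block 0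
    -- removes the constant term.
    Normaliser : ℕ → El → Set
    Normaliser k s = s ∙ x ≡ (x ^ k) ∙ s × bl s [ 0 ]ₚ ≡ [ 0 ]ₚ

    abstract
      -- A power of `x` first brings the base block back to its place, which does not change the
      -- multiplier; `lift` then makes the relation exact without altering the action on blocks.
      normalise : ∀ {h k} → Multiplier x h k → ∃ (Normaliser k)
      normalise {h} {k} mult =
        let (m , _ , e) = reach (onBlocks h base) base
            y = (x ^ m) ∙ h
            commute : (x ^ m) ∙ (x ^ k) ≡ (x ^ k) ∙ (x ^ m)
            commute = trans (sym (^-+ x m k)) (trans (cong (x ^_) (+-comm m k)) (^-+ x k m))
            multʸ : Multiplier x y k
            multʸ = ≈-trans (≡⇒≈ (assoc (x ^ m) h x)) (≈-trans (∙-≈ {x ^ m} ≈-refl mult)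
              (≡⇒≈ (trans (sym (assoc (x ^ m) (x ^ k) h)) (trans (cong (_∙ h) commute) (assoc (x ^ k) (x ^ m) h)))))
            (s , s≈y , sx) = lift {y} {k} multʸ
            zeroth : fold base x̄ (toℕ [ 0 ]ₚ) ≡ base
            zeroth = x̄-cong base (toℕ-[]-≋ 0)
        in s , sx , bl-unique s (trans zeroth (sym (trans (cong (onBlocks s) zeroth)
             (trans (s≈y base) (trans (onBlocks-∙ (x ^ m) h base) (trans (onBlocks-^ x m _) e))))))

    module Reversal {s : El} (normaliser : Normaliser (pred p) s) where

      private
        sx = proj₁ normaliser
        s0 = proj₂ normaliser

        σ : F₃
        σ = sg s [ 0 ]ₚ

        g : Fin p → El
        g t = (x ^ toℕ t) ∙ s

        act-g : ∀ t i a → act (g t) (P i a) ≡ P (t ⊕ (⊖ i)) (tr s [ 0 ]ₚ a)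
        act-g t i a = trans (act-∙ (x ^ toℕ t) s _)
          (trans (cong (act (x ^ toℕ t)) (act-twist {s} {pred p} sx s0 i a)) (act-x^ (toℕ t) (⊖ i) _))

        bl-g : ∀ t i → bl (g t) i ≡ t ⊕ (⊖ i)
        bl-g t i = P-bl {g t} {i} {0₃} (act-g t i 0₃)

        sg-g : ∀ t i → sg (g t) i ≡ σ
        sg-g t i = cong₂ (λ a b → a +₃ -₃ b) (P-tr {g t} {i} {1₃} (act-g t i 1₃)) (P-tr {g t} {i} {0₃} (act-g t i 0₃))

      -- `g t` acts on indices by i ↦ t - i with the same sign `σ` on every block, so one further
      -- factor `σ` removes the sign from the pulled back word.
      reflect : ∀ {c} t → Has c → Has (λ i → c (t ⊕ (⊖ i)))
      reflect {c} t h = has-cong {λ i → σ *₃ (sg (g t) i *₃ c (bl (g t) i))}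
        (λ i → trans (cong₂ (λ u j → σ *₃ (u *₃ c j)) (sg-g t i) (bl-g t i)) (twice σ (c (t ⊕ (⊖ i))) (sg² s [ 0 ]ₚ)))
        (has-* {λ i → sg (g t) i *₃ c (bl (g t) i)} σ (MonomialSymmetry.pull (symmetry-of (g t)) {c} h))

    -- A full word belongs to an element of N that translates every block nontrivially, a
    -- derangement in the kernel.
    no-reversal : TwoTransitiveOnBlocks G blk →
      (∀ {σ} → σ ∈ elems G → InKernel blk σ → ∃ λ ω → app σ ω ≡ ω) →
      ∀ {s} → ¬ Normaliser (pred p) s
    no-reversal two fixed {s} rev = contradict full
      where
      2<p : 2 < p
      2<p = <-≤-trans (s≤s (s≤s (s≤s z≤n))) 5≤p
      3<p : 3 < p
      3<p = <-≤-trans (s≤s (s≤s (s≤s (s≤s z≤n)))) 5≤p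
      nondegenerate : ∀ {c} → Has c → CodeTheory._⊥C code c → ∀ t → c t ≡ 0₃
      nondegenerate = CodeTheory.isotropic⇒zero code ⊕-isAbelianGroup (⊕-cubes 3<p) (Reversal.reflect rev)
      full : ∃ λ c → Has c × (∀ i → c i ≢ 0₃)
      full = full-word′ code (odd 2<p) nondegenerate (doublyTransitive two) {val n₀} (n₀ , n₀∈ , λ _ → refl) {idx o} val≢0
      translation-free : ∀ a v → a +₃ v ≡ a → v ≡ 0₃
      translation-free = toWitness {a? = all? λ a → all? λ v → (a +₃ v ≟ᶠ a) →-dec (v ≟ᶠ 0₃)} _
      contradict : (∃ λ c → Has c × (∀ i → c i ≢ 0₃)) → ⊥
      contradict (c , (ν , ν∈ , v) , c≢0) = c≢0 (idx ω) (trans (sym (v (idx ω))) (translation-free (col ω) _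
          (proj₂ (P-injective {idx ω} {idx ω} (begin
            P (idx ω) (col ω +₃ val ν (idx ω))  ≡⟨ act-N ν∈ (idx ω) (col ω) ⟨
            act ν (P (idx ω) (col ω))           ≡⟨ cong (act ν) (P-coord ω) ⟩
            act ν ω                             ≡⟨ proj₂ (fixed (perm∈ ν) (N⊆K ν∈)) ⟩
            ω                                   ≡⟨ P-coord ω ⟨
            P (idx ω) (col ω)                   ∎)))))
        where
        open ≡-Reasoning
        ω = proj₁ (fixed (perm∈ ν) (N⊆K ν∈))

    -- Counting intersecting families

    -- Used for t² and its multiplier, so `k` here is already a square. The last two hypotheses make
    -- the slopes 1, k, k² of the three powers of `s` distinct.
    module Count (s : El) (k : ℕ) (τ : F₃) (act-s : ∀ i a → act s (P i a) ≡ P [ k * toℕ i ]ₚ (a +₃ τ))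
      (k≢1 : ¬ k ≋ 1) (k²≢1 : ¬ k * k ≋ 1) where

      private
        kp : F₃ → ℕ
        kp 0₃ = 1
        kp 1₃ = k
        kp 2₃ = k * k

        1<p : 1 < p
        1<p = <-≤-trans (s≤s (s≤s z≤n)) 5≤p

        0<p : 0 < p
        0<p = <-trans z<s 1<p

        -- With slope 0 the permutation `s` would send points of blocks 0 and 1 to the same point.
        k≢0 : ¬ k ≋ 0
        k≢0 e = case ≋⇒≡ {0} {1} 0<p 1<p ([]-injective {0} {1} 0≡1) of λ ()
          where
          open ≡-Reasoning
          collapse : ∀ i → act s (P i 0₃) ≡ P [ 0 ]ₚ (0₃ +₃ τ)
          collapse i = trans (act-s i 0₃) (cong (λ j → P j (0₃ +₃ τ)) ([]-cong {k * toℕ i} {0} (≋-* {k} {0} {toℕ i} {toℕ i} e refl)))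
          0≡1 : [ 0 ]ₚ ≡ [ 1 ]ₚ
          0≡1 = proj₁ (P-injective {[ 0 ]ₚ} {[ 1 ]ₚ} {0₃} {0₃} (act-injective s (trans (collapse [ 0 ]ₚ) (sym (collapse [ 1 ]ₚ)))))

        k≢k² : ¬ k ≋ k * k
        k≢k² e = k≢1 (sym (≋-*-cancelʳ {1} {k} (k % p) 0<k% (m%n<n k p) (begin
          (1 * (k % p)) % p    ≡⟨ cong (_% p) (*-identityˡ (k % p)) ⟩
          k % p % p            ≡⟨ m%n%n≡m%n k p ⟩
          k % p                ≡⟨ e ⟩
          (k * k) % p          ≡⟨ ≋-* {k} {k} {k} {k % p} refl (sym (m%n%n≡m%n k p)) ⟩
          (k * (k % p)) % p    ∎)))
          where
          open ≡-Reasoning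
          0<k% : 0 < k % p
          0<k% = n≢0⇒n>0 λ q → k≢0 (trans q (sym (m<n⇒m%n≡m 0<p)))

        kp-distinct : ∀ {j j′} → j ≢ j′ → ¬ kp j ≋ kp j′
        kp-distinct {0₃} {0₃} ne _ = ne refl
        kp-distinct {0₃} {1₃} _ e = k≢1 (sym e)
        kp-distinct {0₃} {2₃} _ e = k²≢1 (sym e)
        kp-distinct {1₃} {0₃} _ e = k≢1 e
        kp-distinct {1₃} {1₃} ne _ = ne refl
        kp-distinct {1₃} {2₃} _ e = k≢k² e
        kp-distinct {2₃} {0₃} _ e = k²≢1 e
        kp-distinct {2₃} {1₃} _ e = k≢k² (sym e)
        kp-distinct {2₃} {2₃} ne _ = ne refl

        act-sʲ : ∀ j i a → act (pow₃ s j) (P i a) ≡ P [ kp j * toℕ i ]ₚ (a +₃ j *₃ τ)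
        act-sʲ 0₃ i a = trans (act-ε _) (cong₂ P (sym (trans (cong [_]ₚ (*-identityˡ (toℕ i))) ([]-toℕ i))) (sym (F₃.+-identityʳ a)))
        act-sʲ 1₃ i a = act-s i a
        act-sʲ 2₃ i a = trans (act-∙ s s _) (trans (cong (act s) (act-s i a)) (trans (act-s _ _) (cong₂ P
          ([]-cong (trans (≋-* {k} refl (toℕ-[]-≋ (k * toℕ i))) (cong (_% p) (sym (*-assoc k k (toℕ i))))))
          (toWitness {a? = all? λ a → all? λ t → (a +₃ t) +₃ t ≟ᶠ a +₃ -₃ t} _ a τ))))

        -- The family is counted by its parameters, which gives 3p|N| members without comparing the
        -- elements they name.
        Index : Set
        Index = El × Fin p × F₃

        power : Index → F₃
        power (_ , _ , j) = j

        elt : Index → El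
        elt (ν , i , j) = ν ∙ ((x ^ toℕ i) ∙ pow₃ s j)

        target : Index → Fin p → Fin p
        target (ν , i , j) e = [ toℕ i + kp j * toℕ e ]ₚ

        act-elt : ∀ {ν} i j → InN ν → ∀ e a → let e* = target (ν , i , j) e in
          act (elt (ν , i , j)) (P e a) ≡ P e* ((a +₃ j *₃ τ) +₃ val ν e*)
        act-elt {ν} i j ν∈ e a = begin
          act (ν ∙ ((x ^ toℕ i) ∙ pow₃ s j)) (P e a)            ≡⟨ act-∙ ν _ _ ⟩
          act ν (act ((x ^ toℕ i) ∙ pow₃ s j) (P e a))          ≡⟨ cong (act ν) (act-∙ (x ^ toℕ i) (pow₃ s j) _) ⟩
          act ν (act (x ^ toℕ i) (act (pow₃ s j) (P e a)))      ≡⟨ cong (act ν ∘ act (x ^ toℕ i)) (act-sʲ j e a) ⟩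
          act ν (act (x ^ toℕ i) (P [ kp j * toℕ e ]ₚ b))         ≡⟨ cong (act ν) (act-x^ (toℕ i) _ b) ⟩
          act ν (P [ toℕ i + toℕ [ kp j * toℕ e ]ₚ ]ₚ b)          ≡⟨ cong (λ z → act ν (P z b)) ([]-cong (≋-+ {toℕ i} refl (toℕ-[]-≋ (kp j * toℕ e)))) ⟩
          act ν (P [ toℕ i + kp j * toℕ e ]ₚ b)                   ≡⟨ act-N ν∈ _ b ⟩
          P [ toℕ i + kp j * toℕ e ]ₚ (b +₃ val ν [ toℕ i + kp j * toℕ e ]ₚ) ∎
          where
          open ≡-Reasoning
          b = a +₃ j *₃ τ

        X : List Index
        X = cartesianProduct NL (cartesianProduct (allFin p) (allFin 3))

        X⁻ : ∀ {w} → w ∈ X → InN (proj₁ w)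
        X⁻ i = NL⁻ (proj₁ (∈-cartesianProduct⁻ NL (cartesianProduct (allFin p) (allFin 3)) i))

        X-unique : Unique X
        X-unique = Uniqueₚ.cartesianProduct⁺ NL-unique (Uniqueₚ.cartesianProduct⁺ (Uniqueₚ.allFin⁺ p) (Uniqueₚ.allFin⁺ 3))

        X-length : length X ≡ length NL * (p * 3)
        X-length = trans (length-×-product NL _) (cong (length NL *_) (trans (length-×-product (allFin p) (allFin 3))
          (cong (_* 3) (length-tabulate {n = p} id))))

        Meet : Index → Index → Set
        Meet w w′ = ∃ λ ω → act (elt w) ω ≡ act (elt w′) ω

        abstract
          -- Members of the family act on labels by translations, so the label of the common point
          -- cancels: agreeing at one point means agreeing on its whole block.
          meet : ∀ {w w′} → w ∈ X → w′ ∈ X → Meet w w′ → ∃ λ e → target w e ≡ target w′ e ×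
            power w *₃ τ +₃ val (proj₁ w) (target w e) ≡ power w′ *₃ τ +₃ val (proj₁ w′) (target w e)
          meet {ν , i , j} {ν′ , i′ , j′} w∈ w′∈ (ω , q) =
            let e = idx ω ; a = col ω
                (t , v) = P-injective (trans (sym (act-elt i j (X⁻ w∈) e a))
                  (trans (cong (act (elt (ν , i , j))) (P-coord ω)) (trans q
                  (trans (cong (act (elt (ν′ , i′ , j′))) (sym (P-coord ω))) (act-elt i′ j′ (X⁻ w′∈) e a)))))
            in e , t , cancel a _ _ _ _ (trans v (cong (λ z → (a +₃ j′ *₃ τ) +₃ val ν′ z) (sym t)))
            where
            cancel : ∀ a b c d e → (a +₃ b) +₃ c ≡ (a +₃ d) +₃ e → b +₃ c ≡ d +₃ e
            cancel = toWitness {a? = all? λ a → all? λ b → all? λ c → all? λ d → all? λ e →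
              ((a +₃ b) +₃ c ≟ᶠ (a +₃ d) +₃ e) →-dec (b +₃ c ≟ᶠ d +₃ e)} _

        -- Equal powers have equal slopes, so a single common block forces equal constant terms.
        same-shift : ∀ {ν ν′ i i′ j} → (ν , i , j) ∈ X → (ν′ , i′ , j) ∈ X → Meet (ν , i , j) (ν′ , i′ , j) → i ≡ i′
        same-shift {i = i} {i′} {j} w∈ w′∈ m = toℕ-injective (≋⇒≡ (toℕ<n i) (toℕ<n i′)
            (≋-+-cancelˡ c {toℕ i} {toℕ i′} (begin
              (c + toℕ i) % p    ≡⟨ cong (_% p) (+-comm c (toℕ i)) ⟩
              (toℕ i + c) % p    ≡⟨ []-injective {toℕ i + c} {toℕ i′ + c} (proj₁ (proj₂ (meet w∈ w′∈ m))) ⟩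
              (toℕ i′ + c) % p   ≡⟨ cong (_% p) (+-comm (toℕ i′) c) ⟩
              (c + toℕ i′) % p   ∎)))
          where
          open ≡-Reasoning
          c : ℕ
          c = kp j * toℕ (proj₁ (meet w∈ w′∈ m))

        shift-to : ∀ (i j : Fin p) → [ (toℕ j + pred p * toℕ i) + toℕ i ]ₚ ≡ j
        shift-to i j = trans ([]-cong {(toℕ j + pred p * toℕ i) + toℕ i} {toℕ j} (trans
            (cong (_% p) (+-assoc (toℕ j) (pred p * toℕ i) (toℕ i)))
            (trans (≋-+ {toℕ j} {toℕ j} {pred p * toℕ i + toℕ i} {0} refl (neg-+ (toℕ i)))
              (cong (_% p) (+-identityʳ (toℕ j)))))) ([]-toℕ j)

        abstract
          transport : ∀ i j → ∃ λ g → bl g i ≡ j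
          transport i j = x ^ (toℕ j + pred p * toℕ i) , trans (bl-x^ (toℕ j + pred p * toℕ i) i) (shift-to i j)

        -- No coordinate vanishes on the whole code: `n₀` is nonzero at the block of `o`, and powers
        -- of `x` carry that block to every other.
        detect : ∀ e → ∃ λ μ → InN μ × val μ e ≢ 0₃
        detect e = along (transport (idx o) e)
          where
          along : (∃ λ g → bl g (idx o) ≡ e) → ∃ λ μ → InN μ × val μ e ≢ 0₃
          along (g , refl) = g ∙ n₀ ∙ g ⁻¹ , N-conj g n₀∈ , λ q →
            val≢0 (unit-cancel {sg g (idx o)} {val n₀ (idx o)} (sg² g (idx o)) (trans (sym (val-conj g n₀∈ (idx o))) q))
            where
            unit-cancel : ∀ {s y} → s *₃ s ≡ 1₃ → s *₃ y ≡ 0₃ → y ≡ 0₃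
            unit-cancel {s} {y} u q = trans (sym (twice s y u)) (trans (cong (s *₃_) q) (F₃.zeroʳ s))

        -- Translating by the powers of some μ with val μ e ≢ 0 triples a set on which val ν e is constant.
        constant-value : ∀ e d c i₀ j₀ (ws : List Index) → Unique ws →
          (∀ {ν i j} → (ν , i , j) ∈ ws → InN ν × i ≡ i₀ × j ≡ j₀ × d +₃ val ν e ≡ c) → length ws * 3 ≤ length NL
        constant-value e d c i₀ j₀ ws u h = shifted (detect e)
          where
          separate : ∀ d c a b v w m → m ≢ 0₃ → d +₃ a ≡ c → d +₃ b ≡ c → v *₃ m +₃ a ≡ w *₃ m +₃ b → v ≡ w
          separate d c a b v w m m≢0 ea eb eq =
            *-cancel v w m m≢0 (+-cancel (v *₃ m) (w *₃ m) a (trans eq (cong (w *₃ m +₃_) (sym (+-cancelˡ d a b (trans ea (sym eb)))))))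
            where
            +-cancel : ∀ x y a → x +₃ a ≡ y +₃ a → x ≡ y
            +-cancel = toWitness {a? = all? λ x → all? λ y → all? λ a → (x +₃ a ≟ᶠ y +₃ a) →-dec (x ≟ᶠ y)} _
            +-cancelˡ : ∀ d a b → d +₃ a ≡ d +₃ b → a ≡ b
            +-cancelˡ = toWitness {a? = all? λ d → all? λ a → all? λ b → (d +₃ a ≟ᶠ d +₃ b) →-dec (a ≟ᶠ b)} _
            *-cancel : ∀ v w m → m ≢ 0₃ → v *₃ m ≡ w *₃ m → v ≡ w
            *-cancel = toWitness {a? = all? λ v → all? λ w → all? λ m → ¬? (m ≟ᶠ 0₃) →-dec (v *₃ m ≟ᶠ w *₃ m) →-dec (v ≟ᶠ w)} _
          shifted : (∃ λ μ → InN μ × val μ e ≢ 0₃) → length ws * 3 ≤ length NL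
          shifted (μ , μ∈ , μ≢0) = ≤-trans (≤-reflexive (sym (length-×-product ws (allFin 3))))
              (length-≤ Φ (Uniqueₚ.cartesianProduct⁺ u (Uniqueₚ.allFin⁺ 3)) into injective)
            where
            member : ∀ {w v} → (w , v) ∈ cartesianProduct ws (allFin 3) → w ∈ ws
            member i = proj₁ (∈-cartesianProduct⁻ ws (allFin 3) i)
            Φ : Index × F₃ → El
            Φ (w , v) = proj₁ w ∙ pow₃ μ v
            into : ∀ {wv} → wv ∈ cartesianProduct ws (allFin 3) → Φ wv ∈ NL
            into {w , v} i = NL⁺ (N-∙ (proj₁ (h (member i))) (pow₃∈ μ∈ v))
            at : ∀ {ν} v → InN ν → val (ν ∙ pow₃ μ v) e ≡ v *₃ val μ e +₃ val ν e
            at {ν} v ν∈ = trans (val-∙ ν∈ (pow₃∈ μ∈ v) e) (cong (_+₃ val ν e) (val-pow₃ μ∈ v e))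
            injective : ∀ {wv wv′} → wv ∈ cartesianProduct ws (allFin 3) → wv′ ∈ cartesianProduct ws (allFin 3) →
              Φ wv ≡ Φ wv′ → wv ≡ wv′
            injective {(ν₁ , i₁ , j₁) , v₁} {(ν₂ , i₂ , j₂) , v₂} m₁ m₂ eq =
              combine (h (member m₁)) (h (member m₂))
              where
              combine : InN ν₁ × i₁ ≡ i₀ × j₁ ≡ j₀ × d +₃ val ν₁ e ≡ c → InN ν₂ × i₂ ≡ i₀ × j₂ ≡ j₀ × d +₃ val ν₂ e ≡ c →
                ((ν₁ , i₁ , j₁) , v₁) ≡ ((ν₂ , i₂ , j₂) , v₂)
              combine (ν₁∈ , p₁ , q₁ , e₁) (ν₂∈ , p₂ , q₂ , e₂) = cong₂ _,_
                  (cong₂ _,_ ν≡ (cong₂ _,_ (trans p₁ (sym p₂)) (trans q₁ (sym q₂)))) v≡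
                where
                v≡ : v₁ ≡ v₂
                v≡ = separate d c (val ν₁ e) (val ν₂ e) v₁ v₂ (val μ e) μ≢0 e₁ e₂
                  (trans (sym (at v₁ ν₁∈)) (trans (cong (λ g → val g e) eq) (at v₂ ν₂∈)))
                ν≡ : ν₁ ≡ ν₂
                ν≡ = ∙-cancelʳ (pow₃ μ v₁) ν₁ ν₂ (trans eq (cong (λ v → ν₂ ∙ pow₃ μ v) (sym v≡)))

        module Family (l : List Index) (l-unique : Unique l) (l⊆X : ∀ {w} → w ∈ l → w ∈ X)
          (meets : ∀ {w w′} → w ∈ l → w′ ∈ l → Meet w w′) where

          -- The shift i is common to all members by `same-shift`, so only ν distinguishes them.
          one-power : (∀ {w w′} → w ∈ l → w′ ∈ l → power w ≡ power w′) → length l ≤ length NL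
          one-power same = length-≤ proj₁ l-unique
            (λ w∈ → NL⁺ (X⁻ (l⊆X w∈))) injective
            where
            injective : ∀ {w w′} → w ∈ l → w′ ∈ l → proj₁ w ≡ proj₁ w′ → w ≡ w′
            injective {ν , i , j} {ν′ , i′ , j′} w∈ w′∈ refl with same w∈ w′∈
            ... | refl = cong (λ z → ν , z , j) (same-shift (l⊆X w∈) (l⊆X w′∈) (meets w∈ w′∈))

          part : F₃ → List Index
          part j = filter (λ w → power w ≟ᶠ j) l

          part⁻ : ∀ {j w} → w ∈ part j → w ∈ l × power w ≡ j
          part⁻ {j} = ∈-filter⁻ (λ w → power w ≟ᶠ j) {xs = l}

          -- Members with power j share their shift, so by `affine-agree` all of them meet `w′` on
          -- the same block. The value of ν at its image `e*` is thereby prescribed, and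
          -- `constant-value` applies.
          two-powers : ∀ {w′ j} → w′ ∈ l → power w′ ≢ j → length (part j) * 3 ≤ length NL
          two-powers {w′@(ν′ , i′ , j′)} {j} w′∈ j′≢j = bound (part j) (Uniqueₚ.filter⁺ (λ w → power w ≟ᶠ j) l-unique) part⁻
            where
            bound : ∀ ws → Unique ws → (∀ {w} → w ∈ ws → w ∈ l × power w ≡ j) → length ws * 3 ≤ length NL
            bound [] _ _ = z≤n
            bound ws@((ν₀ , i₀ , j₀) ∷ _) u into =
                constant-value e* (j *₃ τ) (j′ *₃ τ +₃ val ν′ e*) i₀ j ws u λ w∈ → value (into w∈)
              where
              w₀∈ : (ν₀ , i₀ , j) ∈ l
              w₀∈ = subst (λ z → (ν₀ , i₀ , z) ∈ l) (proj₂ (into (here refl))) (proj₁ (into (here refl)))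
              meeting = meet (l⊆X w₀∈) (l⊆X w′∈) (meets w₀∈ w′∈)
              e₀ : Fin p
              e₀ = proj₁ meeting
              e* : Fin p
              e* = target w′ e₀
              value : ∀ {ν i k} → (ν , i , k) ∈ l × k ≡ j →
                InN ν × i ≡ i₀ × k ≡ j × j *₃ τ +₃ val ν e* ≡ j′ *₃ τ +₃ val ν′ e*
              value {ν} {i} (w∈ , refl) with same-shift (l⊆X w∈) (l⊆X w₀∈) (meets w∈ w₀∈)
              ... | refl = X⁻ (l⊆X w∈) , refl , refl , at (meet (l⊆X w∈) (l⊆X w′∈) (meets w∈ w′∈))
                where
                at : (∃ λ e → target (ν , i , j) e ≡ target w′ e ×
                       j *₃ τ +₃ val ν (target (ν , i , j) e) ≡ j′ *₃ τ +₃ val ν′ (target (ν , i , j) e)) →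
                  j *₃ τ +₃ val ν e* ≡ j′ *₃ τ +₃ val ν′ e*
                at (e , t , q) = subst (λ z → j *₃ τ +₃ val ν z ≡ j′ *₃ τ +₃ val ν′ z) (trans t (cong (target w′) e≡)) q
                  where
                  e≡ : e ≡ e₀
                  e≡ = toℕ-injective (affine-agree {kp j} {kp j′} {toℕ i} {toℕ i′} {toℕ e} {toℕ e₀} (toℕ<n e) (toℕ<n e₀)
                    (kp-distinct (j′≢j ∘ sym))
                    ([]-injective {toℕ i + kp j * toℕ e} {toℕ i′ + kp j′ * toℕ e} t)
                    ([]-injective {toℕ i + kp j * toℕ e₀} {toℕ i′ + kp j′ * toℕ e₀} (proj₁ (proj₂ meeting))))

          family-size : length l ≤ length NL
          family-size with Any.any? (λ w → Any.any? (λ w′ → ¬? (power w ≟ᶠ power w′)) l) l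
          ... | no ¬a = one-power λ {w} {w′} w∈ w′∈ → decidable-stable (power w ≟ᶠ power w′)
                λ ne → ¬a (lose w∈ (lose w′∈ ne))
          ... | yes a with find a
          ... | w , w∈ , a′ with find a′
          ... | w′ , w′∈ , ne = ≤-trans (fibre-bound _≟ᶠ_ power (allFin 3) l-unique (λ _ → ∈-allFin _) third)
                (≤-trans (≤-reflexive (*-comm 3 (length NL / 3))) (m/n*n≤m (length NL) 3))
            where
            third : ∀ j → length (part j) ≤ length NL / 3
            -- Since `w` and `w′` have different powers, one of them differs from j and bounds this
            -- part.
            third j = ≤-trans (≤-reflexive (sym (m*n/n≡m (length (part j)) 3))) (/-monoˡ-≤ 3 (case power w ≟ᶠ j of λ
              { (yes refl) → two-powers w′∈ (ne ∘ sym)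
              ; (no ne′) → two-powers w∈ ne′ }))

      -- Pairs from F and `X` are counted by σ w⁻¹. The fibre over y is the part of F in the
      -- translate y X: cancelling y shows that its indices still meet pairwise, and an index
      -- determines its σ.
      intersecting-size : ∀ F → Unique F → (∀ {σ} → σ ∈ F → σ ∈ elems G) → AgreeAll G F →
        ∀ ω → length F ≤ stabSize G ω
      intersecting-size F uF F⊆G agree ω = *-cancelʳ-≤ _ _ (length NL * (p * 3)) (begin
        length F * (length NL * (p * 3))                   ≡⟨ cong (length F *_) X-length ⟨
        length F * length X                                ≡⟨ length-×-product F X ⟨
        length (cartesianProduct F X)                      ≤⟨ fibre-bound _≟ᶠ_ quotient allEl pairs-unique (λ _ → allEl-complete _) fibre ⟩
        length allEl * length NL                           ≡⟨ cong (_* length NL) (order-count ω) ⟩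
        3 * p * stabSize G ω * length NL                   ≡⟨ arrange p (stabSize G ω) (length NL) ⟩
        stabSize G ω * (length NL * (p * 3))               ∎)
        where
        open ≤-Reasoning
        instance
          NL≢0 : NonZero (length NL * (p * 3))
          NL≢0 = m*n≢0 (length NL) (p * 3) {{>-nonZero (∈-length (NL⁺ N-ε))}} {{m*n≢0 p 3}}
        arrange : ∀ p s n → 3 * p * s * n ≡ s * (n * (p * 3))
        arrange = solve-∀
        pairs-unique : Unique (cartesianProduct F X)
        pairs-unique = Uniqueₚ.cartesianProduct⁺ uF X-unique
        quotient : Perm (3 * p) × Index → El
        quotient (σ , w) = element σ ∙ elt w ⁻¹
        fibre : ∀ y → length (filter (λ σw → quotient σw ≟ᶠ y) (cartesianProduct F X)) ≤ length NL
        fibre y = ≤-trans (≤-reflexive (sym (length-map proj₂ L))) (Family.family-size (map proj₂ L) L₂-unique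
            (λ i → let (_ , j , e) = ∈-map⁻ proj₂ i in subst (_∈ X) (sym e) (proj₂ (proj₁ (L⁻ j))))
            (λ i i′ → let (_ , j , e) = ∈-map⁻ proj₂ i ; (_ , j′ , e′) = ∈-map⁻ proj₂ i′ in
              subst₂ Meet (sym e) (sym e′) (L-meet j j′)))
          where
          L : List (Perm (3 * p) × Index)
          L = filter (λ σw → quotient σw ≟ᶠ y) (cartesianProduct F X)
          L⁻ : ∀ {σ w} → (σ , w) ∈ L → (σ ∈ F × w ∈ X) × element σ ≡ y ∙ elt w
          L⁻ {σ} {w} i = let (j , e) = ∈-filter⁻ (λ σw → quotient σw ≟ᶠ y) {xs = cartesianProduct F X} i
            in ∈-cartesianProduct⁻ F X j , trans (sym (identityʳ _)) (trans (cong (element σ ∙_) (sym (inverseˡ (elt w))))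
                 (trans (sym (assoc _ (elt w ⁻¹) (elt w))) (cong (_∙ elt w) e)))
          L-meet : ∀ {a b} → a ∈ L → b ∈ L → Meet (proj₂ a) (proj₂ b)
          L-meet {σ , w} {σ′ , w′} i i′ = let (ω , e) = common in ω , act-injective y
              (trans (sym (act-∙ y (elt w) ω)) (trans (cong (λ g → act g ω) (sym (proj₂ (L⁻ i)))) (trans (act-element (F⊆G (proj₁ (proj₁ (L⁻ i)))) ω)
              (trans e (trans (sym (act-element (F⊆G (proj₁ (proj₁ (L⁻ i′)))) ω)) (trans (cong (λ g → act g ω) (proj₂ (L⁻ i′))) (act-∙ y (elt w′) ω)))))))
            where
            common : Agree σ σ′
            common with σ ≟ᵖ σ′
            ... | yes refl = o , refl
            ... | no ne = agree (proj₁ (proj₁ (L⁻ i))) (proj₁ (proj₁ (L⁻ i′))) ne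
          L₂-unique : Unique (map proj₂ L)
          L₂-unique = map⁺-injectiveOn (Uniqueₚ.filter⁺ (λ σw → quotient σw ≟ᶠ y) pairs-unique)
            λ { {σ , w} {σ′ , .w} i j refl → cong (_, w) (trans (sym (perm-element (F⊆G (proj₁ (proj₁ (L⁻ i))))))
              (trans (cong perm (trans (proj₂ (L⁻ i)) (sym (proj₂ (L⁻ j))))) (perm-element (F⊆G (proj₁ (proj₁ (L⁻ j))))))) }

-- Assembling the density bound

module _ {p} (pr : Prime p) (5≤p : 5 ≤ p) (G : PermGroup (3 * p)) (transitive : Transitive G)
  (blk : Fin (3 * p) → Fin p) (size3 : ∀ b → blockSize blk b ≡ 3) (invariant : Invariant G blk)
  (fixed : ∀ {σ} → σ ∈ elems G → InKernel blk σ → ∃ λ ω → app σ ω ≡ ω)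
  (two : TwoTransitiveOnBlocks G blk)
  (N : PermGroup (3 * p)) (normal : Normal N G) (nontrivial : Nontrivial N)
  (N⊆K : ∀ {σ} → σ ∈ elems N → InKernel blk σ) (abelian : ElemAbelian3 N) where

  private
    open Coordinates pr 5≤p G transitive blk size3 invariant N normal N⊆K abelian

    n₀ : El
    n₀ = element (proj₁ nontrivial)

    perm-n₀ : perm n₀ ≡ proj₁ nontrivial
    perm-n₀ = perm-element (All.lookup (proj₁ normal) (proj₁ (proj₂ nontrivial)))

    n₀∈ : InN n₀
    n₀∈ = subst (_∈ elems N) (sym perm-n₀) (proj₁ (proj₂ nontrivial))

    n₀≢ε : n₀ ≢ ε
    n₀≢ε e = proj₂ (proj₂ nontrivial) (trans (sym perm-n₀) (trans (cong perm e) perm-ε))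

  -- If equality failed, a multiplier other than 1 would give the missing upper bound, so all
  -- multipliers would be 1, against `no-central`.
  densityOne : ∀ ω → DensityOne G ω
  densityOne ω = decidable-stable (maxIntersecting G ≟ stabSize G ω) λ ne →
      Burnside.no-central two λ h k mult → decidable-stable (k % p ≟ 1 % p) λ k≢1 →
        ne (≤-antisym (upper k≢1 (normalise {h} {k} mult)) (stabSize≤maxIntersecting G ω))
    where
    instance
      p≢0 : NonZero p
      p≢0 = prime⇒nonZero pr

    open Frame (proj₁ (cycle ω)) (proj₁ (proj₂ (cycle ω))) (proj₂ (proj₂ (cycle ω)))
      n₀ n₀∈ (proj₁ (moved n₀≢ε)) (proj₂ (moved n₀≢ε))

    x : El
    x = proj₁ (cycle ω)

    not-reversing : ∀ {k s} → Normaliser k s → ¬ k ≋ pred p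
    not-reversing {k} {s} (sx , s0) e = no-reversal two fixed
      (trans sx (cong (_∙ s) (x^-cong {k} {pred p} e)) , s0)

    upper : ∀ {k} → ¬ k ≋ 1 → ∃ (Normaliser k) → maxIntersecting G ≤ stabSize G ω
    upper {k} k≢1 (t , t-normal@(tx , t0)) = maxIntersecting≤ G λ F uF F⊆G agree →
        Count.intersecting-size (t ∙ t) (k * k) τ act-tt k²≢1 k⁴≢1 F uF F⊆G agree ω
      where
      T : F₃ → F₃
      T = tr t [ 0 ]ₚ
      -- `T` is affine with linear part ±1, so its square has linear part 1 and is the translation
      -- by this constant.
      τ : F₃
      τ = T 0₃ +₃ sg t [ 0 ]ₚ *₃ T 0₃
      T∘T : ∀ a → T (T a) ≡ a +₃ τ
      T∘T a = trans (tr-affine t [ 0 ]ₚ (T a)) (trans (cong (λ z → T 0₃ +₃ sg t [ 0 ]ₚ *₃ z) (tr-affine t [ 0 ]ₚ a))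
        (alg (T 0₃) (sg t [ 0 ]ₚ) a (sg² t [ 0 ]ₚ)))
        where
        alg : ∀ c s a → s *₃ s ≡ 1₃ → c +₃ s *₃ (c +₃ s *₃ a) ≡ a +₃ (c +₃ s *₃ c)
        alg = toWitness {a? = all? λ c → all? λ s → all? λ a → (s *₃ s ≟ᶠ 1₃) →-dec
          (c +₃ s *₃ (c +₃ s *₃ a) ≟ᶠ a +₃ (c +₃ s *₃ c))} _
      act-tt : ∀ i a → act (t ∙ t) (P i a) ≡ P [ k * k * toℕ i ]ₚ (a +₃ τ)
      act-tt i a = begin
        act (t ∙ t) (P i a)                           ≡⟨ act-∙ t t (P i a) ⟩
        act t (act t (P i a))                         ≡⟨ cong (act t) (act-twist {t} {k} tx t0 i a) ⟩
        act t (P [ k * toℕ i ]ₚ (T a))                ≡⟨ act-twist {t} {k} tx t0 [ k * toℕ i ]ₚ (T a) ⟩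
        P [ k * toℕ [ k * toℕ i ]ₚ ]ₚ (T (T a))       ≡⟨ cong₂ P ([]-cong {k * toℕ [ k * toℕ i ]ₚ} {k * k * toℕ i} (trans
                                                           (≋-* {k} {k} {toℕ [ k * toℕ i ]ₚ} {k * toℕ i} refl (toℕ-[]-≋ (k * toℕ i)))
                                                           (cong (_% p) (sym (*-assoc k k (toℕ i)))))) (T∘T a) ⟩
        P [ k * k * toℕ i ]ₚ (a +₃ τ)                 ∎
        where open ≡-Reasoning
      tt-normal : Normaliser (k * k) (t ∙ t)
      tt-normal = trans (assoc t t x) (trans (cong (t ∙_) tx) (trans (sym (assoc t (x ^ k) t))
          (trans (cong (_∙ t) (^-twist tx k)) (assoc (x ^ (k * k)) t t)))) ,
        trans (bl-∙ t t [ 0 ]ₚ) (trans (cong (bl t) t0) t0)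
      k²≢1 : ¬ k * k ≋ 1
      k²≢1 e = case square-one {k} e of λ
        { (inj₁ q) → k≢1 q
        ; (inj₂ q) → not-reversing {k} {t} t-normal q }
      -- The exclusion of -1 is used a second time, for the normaliser t² with multiplier k².
      k⁴≢1 : ¬ (k * k) * (k * k) ≋ 1
      k⁴≢1 e = case square-one {k * k} e of λ
        { (inj₁ q) → k²≢1 q
        ; (inj₂ q) → not-reversing {k * k} {t ∙ t} tt-normal q }

theorem9p3 : (p : ℕ) → Prime p → 5 ≤ p →
    (G : PermGroup (3 * p)) → Transitive G →
    (blk : Fin (3 * p) → Fin p) →
    (∀ (b : Fin p) → blockSize blk b ≡ 3) →
    Invariant G blk →
    (∀ (lab : Fin (3 * p) → Fin (3 * p)) → Invariant G lab → NontrivialPartition lab →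
    SamePartition lab blk) →
    (∃ λ σ → σ ∈ elems G × InKernel blk σ × σ ≢ idP) →
    (∀ {σ} → σ ∈ elems G → InKernel blk σ → ∃ λ (ω : Fin (3 * p)) → app σ ω ≡ ω) →
    (∀ (N : PermGroup (3 * p)) → MinimalNormal N G →
    (∀ {σ} → σ ∈ elems N → InKernel blk σ) → ElemAbelian3 N) →
    TwoTransitiveOnBlocks G blk →
    ¬ Exception G blk →
    ∀ (ω : Fin (3 * p)) → DensityOne G ω
theorem9p3 p pr 5≤p G transitive blk size3 invariant _ (σ , σ∈ , σ-kernel , σ≢id) fixed minimal two _ ω =
  decidable-stable (maxIntersecting G ≟ stabSize G ω) λ ne →
    -- The descent starts at the whole kernel and stays inside it, so the hypothesis on minimal
    -- normal subgroups covers its outcome.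
    ¬¬-minimalNormal {G = G} {P = InKernel blk} Kernel Kernel-normal
      (σ , ∈-filter⁺ inKernel? σ∈ σ-kernel , σ≢id) (proj₂ ∘ ∈Kernel⁻)
      λ (N , mN@(normal , nontrivial , _) , N⊆K) →
        ne (densityOne pr 5≤p G transitive blk size3 invariant fixed two N normal nontrivial N⊆K
              (minimal N mN N⊆K) ω)
  where open PrimeBlocks pr 5≤p G transitive blk size3 invariant
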